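{- Testing uniformity can be done using $\mathrm{poly}(\log n,\epsilon^{ -1},\log(\delta^{ -1}))$ non-adaptive conditional samples. That is, there is a polynomial $p$ and a non-adaptive distribution tester for the property of being the uniform distribution over $[n]$ such that for all $\epsilon,\delta\in(0,1)$ and all $n$ the tester makes at most $p(\log n,\epsilon^{ -1},\log(\delta^{ -1}))$ conditional samples.
   Context: $[n]=\{1,\ldots,n\}$. A conditional sampling oracle for a distribution $\mu$ over $[n]$ takes a nonempty set $A\subseteq[n]$ and returns $j\in A$ with probability $\mu(j)/\mu(A)$ if $\mu(A)>0$, and a uniformly random member of $A$ if $\mu(A)=0$, independently of all previous samples. The variation distance is $d(\mu,\mu')=\frac12\sum_{i=1}^n|\mu(i)-\mu'(i)|$. A property $\mathcal P$ is a set of distributions over $[n]$; $\mu$ is $\epsilon$-far from $\mathcal P$ if $d(\mu,\mu')\ge\epsilon$ for every $\mu'\in\mathcal P$. A non-adaptive distribution tester for $\mathcal P$ with conditional sample complexity $t(\epsilon,\delta,n)$ is a randomized algorithm that receives $\epsilon,\delta>0$, $n\in\mathbb N$ and a conditional sampling oracle for an unknown distribution $\mu$ over $[n]$. It first generates (before receiving any sample) a sequence of $t\le t(\epsilon,\delta,n)$ sets $A_1,\ldots,A_t\subseteq[n]$, then calls the oracle on $A_1,\ldots,A_t$ to receive $j_1,\ldots,j_t$, and then accepts or rejects based on $j_1,\ldots,j_t$ and its internal coin tosses. If $\mu\in\mathcal P$ it must accept with probability at least $1-\delta$; if $\mu$ is $\epsilon$-far from $\mathcal P$ it must reject with probability at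 least $1-\delta$. -}

module Defs where

open import Algebra.Bundles using (CommutativeRing)
open import Data.Bool using (Bool; true; false; not; if_then_else_)
open import Data.Fin using (Fin)
open import Data.Fin.Properties using (nonZeroIndex)
open import Data.Fin.Subset as Subset using (Subset; Nonempty; _∈_; _∉_)
open import Data.Fin.Subset.Properties using (x∈p⇒∣p-x∣<∣p∣)
open import Data.Integer as ℤ using (+_; +≤+)
import Data.Integer.Properties as ℤ
open import Data.List using (List; []; _∷_; length; foldr)
open import Data.Nat as ℕ using (ℕ; zero; suc)
open import Data.Nat.Coprimality using (1-coprimeTo) renaming (sym to coprime-sym)
import Data.Nat.Properties as ℕ
open import Data.Product using (∃; _×_; _,_; proj₁; proj₂)
open import Data.Rational as ℚ using (ℚ; 0ℚ; 1ℚ; ½; mkℚ)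
import Data.Rational.Properties as ℚ
open import Data.Rational.Solver using (module +-*-Solver)
open import Data.Sum using (_⊎_; inj₁; inj₂)
open import Data.Vec as Vec using (Vec; []; _∷_)
import Data.Vec.Functional as Vector
open import Relation.Binary.PropositionalEquality
  using (_≡_; refl; sym; cong; cong₂; trans; subst; subst₂)
open import Relation.Nullary using (yes; no; ¬_; contradiction)
open import Relation.Unary using (Decidable)

open import Algebra.Properties.CommutativeSemiring.Exp
  (CommutativeRing.commutativeSemiring ℚ.+-*-commutativeRing)
  using ()
  renaming (_^_ to _^ℚ_; ^-assocʳ to ^ℚ-assoc; ^-distrib-* to ^ℚ-distrib)
open +-*-Solver using (solve; _:=_; _:+_; _:*_; :-_; _:-_; con)

ι : ℕ → ℚ
ι n = mkℚ (+ n) 0 (coprime-sym (1-coprimeTo n))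

module RationalLemmas where
  open import Data.Rational using (_≤_; _<_; _/_; _+_; _*_; _-_; -_; ∣_∣; positive; nonNegative)

  ι-mono : ∀ {m n} → m ℕ.≤ n → ι m ≤ ι n
  ι-mono m≤n = ℚ.*≤* (ℤ.*-monoʳ-≤-nonNeg (+ 1) (+≤+ m≤n))

  ι-cancel : ∀ {m n} → ι m ≤ ι n → m ℕ.≤ n
  ι-cancel {m} {n} (ℚ.*≤* q) =
    ℤ.drop‿+≤+ (subst₂ ℤ._≤_ (ℤ.*-identityʳ (+ m)) (ℤ.*-identityʳ (+ n)) q)

  ι≡n/1 : ∀ n → ι n ≡ + n / 1
  ι≡n/1 n = sym (ℚ.normalize-coprime (coprime-sym (1-coprimeTo n)))

  ι-+ : ∀ m n → ι (m ℕ.+ n) ≡ ι m + ι n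
  ι-+ m n = trans (ι≡n/1 (m ℕ.+ n))
    (cong (_/ 1) (sym (cong₂ ℤ._+_ (ℤ.*-identityʳ (+ m)) (ℤ.*-identityʳ (+ n)))))

  ι-* : ∀ m n → ι (m ℕ.* n) ≡ ι m * ι n
  ι-* m n = trans (ι≡n/1 (m ℕ.* n)) (cong (_/ 1) (ℤ.pos-* m n))

  ι-^ : ∀ m k → ι (m ℕ.^ k) ≡ ι m ^ℚ k
  ι-^ m zero    = refl
  ι-^ m (suc k) = trans (ι-* m (m ℕ.^ k)) (cong (ι m *_) (ι-^ m k))

  0≤ι : ∀ n → 0ℚ ≤ ι n
  0≤ι n = ι-mono ℕ.z≤n

  0<ι-suc : ∀ k → 0ℚ < ι (suc k)
  0<ι-suc k = ℚ.≰⇒> λ p → ℕ.<⇒≱ (ℕ.s≤s ℕ.z≤n) (ι-cancel p)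

  archimedean : ∀ q → ∃ λ n → q ≤ ι n
  archimedean q@(mkℚ i d _) = ℤ.∣ i ∣ , ℚ.*≤* bound
    where
    open ℤ.≤-Reasoning
    i≤∣i∣ : ∀ j → j ℤ.≤ + ℤ.∣ j ∣
    i≤∣i∣ (+ n)      = ℤ.≤-refl
    i≤∣i∣ ℤ.-[1+ n ] = ℤ.-≤+
    bound : i ℤ.* + 1 ℤ.≤ + ℤ.∣ i ∣ ℤ.* + suc d
    bound = begin
      i ℤ.* + 1               ≡⟨ ℤ.*-identityʳ i ⟩
      i                       ≤⟨ i≤∣i∣ i ⟩
      + ℤ.∣ i ∣               ≤⟨ +≤+ (ℕ.m≤m*n ℤ.∣ i ∣ (suc d)) ⟩
      + (ℤ.∣ i ∣ ℕ.* suc d)   ≡⟨ ℤ.pos-* ℤ.∣ i ∣ (suc d) ⟩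
      + ℤ.∣ i ∣ ℤ.* + suc d   ∎

  *-monoˡ : ∀ {r p q} → 0ℚ ≤ r → p ≤ q → r * p ≤ r * q
  *-monoˡ {r} 0≤r = ℚ.*-monoˡ-≤-nonNeg r {{nonNegative 0≤r}}

  *-mono : ∀ {p q r s} → 0ℚ ≤ p → 0ℚ ≤ s → p ≤ q → r ≤ s → p * r ≤ q * s
  *-mono {p} {q} {r} {s} 0≤p 0≤s p≤q r≤s =
    ℚ.≤-trans (*-monoˡ 0≤p r≤s) (ℚ.*-monoʳ-≤-nonNeg s {{nonNegative 0≤s}} p≤q)

  *-pos : ∀ {p q} → 0ℚ < p → 0ℚ < q → 0ℚ < p * q
  *-pos {p} {q} 0<p 0<q =
    ℚ.positive⁻¹ (p * q) {{ℚ.pos*pos⇒pos p {{positive 0<p}} q {{positive 0<q}}}}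

  *-nonneg : ∀ {p q} → 0ℚ ≤ p → 0ℚ ≤ q → 0ℚ ≤ p * q
  *-nonneg {p} {q} 0≤p 0≤q = subst (_≤ p * q) (ℚ.*-zeroʳ p) (*-monoˡ 0≤p 0≤q)

  ½-pos : ∀ {p} → 0ℚ < p → 0ℚ < p * ½
  ½-pos 0<p = *-pos 0<p (ℚ.positive⁻¹ ½)

  halves : ∀ p → p * ½ + p * ½ ≡ p
  halves = solve 1 (λ p → p :* con ½ :+ p :* con ½ := p) refl

  ∣∣≤ : ∀ {p q} → p ≤ q → - p ≤ q → ∣ p ∣ ≤ q
  ∣∣≤ {p} {q} h₁ h₂ with ℚ.∣p∣≡p∨∣p∣≡-p p
  ... | inj₁ e = subst (_≤ q) (sym e) h₁
  ... | inj₂ e = subst (_≤ q) (sym e) h₂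

  ∣∣-swap : ∀ p q → ∣ p - q ∣ ≡ ∣ q - p ∣
  ∣∣-swap p q = trans (sym (ℚ.∣-p∣≡∣p∣ (p - q)))
    (cong ∣_∣ (solve 2 (λ p q → :- (p :- q) := q :- p) refl p q))

  p≤∣p∣ : ∀ p → p ≤ ∣ p ∣
  p≤∣p∣ p with ℚ.≤-total 0ℚ p
  ... | inj₁ 0≤p = ℚ.≤-reflexive (sym (ℚ.0≤p⇒∣p∣≡p 0≤p))
  ... | inj₂ p≤0 = ℚ.≤-trans p≤0 (ℚ.0≤∣p∣ p)

  ∣-∣≤⇒≤+ : ∀ {p q r} → ∣ p - q ∣ ≤ r → p ≤ q + r
  ∣-∣≤⇒≤+ {p} {q} {r} h = begin
    p             ≡⟨ solve 2 (λ p q → p := q :+ (p :- q)) refl p q ⟩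
    q + (p - q)   ≤⟨ ℚ.+-monoʳ-≤ q (ℚ.≤-trans (p≤∣p∣ (p - q)) h) ⟩
    q + r         ∎
    where open ℚ.≤-Reasoning

  ∣∣-reverse : ∀ p q → ∣ ∣ p ∣ - ∣ q ∣ ∣ ≤ ∣ p - q ∣
  ∣∣-reverse p q = ∣∣≤ (half p q) (begin
    - (∣ p ∣ - ∣ q ∣)   ≡⟨ solve 2 (λ p q → :- (p :- q) := q :- p) refl ∣ p ∣ ∣ q ∣ ⟩
    ∣ q ∣ - ∣ p ∣       ≤⟨ half q p ⟩
    ∣ q - p ∣           ≡⟨ ∣∣-swap q p ⟩
    ∣ p - q ∣           ∎)
    where
    open ℚ.≤-Reasoning
    half : ∀ p q → ∣ p ∣ - ∣ q ∣ ≤ ∣ p - q ∣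
    half p q = begin
      ∣ p ∣ - ∣ q ∣
        ≡⟨ cong (λ z → ∣ z ∣ - ∣ q ∣) (solve 2 (λ p q → p := (p :- q) :+ q) refl p q) ⟩
      ∣ (p - q) + q ∣ - ∣ q ∣
        ≤⟨ ℚ.+-monoˡ-≤ (- ∣ q ∣) (ℚ.∣p+q∣≤∣p∣+∣q∣ (p - q) q) ⟩
      ∣ p - q ∣ + ∣ q ∣ - ∣ q ∣
        ≡⟨ solve 2 (λ a b → (a :+ b) :- b := a) refl ∣ p - q ∣ ∣ q ∣ ⟩
      ∣ p - q ∣ ∎

  ^-nonneg : ∀ {a} k → 0ℚ ≤ a → 0ℚ ≤ a ^ℚ k
  ^-nonneg zero    _   = ℚ.nonNegative⁻¹ 1ℚ
  ^-nonneg (suc k) 0≤a = *-nonneg 0≤a (^-nonneg k 0≤a)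

  ^-mono : ∀ {a b} k → 0ℚ ≤ a → a ≤ b → a ^ℚ k ≤ b ^ℚ k
  ^-mono zero    _   _   = ℚ.≤-refl
  ^-mono (suc k) 0≤a a≤b =
    *-mono 0≤a (^-nonneg k (ℚ.≤-trans 0≤a a≤b)) a≤b (^-mono k 0≤a a≤b)

  ^-pos : ∀ {a} k → 0ℚ < a → 0ℚ < a ^ℚ k
  ^-pos zero    _   = ℚ.positive⁻¹ 1ℚ
  ^-pos (suc k) 0<a = *-pos 0<a (^-pos k 0<a)

  ^-cancel : ∀ {a b} k → 0ℚ ≤ b → a ^ℚ suc k ≤ b ^ℚ suc k → a ≤ b
  ^-cancel {a} {b} k 0≤b h with a ℚ.≤? b
  ... | yes a≤b = a≤b
  ... | no  a≰b = contradiction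
    (ℚ.<-≤-trans (ℚ.*-monoˡ-<-pos (a ^ℚ k) {{positive (^-pos k (ℚ.≤-<-trans 0≤b b<a))}} b<a) h')
    (ℚ.<-irrefl refl)
    where
    b<a = ℚ.≰⇒> a≰b
    h' : a * a ^ℚ k ≤ b * a ^ℚ k
    h' = ℚ.≤-trans h (*-monoˡ 0≤b (^-mono k 0≤b (ℚ.<⇒≤ b<a)))

IsCauchy : (ℕ → ℚ) → Set
IsCauchy x = ∀ η → 0ℚ ℚ.< η →
  ∃ λ N → ∀ m n → N ℕ.≤ m → N ℕ.≤ n → ℚ.∣ x m ℚ.- x n ∣ ℚ.≤ η

-- Cauchy sequences of rationals; real numbers are these up to _≃_.
record ℝ : Set where
  constructor real
  field
    seq    : ℕ → ℚ
    cauchy : IsCauchy seq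
open ℝ public

Eventually : (ℕ → Set) → Set
Eventually P = ∃ λ N → ∀ n → N ℕ.≤ n → P n

infix 4 _≤_ _<_ _≃_

record _≤_ (x y : ℝ) : Set where
  constructor *≤*
  field
    approx : ∀ η → 0ℚ ℚ.< η → Eventually λ n → seq x n ℚ.≤ seq y n ℚ.+ η

record _<_ (x y : ℝ) : Set where
  constructor *<*
  field
    gap        : ℚ
    gap>0      : 0ℚ ℚ.< gap
    eventually : Eventually λ n → seq x n ℚ.+ gap ℚ.≤ seq y n

_≃_ : ℝ → ℝ → Set
x ≃ y = x ≤ y × y ≤ x

module CauchyProofs where
  open import Data.Rational using (_+_; _*_; _-_; -_; ∣_∣; positive; nonNegative)
  open RationalLemmas
  open ℚ.≤-Reasoning

  both : ∀ {P Q : ℕ → Set} → Eventually P → Eventually Q → Eventually λ n → P n × Q n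
  both (M , p) (N , q) = M ℕ.⊔ N , λ n h →
    p n (ℕ.≤-trans (ℕ.m≤m⊔n M N) h) , q n (ℕ.≤-trans (ℕ.m≤n⊔m M N) h)

  const-cauchy : ∀ q → IsCauchy λ _ → q
  const-cauchy q η 0<η = 0 , λ _ _ _ _ →
    subst (ℚ._≤ η) (sym (cong ∣_∣ (ℚ.+-inverseʳ q))) (ℚ.<⇒≤ 0<η)

  +-cauchy : ∀ x y → IsCauchy x → IsCauchy y → IsCauchy λ n → x n + y n
  +-cauchy x y cx cy η 0<η with cx (η * ½) (½-pos 0<η) | cy (η * ½) (½-pos 0<η)
  ... | M , p | N , q = M ℕ.⊔ N , λ m n hm hn → begin
    ∣ (x m + y m) - (x n + y n) ∣
      ≡⟨ cong ∣_∣ (solve 4 (λ a b c d → (a :+ b) :- (c :+ d) := (a :- c) :+ (b :- d)) refl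
           (x m) (y m) (x n) (y n)) ⟩
    ∣ (x m - x n) + (y m - y n) ∣
      ≤⟨ ℚ.∣p+q∣≤∣p∣+∣q∣ (x m - x n) (y m - y n) ⟩
    ∣ x m - x n ∣ + ∣ y m - y n ∣
      ≤⟨ ℚ.+-mono-≤ (p m n (ℕ.≤-trans (ℕ.m≤m⊔n M N) hm) (ℕ.≤-trans (ℕ.m≤m⊔n M N) hn))
                    (q m n (ℕ.≤-trans (ℕ.m≤n⊔m M N) hm) (ℕ.≤-trans (ℕ.m≤n⊔m M N) hn)) ⟩
    η * ½ + η * ½
      ≡⟨ halves η ⟩
    η ∎

  neg-cauchy : ∀ x → IsCauchy x → IsCauchy λ n → - x n
  neg-cauchy x cx η 0<η with cx η 0<η
  ... | N , p = N , λ m n hm hn → begin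
    ∣ - x m - - x n ∣   ≡⟨ cong ∣_∣ (solve 2 (λ a b → :- a :- :- b := b :- a) refl (x m) (x n)) ⟩
    ∣ x n - x m ∣       ≤⟨ p n m hn hm ⟩
    η                   ∎

  abs-cauchy : ∀ x → IsCauchy x → IsCauchy λ n → ∣ x n ∣
  abs-cauchy x cx η 0<η with cx η 0<η
  ... | N , p = N , λ m n hm hn → ℚ.≤-trans (∣∣-reverse (x m) (x n)) (p m n hm hn)

  bounded : ∀ x → IsCauchy x → ∃ λ B → Eventually λ n → ∣ x n ∣ ℚ.≤ ι (suc B)
  bounded x cx with cx 1ℚ (ℚ.positive⁻¹ 1ℚ)
  ... | N , p with archimedean ∣ x N ∣
  ... | B , h = B , N , λ n hn → begin
    ∣ x n ∣                       ≡⟨ cong ∣_∣ (solve 2 (λ a b → a := (a :- b) :+ b) refl (x n) (x N)) ⟩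
    ∣ (x n - x N) + x N ∣         ≤⟨ ℚ.∣p+q∣≤∣p∣+∣q∣ (x n - x N) (x N) ⟩
    ∣ x n - x N ∣ + ∣ x N ∣       ≤⟨ ℚ.+-mono-≤ (p n N hn ℕ.≤-refl) h ⟩
    1ℚ + ι B                      ≡⟨ ι-+ 1 B ⟨
    ι (suc B)                     ∎

  frac : ℚ → ℕ → ℚ
  frac η B = η * ℚ.1/ ι (suc B)

  frac-pos : ∀ {η} B → 0ℚ ℚ.< η → 0ℚ ℚ.< frac η B
  frac-pos B 0<η = *-pos 0<η (ℚ.positive⁻¹ (ℚ.1/ ι (suc B)))

  frac-* : ∀ η B → ι (suc B) * frac η B ≡ η
  frac-* η B = trans
    (solve 3 (λ b η c → b :* (η :* c) := η :* (b :* c)) refl (ι (suc B)) η (ℚ.1/ ι (suc B)))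
    (trans (cong (η *_) (ℚ.*-inverseʳ (ι (suc B)))) (ℚ.*-identityʳ η))

  product-close : ∀ a b c d {A B η₁ η₂} → 0ℚ ℚ.≤ η₁ → 0ℚ ℚ.≤ η₂ →
    ∣ a ∣ ℚ.≤ A → ∣ d ∣ ℚ.≤ B → ∣ b - d ∣ ℚ.≤ η₁ → ∣ a - c ∣ ℚ.≤ η₂ →
    ∣ a * b - c * d ∣ ℚ.≤ A * η₁ + B * η₂
  product-close a b c d {A} {B} {η₁} {η₂} 0≤η₁ 0≤η₂ hA hB h₁ h₂ = begin
    ∣ a * b - c * d ∣
      ≡⟨ cong ∣_∣ (solve 4 (λ a b c d → a :* b :- c :* d := a :* (b :- d) :+ d :* (a :- c)) refl a b c d) ⟩
    ∣ a * (b - d) + d * (a - c) ∣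
      ≤⟨ ℚ.∣p+q∣≤∣p∣+∣q∣ (a * (b - d)) (d * (a - c)) ⟩
    ∣ a * (b - d) ∣ + ∣ d * (a - c) ∣
      ≡⟨ cong₂ _+_ (ℚ.∣p*q∣≡∣p∣*∣q∣ a (b - d)) (ℚ.∣p*q∣≡∣p∣*∣q∣ d (a - c)) ⟩
    ∣ a ∣ * ∣ b - d ∣ + ∣ d ∣ * ∣ a - c ∣
      ≤⟨ ℚ.+-mono-≤ (*-mono (ℚ.0≤∣p∣ a) 0≤η₁ hA h₁) (*-mono (ℚ.0≤∣p∣ d) 0≤η₂ hB h₂) ⟩
    A * η₁ + B * η₂ ∎

  *-cauchy : ∀ x y → IsCauchy x → IsCauchy y → IsCauchy λ n → x n * y n
  *-cauchy x y cx cy η 0<η = (M₁ ℕ.⊔ N₁) ℕ.⊔ (M₂ ℕ.⊔ N₂) , close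
    where
    A = proj₁ (bounded x cx)
    B = proj₁ (bounded y cy)
    M₁ = proj₁ (proj₂ (bounded x cx))
    N₁ = proj₁ (proj₂ (bounded y cy))
    η₁ = frac (η * ½) A
    η₂ = frac (η * ½) B
    0<η₁ : 0ℚ ℚ.< η₁
    0<η₁ = frac-pos A (½-pos 0<η)
    0<η₂ : 0ℚ ℚ.< η₂
    0<η₂ = frac-pos B (½-pos 0<η)
    M₂ = proj₁ (cx η₂ 0<η₂)
    N₂ = proj₁ (cy η₁ 0<η₁)
    split : ∀ {m} → (M₁ ℕ.⊔ N₁) ℕ.⊔ (M₂ ℕ.⊔ N₂) ℕ.≤ m →
            (M₁ ℕ.≤ m × N₁ ℕ.≤ m) × (M₂ ℕ.≤ m × N₂ ℕ.≤ m)
    split h =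
      let h₁ = ℕ.m⊔n≤o⇒m≤o (M₁ ℕ.⊔ N₁) (M₂ ℕ.⊔ N₂) h
          h₂ = ℕ.m⊔n≤o⇒n≤o (M₁ ℕ.⊔ N₁) (M₂ ℕ.⊔ N₂) h
      in (ℕ.m⊔n≤o⇒m≤o M₁ N₁ h₁ , ℕ.m⊔n≤o⇒n≤o M₁ N₁ h₁) ,
         (ℕ.m⊔n≤o⇒m≤o M₂ N₂ h₂ , ℕ.m⊔n≤o⇒n≤o M₂ N₂ h₂)
    sum-η : ι (suc A) * η₁ + ι (suc B) * η₂ ≡ η
    sum-η = trans (cong₂ _+_ (frac-* (η * ½) A) (frac-* (η * ½) B)) (halves η)
    close : ∀ m n → _ → _ → ∣ x m * y m - x n * y n ∣ ℚ.≤ η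
    close m n hm hn =
      let ((M₁≤m , _) , (M₂≤m , N₂≤m)) = split hm
          ((_ , N₁≤n) , (M₂≤n , N₂≤n)) = split hn
      in subst (∣ x m * y m - x n * y n ∣ ℚ.≤_) sum-η
           (product-close (x m) (y m) (x n) (y n) (ℚ.<⇒≤ 0<η₁) (ℚ.<⇒≤ 0<η₂)
             (proj₂ (proj₂ (bounded x cx)) m M₁≤m) (proj₂ (proj₂ (bounded y cy)) n N₁≤n)
             (proj₂ (cy η₁ 0<η₁) m n N₂≤m N₂≤n) (proj₂ (cx η₂ 0<η₂) m n M₂≤m M₂≤n))

  -- Total on ℚ, with 1/₀ 0 = 0, so that a real which is eventually bounded away
  -- from 0 can be inverted termwise.
  1/₀ : ℚ → ℚ
  1/₀ q with q ℚ.≟ 0ℚ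
  ... | yes _   = 0ℚ
  ... | no  q≢0 = (ℚ.1/ q) {{ℚ.≢-nonZero q≢0}}

  1/₀-inverse : ∀ {q} → 0ℚ ℚ.< q → q * 1/₀ q ≡ 1ℚ
  1/₀-inverse {q} 0<q with q ℚ.≟ 0ℚ
  ... | yes refl = contradiction 0<q (ℚ.<-irrefl refl)
  ... | no  q≢0  = ℚ.*-inverseʳ q {{ℚ.≢-nonZero q≢0}}

  inverse-close : ∀ a b a' b' {c η} → 0ℚ ℚ.< c → c ℚ.≤ a → c ℚ.≤ b →
    a * a' ≡ 1ℚ → b * b' ≡ 1ℚ → ∣ b - a ∣ ℚ.≤ η * (c * c) → ∣ a' - b' ∣ ℚ.≤ η
  inverse-close a b a' b' {c} {η} 0<c c≤a c≤b aa' bb' h =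
    ℚ.*-cancelʳ-≤-pos (c * c) {{positive (*-pos 0<c 0<c)}} (begin
      ∣ a' - b' ∣ * (c * c)
        ≤⟨ *-monoˡ (ℚ.0≤∣p∣ (a' - b')) (*-mono (ℚ.<⇒≤ 0<c) 0≤b c≤a c≤b) ⟩
      ∣ a' - b' ∣ * (a * b)
        ≡⟨ cong (∣ a' - b' ∣ *_) (ℚ.0≤p⇒∣p∣≡p (*-nonneg 0≤a 0≤b)) ⟨
      ∣ a' - b' ∣ * ∣ a * b ∣
        ≡⟨ ℚ.∣p*q∣≡∣p∣*∣q∣ (a' - b') (a * b) ⟨
      ∣ (a' - b') * (a * b) ∣
        ≡⟨ cong ∣_∣ (solve 4 (λ a b a' b' →
             (a' :- b') :* (a :* b) := b :* (a :* a') :- a :* (b :* b')) refl a b a' b') ⟩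
      ∣ b * (a * a') - a * (b * b') ∣
        ≡⟨ cong₂ (λ s t → ∣ b * s - a * t ∣) aa' bb' ⟩
      ∣ b * 1ℚ - a * 1ℚ ∣
        ≡⟨ cong₂ (λ s t → ∣ s - t ∣) (ℚ.*-identityʳ b) (ℚ.*-identityʳ a) ⟩
      ∣ b - a ∣
        ≤⟨ h ⟩
      η * (c * c) ∎)
    where
    0≤a : 0ℚ ℚ.≤ a
    0≤a = ℚ.≤-trans (ℚ.<⇒≤ 0<c) c≤a
    0≤b : 0ℚ ℚ.≤ b
    0≤b = ℚ.≤-trans (ℚ.<⇒≤ 0<c) c≤b

  inv-cauchy : ∀ x {c} → IsCauchy x → 0ℚ ℚ.< c → Eventually (λ n → c ℚ.≤ x n) →
               IsCauchy λ n → 1/₀ (x n)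
  inv-cauchy x {c} cx 0<c (M , p) η 0<η = M ℕ.⊔ N , λ m n hm hn →
    let c≤xm = p m (ℕ.m⊔n≤o⇒m≤o M N hm)
        c≤xn = p n (ℕ.m⊔n≤o⇒m≤o M N hn)
    in inverse-close (x m) (x n) (1/₀ (x m)) (1/₀ (x n)) 0<c c≤xm c≤xn
         (1/₀-inverse (ℚ.<-≤-trans 0<c c≤xm)) (1/₀-inverse (ℚ.<-≤-trans 0<c c≤xn))
         (q n m (ℕ.m⊔n≤o⇒n≤o M N hn) (ℕ.m⊔n≤o⇒n≤o M N hm))
    where
    0<ηcc = *-pos 0<η (*-pos 0<c 0<c)
    N = proj₁ (cx (η * (c * c)) 0<ηcc)
    q = proj₂ (cx (η * (c * c)) 0<ηcc)

open CauchyProofs public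

fromℚ : ℚ → ℝ
fromℚ q = real (λ _ → q) (const-cauchy q)

fromℕ : ℕ → ℝ
fromℕ n = fromℚ (ι n)

0ℝ 1ℝ : ℝ
0ℝ = fromℕ 0
1ℝ = fromℕ 1

infixl 6 _+_ _-_
infixl 7 _*_
infixr 8 _^_
infix  9 _⁻¹⟨_⟩

-- Opaque: unfolding the Cauchy proofs makes type checking intractable.  The
-- seq-… lemmas describe the results.
opaque
  _+_ : ℝ → ℝ → ℝ
  x + y = real (λ n → seq x n ℚ.+ seq y n) (+-cauchy (seq x) (seq y) (cauchy x) (cauchy y))

  _*_ : ℝ → ℝ → ℝ
  x * y = real (λ n → seq x n ℚ.* seq y n) (*-cauchy (seq x) (seq y) (cauchy x) (cauchy y))

  _-_ : ℝ → ℝ → ℝ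
  x - y = real (λ n → seq x n ℚ.- seq y n) (+-cauchy (seq x) (λ n → ℚ.- seq y n) (cauchy x) (neg-cauchy (seq y) (cauchy y)))

  ∣_∣ : ℝ → ℝ
  ∣ x ∣ = real (λ n → ℚ.∣ seq x n ∣) (abs-cauchy (seq x) (cauchy x))

  _⁻¹⟨_⟩ : (x : ℝ) → 0ℝ < x → ℝ
  x ⁻¹⟨ *<* c 0<c (N , c≤x) ⟩ = real (λ n → 1/₀ (seq x n))
    (inv-cauchy (seq x) (cauchy x) 0<c (N , λ n N≤n → subst (ℚ._≤ seq x n) (ℚ.+-identityˡ c) (c≤x n N≤n)))

  seq-+ : ∀ x y n → seq (x + y) n ≡ seq x n ℚ.+ seq y n
  seq-+ x y n = refl

  seq-* : ∀ x y n → seq (x * y) n ≡ seq x n ℚ.* seq y n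
  seq-* x y n = refl

  seq-- : ∀ x y n → seq (x - y) n ≡ seq x n ℚ.- seq y n
  seq-- x y n = refl

  seq-∣∣ : ∀ x n → seq ∣ x ∣ n ≡ ℚ.∣ seq x n ∣
  seq-∣∣ x n = refl

  seq-⁻¹ : ∀ x x>0 n → seq (x ⁻¹⟨ x>0 ⟩) n ≡ 1/₀ (seq x n)
  seq-⁻¹ x x>0 n = refl

_^_ : ℝ → ℕ → ℝ
x ^ zero  = 1ℝ
x ^ suc k = x * x ^ k

-- ℓ = log₂ y for y ≥ 1, by the Dedekind cut of ℓ: for rationals p / q ≥ 0,
-- p / q < ℓ implies 2 ^ (p / q) ≤ y, and ℓ < p / q implies y ≤ 2 ^ (p / q).
record IsLog₂ (y ℓ : ℝ) : Set where
  field
    nonneg : 0ℝ ≤ ℓ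
    lower  : ∀ p q → fromℕ p < fromℕ q * ℓ → fromℕ (2 ℕ.^ p) ≤ y ^ q
    upper  : ∀ p q → fromℕ q * ℓ < fromℕ p → y ^ q ≤ fromℕ (2 ℕ.^ p)

module LogProofs where
  open import Data.Rational using (positive; nonNegative) renaming (_+_ to _⊕_; _*_ to _⊛_; _-_ to _⊖_; _≤_ to _≼_; _<_ to _≺_)
  open RationalLemmas
  open ℚ.≤-Reasoning

  seq-^ : ∀ x k n → seq (x ^ k) n ≡ seq x n ^ℚ k
  seq-^ x zero    n = refl
  seq-^ x (suc k) n = trans (seq-* x (x ^ k) n) (cong (seq x n ⊛_) (seq-^ x k n))

  exact : ∀ {x y} → Eventually (λ n → seq x n ≼ seq y n) → x ≤ y
  exact {x} {y} (N , h) = *≤* λ η 0<η → N , λ n N≤n → ℚ.≤-trans (h n N≤n) (begin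
    seq y n        ≡⟨ ℚ.+-identityʳ (seq y n) ⟨
    seq y n ⊕ 0ℚ   ≤⟨ ℚ.+-monoʳ-≤ (seq y n) (ℚ.<⇒≤ 0<η) ⟩
    seq y n ⊕ η    ∎)

  least : ∀ {P : ℕ → Set} → Decidable P → ∀ b → P b → ∃ λ a → P a × (a ≡ 0 ⊎ ∃ λ a' → a ≡ suc a' × ¬ P a')
  least P? zero    p = zero , p , inj₁ refl
  least P? (suc b) p with P? b
  ... | yes p' = least P? b p'
  ... | no ¬p' = suc b , p , inj₂ (b , refl , ¬p')

  2^ : ℕ → ℚ
  2^ a = ι (2 ℕ.^ a)

  2^-+ : ∀ a b → 2^ (a ℕ.+ b) ≡ 2^ a ⊛ 2^ b
  2^-+ a b = trans (cong ι (ℕ.^-distribˡ-+-* 2 a b)) (ι-* (2 ℕ.^ a) (2 ℕ.^ b))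

  2^-^ : ∀ a k → 2^ a ^ℚ k ≡ 2^ (a ℕ.* k)
  2^-^ a k = trans (sym (ι-^ (2 ℕ.^ a) k)) (cong ι (ℕ.^-*-assoc 2 a k))

  2^-mono : ∀ {a b} → a ℕ.≤ b → 2^ a ≼ 2^ b
  2^-mono h = ι-mono (ℕ.^-monoʳ-≤ 2 h)

  2^-cancel : ∀ {a b} → 2^ a ≼ 2^ b → a ℕ.≤ b
  2^-cancel {a} {b} h = ℕ.≮⇒≥ λ b<a →
    ℕ.<⇒≱ (ℕ.^-monoʳ-< 2 (ℕ.s≤s (ℕ.s≤s ℕ.z≤n)) b<a) (ι-cancel h)

  n≤2^n : ∀ n → n ℕ.≤ 2 ℕ.^ n
  n≤2^n zero    = ℕ.z≤n
  n≤2^n (suc n) = ℕ.≤-trans (ℕ.+-mono-≤ (ℕ.m^n>0 2 n) (n≤2^n n))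
    (ℕ.≤-reflexive (cong (2 ℕ.^ n ℕ.+_) (sym (ℕ.+-identityʳ (2 ℕ.^ n)))))

  half≤1 : ∀ {η} → 0ℚ ≺ η → η ≼ 1ℚ → η ⊛ ½ ≼ 1ℚ
  half≤1 {η} 0<η η≤1 = begin
    η ⊛ ½            ≡⟨ ℚ.+-identityˡ (η ⊛ ½) ⟨
    0ℚ ⊕ η ⊛ ½       ≤⟨ ℚ.+-monoˡ-≤ (η ⊛ ½) (ℚ.<⇒≤ (½-pos 0<η)) ⟩
    η ⊛ ½ ⊕ η ⊛ ½    ≡⟨ halves η ⟩
    η                ≤⟨ η≤1 ⟩
    1ℚ               ∎

  ≤+⇒-≤ : ∀ a b d → a ≼ b ⊕ d → a ⊖ d ≼ b
  ≤+⇒-≤ a b d h = begin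
    a ⊖ d         ≤⟨ ℚ.+-monoˡ-≤ (ℚ.- d) h ⟩
    (b ⊕ d) ⊖ d   ≡⟨ solve 2 (λ b d → (b :+ d) :- d := b) refl b d ⟩
    b             ∎

  0≤1- : ∀ d → d ≼ 1ℚ → 0ℚ ≼ 1ℚ ⊖ d
  0≤1- d h = begin
    0ℚ       ≡⟨ ℚ.+-inverseʳ d ⟨
    d ⊖ d    ≤⟨ ℚ.+-monoˡ-≤ (ℚ.- d) h ⟩
    1ℚ ⊖ d   ∎

  square-bound : ∀ d → 1ℚ ⊖ (d ⊕ d) ≼ (1ℚ ⊖ d) ⊛ (1ℚ ⊖ d)
  square-bound d = begin
    1ℚ ⊖ (d ⊕ d)             ≡⟨ ℚ.+-identityʳ (1ℚ ⊖ (d ⊕ d)) ⟨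
    1ℚ ⊖ (d ⊕ d) ⊕ 0ℚ        ≤⟨ ℚ.+-monoʳ-≤ (1ℚ ⊖ (d ⊕ d)) 0≤d² ⟩
    1ℚ ⊖ (d ⊕ d) ⊕ d ⊛ d     ≡⟨ solve 1 (λ d → con 1ℚ :- (d :+ d) :+ d :* d
                                   := (con 1ℚ :- d) :* (con 1ℚ :- d)) refl d ⟩
    (1ℚ ⊖ d) ⊛ (1ℚ ⊖ d)      ∎
    where
    0≤d² : 0ℚ ≼ d ⊛ d
    0≤d² with ℚ.≤-total 0ℚ d
    ... | inj₁ 0≤d = *-nonneg 0≤d 0≤d
    ... | inj₂ d≤0 = subst (0ℚ ≼_) (solve 1 (λ d → :- d :* :- d := d :* d) refl d)
      (*-nonneg (ℚ.neg-antimono-≤ d≤0) (ℚ.neg-antimono-≤ d≤0))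

  power-step : ∀ d a b → d ≼ 1ℚ → 1ℚ ≼ a ⊕ d → 1ℚ ⊖ d ≼ b → 1ℚ ⊖ (d ⊕ d) ≼ a ⊛ b
  power-step d a b d≤1 ha hb = ℚ.≤-trans (square-bound d)
    (*-mono (0≤1- d d≤1) (ℚ.≤-trans (0≤1- d d≤1) hb) (≤+⇒-≤ 1ℚ a d ha) hb)

  power≥ : ∀ y → 1ℝ ≤ y → ∀ k η → 0ℚ ≺ η → η ≼ 1ℚ → Eventually λ n → 1ℚ ⊖ η ≼ seq y n ^ℚ k
  power≥ y 1≤y zero η 0<η η≤1 = 0 , λ _ _ → ≤+⇒-≤ 1ℚ 1ℚ η (begin
    1ℚ        ≡⟨ ℚ.+-identityʳ 1ℚ ⟨
    1ℚ ⊕ 0ℚ   ≤⟨ ℚ.+-monoʳ-≤ 1ℚ (ℚ.<⇒≤ 0<η) ⟩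
    1ℚ ⊕ η    ∎)
  power≥ y 1≤y (suc k) η 0<η η≤1 = proj₁ ev , λ n N≤n →
    subst (λ z → 1ℚ ⊖ z ≼ seq y n ⊛ seq y n ^ℚ k) (halves η)
      (power-step (η ⊛ ½) (seq y n) (seq y n ^ℚ k) (half≤1 0<η η≤1)
        (proj₁ (proj₂ ev n N≤n)) (proj₂ (proj₂ ev n N≤n)))
    where
    ev : Eventually λ n → 1ℚ ≼ seq y n ⊕ η ⊛ ½ × 1ℚ ⊖ η ⊛ ½ ≼ seq y n ^ℚ k
    ev = both (_≤_.approx 1≤y (η ⊛ ½) (½-pos 0<η))
              (power≥ y 1≤y k (η ⊛ ½) (½-pos 0<η) (half≤1 0<η η≤1))

  ^-swap : ∀ z i j → (z ^ℚ i) ^ℚ j ≡ (z ^ℚ j) ^ℚ i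
  ^-swap z i j = trans (^ℚ-assoc z i j)
    (trans (cong (z ^ℚ_) (ℕ.*-comm i j)) (sym (^ℚ-assoc z j i)))

  raise : ∀ z a j k → 2^ a ≼ 2^ 4 ⊛ z ^ℚ j → 2^ (a ℕ.* k) ≼ 2^ (4 ℕ.* k) ⊛ (z ^ℚ k) ^ℚ j
  raise z a j k lo = begin
    2^ (a ℕ.* k)                       ≡⟨ 2^-^ a k ⟨
    2^ a ^ℚ k                          ≤⟨ ^-mono k (0≤ι (2 ℕ.^ a)) lo ⟩
    (2^ 4 ⊛ z ^ℚ j) ^ℚ k               ≡⟨ ^ℚ-distrib (2^ 4) (z ^ℚ j) k ⟩
    2^ 4 ^ℚ k ⊛ (z ^ℚ j) ^ℚ k          ≡⟨ cong₂ _⊛_ (2^-^ 4 k) (^-swap z j k) ⟩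
    2^ (4 ℕ.* k) ⊛ (z ^ℚ k) ^ℚ j       ∎

  lower-raise : ∀ z b j k → 0ℚ ≼ z → z ^ℚ k ≼ 2^ b → (z ^ℚ k) ^ℚ j ≼ 2^ (b ℕ.* j)
  lower-raise z b j k 0≤z hi = begin
    (z ^ℚ k) ^ℚ j    ≤⟨ ^-mono j (^-nonneg k 0≤z) hi ⟩
    2^ b ^ℚ j        ≡⟨ 2^-^ b j ⟩
    2^ (b ℕ.* j)     ∎

  compare-core : ∀ z a b j k → 0ℚ ≼ z → 2^ a ≼ 2^ 4 ⊛ z ^ℚ j → z ^ℚ k ≼ 2^ b →
                 a ℕ.* k ℕ.≤ 4 ℕ.* k ℕ.+ b ℕ.* j
  compare-core z a b j k 0≤z lo hi = 2^-cancel {a ℕ.* k} {4 ℕ.* k ℕ.+ b ℕ.* j} (begin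
    2^ (a ℕ.* k)                     ≤⟨ raise z a j k lo ⟩
    2^ (4 ℕ.* k) ⊛ (z ^ℚ k) ^ℚ j     ≤⟨ *-monoˡ {2^ (4 ℕ.* k)} (0≤ι (2 ℕ.^ (4 ℕ.* k))) (lower-raise z b j k 0≤z hi) ⟩
    2^ (4 ℕ.* k) ⊛ 2^ (b ℕ.* j)      ≡⟨ 2^-+ (4 ℕ.* k) (b ℕ.* j) ⟨
    2^ (4 ℕ.* k ℕ.+ b ℕ.* j)         ∎)

  lower-core : ∀ z a p q k → 0ℚ ≼ z → 2^ a ≼ 2^ 4 ⊛ z ^ℚ suc k →
               4 ℕ.* q ℕ.+ p ℕ.* suc k ℕ.≤ a ℕ.* q → 2^ p ≼ z ^ℚ q
  lower-core z a p q k 0≤z lo key = ^-cancel k (^-nonneg q 0≤z)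
    (ℚ.*-cancelˡ-≤-pos (2^ (4 ℕ.* q)) {{positive 0<2^}} (begin
      2^ (4 ℕ.* q) ⊛ 2^ p ^ℚ suc k          ≡⟨ cong (2^ (4 ℕ.* q) ⊛_) (2^-^ p (suc k)) ⟩
      2^ (4 ℕ.* q) ⊛ 2^ (p ℕ.* suc k)       ≡⟨ 2^-+ (4 ℕ.* q) (p ℕ.* suc k) ⟨
      2^ (4 ℕ.* q ℕ.+ p ℕ.* suc k)          ≤⟨ 2^-mono key ⟩
      2^ (a ℕ.* q)                          ≤⟨ raise z a (suc k) q lo ⟩
      2^ (4 ℕ.* q) ⊛ (z ^ℚ q) ^ℚ suc k      ∎))
    where
    0<2^ : 0ℚ ≺ 2^ (4 ℕ.* q)
    0<2^ = ℚ.<-≤-trans (0<ι-suc 0) (ι-mono (ℕ.m^n>0 2 (4 ℕ.* q)))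

  upper-core : ∀ z a p q k → 0ℚ ≼ z → z ^ℚ suc k ≼ 2^ a →
               a ℕ.* q ℕ.≤ p ℕ.* suc k → z ^ℚ q ≼ 2^ p
  upper-core z a p q k 0≤z hi key = ^-cancel k (0≤ι (2 ℕ.^ p)) (begin
    (z ^ℚ q) ^ℚ suc k      ≡⟨ ^-swap z q (suc k) ⟩
    (z ^ℚ suc k) ^ℚ q      ≤⟨ lower-raise z a q (suc k) 0≤z hi ⟩
    2^ (a ℕ.* q)           ≤⟨ 2^-mono key ⟩
    2^ (p ℕ.* suc k)       ≡⟨ 2^-^ p (suc k) ⟨
    2^ p ^ℚ suc k          ∎)

  ratio : ℕ → ℕ → ℚ
  ratio e k = ι e ⊛ ℚ.1/ ι (suc k)

  ratio-* : ∀ e k → ι (suc k) ⊛ ratio e k ≡ ι e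
  ratio-* e k = trans
    (solve 3 (λ s a r → s :* (a :* r) := a :* (s :* r)) refl (ι (suc k)) (ι e) (ℚ.1/ ι (suc k)))
    (trans (cong (ι e ⊛_) (ℚ.*-inverseʳ (ι (suc k)))) (ℚ.*-identityʳ (ι e)))

  ratio-nonneg : ∀ e k → 0ℚ ≼ ratio e k
  ratio-nonneg e k = *-nonneg (0≤ι e) (ℚ.<⇒≤ (ℚ.positive⁻¹ (ℚ.1/ ι (suc k))))

  close-core : ∀ a b j k → a ℕ.* suc k ℕ.≤ 4 ℕ.* suc k ℕ.+ b ℕ.* suc j →
               ratio a j ⊖ ratio b k ≼ ratio 4 j
  close-core a b j k h = ℚ.*-cancelˡ-≤-pos (J ⊛ K)
    {{positive (*-pos (0<ι-suc j) (0<ι-suc k))}} (begin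
    (J ⊛ K) ⊛ (ratio a j ⊖ ratio b k)
      ≡⟨ solve 4 (λ J K a b → (J :* K) :* (a :- b) := (J :* a) :* K :- (K :* b) :* J) refl
           J K (ratio a j) (ratio b k) ⟩
    (J ⊛ ratio a j) ⊛ K ⊖ (K ⊛ ratio b k) ⊛ J
      ≡⟨ cong₂ (λ s t → s ⊛ K ⊖ t ⊛ J) (ratio-* a j) (ratio-* b k) ⟩
    ι a ⊛ K ⊖ ι b ⊛ J
      ≡⟨ cong₂ _⊖_ (ι-* a (suc k)) (ι-* b (suc j)) ⟨
    ι (a ℕ.* suc k) ⊖ ι (b ℕ.* suc j)
      ≤⟨ ≤+⇒-≤ (ι (a ℕ.* suc k)) (ι (4 ℕ.* suc k)) (ι (b ℕ.* suc j)) (begin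
           ι (a ℕ.* suc k)                            ≤⟨ ι-mono h ⟩
           ι (4 ℕ.* suc k ℕ.+ b ℕ.* suc j)            ≡⟨ ι-+ (4 ℕ.* suc k) (b ℕ.* suc j) ⟩
           ι (4 ℕ.* suc k) ⊕ ι (b ℕ.* suc j)          ∎) ⟩
    ι (4 ℕ.* suc k)
      ≡⟨ ι-* 4 (suc k) ⟩
    ι 4 ⊛ K
      ≡⟨ cong (_⊛ K) (ratio-* 4 j) ⟨
    (J ⊛ ratio 4 j) ⊛ K
      ≡⟨ solve 3 (λ J K f → (J :* f) :* K := (J :* K) :* f) refl J K (ratio 4 j) ⟩
    (J ⊛ K) ⊛ ratio 4 j ∎)
    where
    J = ι (suc j)
    K = ι (suc k)

  absorb : ∀ c → 0ℚ ≺ c → ∀ e → Eventually λ k → ι e ≼ c ⊛ ι (suc k)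
  absorb c 0<c e = proj₁ arch , λ k k₀≤k → begin
    ι e                    ≡⟨ ℚ.*-identityʳ (ι e) ⟨
    ι e ⊛ 1ℚ               ≡⟨ cong (ι e ⊛_) (1/₀-inverse 0<c) ⟨
    ι e ⊛ (c ⊛ 1/₀ c)      ≡⟨ solve 3 (λ f e r → f :* (e :* r) := e :* (f :* r)) refl (ι e) c (1/₀ c) ⟩
    c ⊛ (ι e ⊛ 1/₀ c)      ≤⟨ *-monoˡ {c} (ℚ.<⇒≤ 0<c) (ℚ.≤-trans (proj₂ arch) (ι-mono (ℕ.m≤n⇒m≤1+n k₀≤k))) ⟩
    c ⊛ ι (suc k)          ∎
    where
    arch : ∃ λ k₀ → ι e ⊛ 1/₀ c ≼ ι k₀
    arch = archimedean (ι e ⊛ 1/₀ c)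

  small : ∀ η → 0ℚ ≺ η → Eventually λ j → ratio 4 j ≼ η
  small η 0<η = proj₁ (absorb η 0<η 4) , λ j N≤j →
    ℚ.*-cancelˡ-≤-pos (ι (suc j)) {{positive (0<ι-suc j)}} (begin
      ι (suc j) ⊛ ratio 4 j    ≡⟨ ratio-* 4 j ⟩
      ι 4                      ≤⟨ proj₂ (absorb η 0<η 4) j N≤j ⟩
      η ⊛ ι (suc j)            ≡⟨ ℚ.*-comm η (ι (suc j)) ⟩
      ι (suc j) ⊛ η            ∎)

  clear : ∀ e q k → (ι q ⊛ ratio e k) ⊛ ι (suc k) ≡ ι (e ℕ.* q)
  clear e q k = trans
    (solve 3 (λ q a s → (q :* a) :* s := (s :* a) :* q) refl (ι q) (ratio e k) (ι (suc k)))
    (trans (cong (_⊛ ι q) (ratio-* e k)) (sym (ι-* e q)))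

  lower-key : ∀ e p q k c → ι (4 ℕ.* q) ≼ c ⊛ ι (suc k) → ι p ⊕ c ≼ ι q ⊛ ratio e k →
              4 ℕ.* q ℕ.+ p ℕ.* suc k ℕ.≤ e ℕ.* q
  lower-key e p q k c h₁ h₂ = ι-cancel (begin
    ι (4 ℕ.* q ℕ.+ p ℕ.* suc k)          ≡⟨ ι-+ (4 ℕ.* q) (p ℕ.* suc k) ⟩
    ι (4 ℕ.* q) ⊕ ι (p ℕ.* suc k)        ≤⟨ ℚ.+-monoˡ-≤ (ι (p ℕ.* suc k)) h₁ ⟩
    c ⊛ ι (suc k) ⊕ ι (p ℕ.* suc k)      ≡⟨ cong (c ⊛ ι (suc k) ⊕_) (ι-* p (suc k)) ⟩
    c ⊛ ι (suc k) ⊕ ι p ⊛ ι (suc k)      ≡⟨ solve 3 (λ c p s → c :* s :+ p :* s := (p :+ c) :* s) refl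
                                              c (ι p) (ι (suc k)) ⟩
    (ι p ⊕ c) ⊛ ι (suc k)                ≤⟨ ℚ.*-monoʳ-≤-nonNeg (ι (suc k)) {{nonNegative (0≤ι (suc k))}} h₂ ⟩
    (ι q ⊛ ratio e k) ⊛ ι (suc k)        ≡⟨ clear e q k ⟩
    ι (e ℕ.* q)                          ∎)

  upper-key : ∀ e p q k c → 0ℚ ≺ c → ι q ⊛ ratio e k ⊕ c ≼ ι p → e ℕ.* q ℕ.≤ p ℕ.* suc k
  upper-key e p q k c 0<c h = ι-cancel (begin
    ι (e ℕ.* q)                       ≡⟨ clear e q k ⟨
    (ι q ⊛ ratio e k) ⊛ ι (suc k)     ≤⟨ ℚ.*-monoʳ-≤-nonNeg (ι (suc k)) {{nonNegative (0≤ι (suc k))}} (begin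
        ι q ⊛ ratio e k         ≡⟨ ℚ.+-identityʳ (ι q ⊛ ratio e k) ⟨
        ι q ⊛ ratio e k ⊕ 0ℚ    ≤⟨ ℚ.+-monoʳ-≤ (ι q ⊛ ratio e k) (ℚ.<⇒≤ 0<c) ⟩
        ι q ⊛ ratio e k ⊕ c     ≤⟨ h ⟩
        ι p                     ∎) ⟩
    ι p ⊛ ι (suc k)                   ≡⟨ ι-* p (suc k) ⟨
    ι (p ℕ.* suc k)                   ∎)

  module _ (y : ℝ) (1≤y : 1ℝ ≤ y) where

    Brackets : ℕ → ℕ → ℕ → Set
    Brackets K a n = 0ℚ ≼ seq y n × seq y n ^ℚ K ≼ 2^ a × 2^ a ≼ 2^ 4 ⊛ seq y n ^ℚ K

    bracket : ∀ K → ∃ λ a → Eventually (Brackets K a)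
    bracket K with cauchy (y ^ K) 1ℚ (ℚ.positive⁻¹ 1ℚ)
    ... | N₀ , h with archimedean (seq (y ^ K) N₀ ⊕ 1ℚ)
    ... | b , c+1≤b
      with least {λ a → seq (y ^ K) N₀ ⊕ 1ℚ ≼ 2^ a} (λ a → (seq (y ^ K) N₀ ⊕ 1ℚ) ℚ.≤? 2^ a) b
             (ℚ.≤-trans c+1≤b (ι-mono (n≤2^n b)))
    ... | a , c+1≤2^a , minimal =
      a , N , λ n N≤n → let ((_ , N₀≤n) , lo) = close n N≤n in
        proj₁ (proj₁ (close n N≤n)) , upto n N₀≤n , from minimal n lo N₀≤n
      where
      c = seq (y ^ K) N₀
      p : ℕ → ℚ
      p n = seq y n ^ℚ K
      events : Eventually λ n → (0ℚ ≼ seq y n × N₀ ℕ.≤ n) × ½ ≼ p n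
      events = both (both y≥0 (N₀ , λ _ h → h))
        (power≥ y 1≤y K ½ (ℚ.positive⁻¹ ½) ½≤1)
        where
        ½≤1 : ½ ≼ 1ℚ
        ½≤1 = ℚ.≤ᵇ⇒≤ _
        y≥0 : Eventually λ n → 0ℚ ≼ seq y n
        y≥0 with _≤_.approx 1≤y 1ℚ (ℚ.positive⁻¹ 1ℚ)
        ... | M , h = M , λ n M≤n → begin
          1ℚ ⊖ 1ℚ               ≤⟨ ℚ.+-monoˡ-≤ (ℚ.- 1ℚ) (h n M≤n) ⟩
          (seq y n ⊕ 1ℚ) ⊖ 1ℚ   ≡⟨ solve 2 (λ a b → (a :+ b) :- b := a) refl (seq y n) 1ℚ ⟩
          seq y n               ∎
      N = proj₁ events
      close = proj₂ events
      near : ∀ n → N₀ ℕ.≤ n → ℚ.∣ p n ⊖ c ∣ ≼ 1ℚ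
      near n N₀≤n = subst (λ z → ℚ.∣ z ⊖ c ∣ ≼ 1ℚ) (seq-^ y K n) (h n N₀ N₀≤n ℕ.≤-refl)
      upto : ∀ n → N₀ ℕ.≤ n → p n ≼ 2^ a
      upto n N₀≤n = ℚ.≤-trans (∣-∣≤⇒≤+ (near n N₀≤n)) c+1≤2^a
      1≤2p : ∀ {q} → ½ ≼ q → 1ℚ ≼ ι 2 ⊛ q
      1≤2p = *-monoˡ (0≤ι 2)
      scale : ∀ {i j q} → i ℕ.≤ j → ½ ≼ q → ι i ⊛ q ≼ ι j ⊛ q
      scale {q = q} i≤j ½≤q =
        ℚ.*-monoʳ-≤-nonNeg q {{nonNegative (ℚ.≤-trans (ℚ.nonNegative⁻¹ ½) ½≤q)}} (ι-mono i≤j)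
      from : a ≡ 0 ⊎ (∃ λ a' → a ≡ suc a' × ¬ (c ⊕ 1ℚ ≼ 2^ a')) →
             ∀ n → ½ ≼ p n → N₀ ℕ.≤ n → 2^ a ≼ 2^ 4 ⊛ p n
      from (inj₁ refl) n ½≤p _ = ℚ.≤-trans (1≤2p ½≤p) (scale (ℕ.m≤m+n 2 14) ½≤p)
      from (inj₂ (a' , refl , ¬h)) n ½≤p N₀≤n = begin
        2^ (suc a')                              ≡⟨ ι-* 2 (2 ℕ.^ a') ⟩
        ι 2 ⊛ 2^ a'                              ≤⟨ *-monoˡ (0≤ι 2) (ℚ.<⇒≤ (ℚ.≰⇒> ¬h)) ⟩
        ι 2 ⊛ (c ⊕ 1ℚ)                           ≤⟨ *-monoˡ (0≤ι 2) (ℚ.+-monoˡ-≤ 1ℚ (∣-∣≤⇒≤+ {c} {p n}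
                                                      (subst (_≼ 1ℚ) (∣∣-swap (p n) c) (near n N₀≤n)))) ⟩
        ι 2 ⊛ (p n ⊕ 1ℚ ⊕ 1ℚ)                    ≤⟨ *-monoˡ (0≤ι 2) (ℚ.+-mono-≤
                                                      (ℚ.+-monoʳ-≤ (p n) (1≤2p ½≤p)) (1≤2p ½≤p)) ⟩
        ι 2 ⊛ (p n ⊕ ι 2 ⊛ p n ⊕ ι 2 ⊛ p n)      ≡⟨ solve 1 (λ a → con (ι 2) :* (a :+ con (ι 2) :* a :+ con (ι 2) :* a)
                                                      := con (ι 10) :* a) refl (p n) ⟩
        ι 10 ⊛ p n                               ≤⟨ scale (ℕ.m≤m+n 10 6) ½≤p ⟩
        2^ 4 ⊛ p n                               ∎

    -- exponent k is within a bounded distance of (k + 1) log₂ y.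
    exponent : ℕ → ℕ
    exponent k = proj₁ (bracket (suc k))

    approx : ℕ → ℚ
    approx k = ratio (exponent k) k

    compare : ∀ j k → exponent j ℕ.* suc k ℕ.≤ 4 ℕ.* suc k ℕ.+ exponent k ℕ.* suc j
    compare j k =
      let (0≤z , _ , lo) , (_ , hi , _) = at N ℕ.≤-refl
      in compare-core (seq y N) (exponent j) (exponent k) (suc j) (suc k) 0≤z lo hi
      where
      ev : Eventually λ n → Brackets (suc j) (exponent j) n × Brackets (suc k) (exponent k) n
      ev = both (proj₂ (bracket (suc j))) (proj₂ (bracket (suc k)))
      N = proj₁ ev
      at = proj₂ ev

    approx-close : ∀ j k → approx j ⊖ approx k ≼ ratio 4 j
    approx-close j k = close-core (exponent j) (exponent k) j k (compare j k)

    approx-cauchy : IsCauchy approx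
    approx-cauchy η 0<η = proj₁ (small η 0<η) , λ m n N≤m N≤n → ∣∣≤
      (ℚ.≤-trans (approx-close m n) (proj₂ (small η 0<η) m N≤m))
      (subst (_≼ η) (solve 2 (λ a b → b :- a := :- (a :- b)) refl (approx m) (approx n))
        (ℚ.≤-trans (approx-close n m) (proj₂ (small η 0<η) n N≤n)))

    logarithm : ℝ
    logarithm = real approx approx-cauchy

    isLog₂ : IsLog₂ y logarithm
    isLog₂ .IsLog₂.nonneg = exact (0 , λ k _ → ratio-nonneg (exponent k) k)
    isLog₂ .IsLog₂.lower p q (*<* c 0<c (M , h)) = exact (proj₁ br , λ n N≤n →
      subst (2^ p ≼_) (sym (seq-^ y q n))
        (lower-core (seq y n) (exponent k) p q k (proj₁ (proj₂ br n N≤n))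
          (proj₂ (proj₂ (proj₂ br n N≤n))) key))
      where
      k = M ℕ.⊔ proj₁ (absorb c 0<c (4 ℕ.* q))
      br = proj₂ (bracket (suc k))
      key : 4 ℕ.* q ℕ.+ p ℕ.* suc k ℕ.≤ exponent k ℕ.* q
      key = lower-key (exponent k) p q k c
        (proj₂ (absorb c 0<c (4 ℕ.* q)) k (ℕ.m≤n⊔m M _))
        (subst (ι p ⊕ c ≼_) (seq-* (fromℕ q) logarithm k) (h k (ℕ.m≤m⊔n M _)))
    isLog₂ .IsLog₂.upper p q (*<* c 0<c (k , h)) = exact (proj₁ br , λ n N≤n →
      subst (_≼ 2^ p) (sym (seq-^ y q n))
        (upper-core (seq y n) (exponent k) p q k (proj₁ (proj₂ br n N≤n))
          (proj₁ (proj₂ (proj₂ br n N≤n))) key))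
      where
      br = proj₂ (bracket (suc k))
      key : exponent k ℕ.* q ℕ.≤ p ℕ.* suc k
      key = upper-key (exponent k) p q k c 0<c
        (subst (λ z → z ⊕ c ≼ ι p) (seq-* (fromℕ q) logarithm k) (h k ℕ.≤-refl))

opaque
  log₂ : (y : ℝ) → 1ℝ ≤ y → ℝ
  log₂ = LogProofs.logarithm

  log₂-isLog₂ : ∀ y (1≤y : 1ℝ ≤ y) → IsLog₂ y (log₂ y 1≤y)
  log₂-isLog₂ = LogProofs.isLog₂

1≤fromℕ : ∀ n .{{_ : ℕ.NonZero n}} → 1ℝ ≤ fromℕ n
1≤fromℕ n = LogProofs.exact (0 , λ _ _ → RationalLemmas.ι-mono (ℕ.>-nonZero⁻¹ n))

1≤⁻¹ : ∀ {x} (x>0 : 0ℝ < x) → x < 1ℝ → 1ℝ ≤ x ⁻¹⟨ x>0 ⟩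
1≤⁻¹ {x} x>0@(*<* c 0<c c≤x) (*<* d 0<d x+d≤1) =
  LogProofs.exact (proj₁ ev , λ n N≤n →
    subst (1ℚ ℚ.≤_) (sym (seq-⁻¹ x x>0 n))
      (bound (seq x n) (proj₁ (proj₂ ev n N≤n)) (proj₂ (proj₂ ev n N≤n))))
  where
  ev : Eventually λ n → 0ℚ ℚ.+ c ℚ.≤ seq x n × seq x n ℚ.+ d ℚ.≤ 1ℚ
  ev = both c≤x x+d≤1
  bound : ∀ a → 0ℚ ℚ.+ c ℚ.≤ a → a ℚ.+ d ℚ.≤ 1ℚ → 1ℚ ℚ.≤ 1/₀ a
  bound a c≤a a+d≤1 = ℚ.*-cancelˡ-≤-pos a {{ℚ.positive 0<a}} (begin
    a ℚ.* 1ℚ       ≡⟨ ℚ.*-identityʳ a ⟩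
    a              ≡⟨ ℚ.+-identityʳ a ⟨
    a ℚ.+ 0ℚ       ≤⟨ ℚ.+-monoʳ-≤ a (ℚ.<⇒≤ 0<d) ⟩
    a ℚ.+ d        ≤⟨ a+d≤1 ⟩
    1ℚ             ≡⟨ 1/₀-inverse 0<a ⟨
    a ℚ.* 1/₀ a    ∎)
    where
    open ℚ.≤-Reasoning
    0<a : 0ℚ ℚ.< a
    0<a = ℚ.<-≤-trans 0<c (subst (ℚ._≤ a) (ℚ.+-identityˡ c) c≤a)

∑ : ∀ {n} → (Fin n → ℝ) → ℝ
∑ = Vector.foldr _+_ 0ℝ

-- Each monomial is a coefficient with the exponents of the three variables.
Polynomial₃ : Set
Polynomial₃ = List (ℝ × ℕ × ℕ × ℕ)

eval : Polynomial₃ → ℝ → ℝ → ℝ → ℝ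
eval p x y z = foldr (λ (c , i , j , k) s → c * x ^ i * y ^ j * z ^ k + s) 0ℝ p

record Distribution (n : ℕ) : Set where
  field
    mass   : Fin n → ℝ
    nonneg : ∀ i → 0ℝ ≤ mass i
    total  : ∑ mass ≃ 1ℝ
open Distribution public using (mass)

massOf : ∀ {n} → Distribution n → Subset n → ℝ
massOf μ A = ∑ λ i → if Vec.lookup A i then mass μ i else 0ℝ

distance : ∀ {n} → Distribution n → Distribution n → ℝ
distance μ μ′ = fromℚ ½ * ∑ λ i → ∣ mass μ i - mass μ′ i ∣

Property : Set₁
Property = ∀ n → Distribution n → Set

Far : Property → ∀ {n} → ℝ → Distribution n → Set
Far P {n} ε μ = ∀ μ′ → P n μ′ → ε ≤ distance μ μ′

IsUniform : Property
IsUniform n μ = ∀ i → mass μ i ≃ fromℚ ((+ 1 ℚ./ n) {{nonZeroIndex i}})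

Query : ℕ → Set
Query n = ∃ λ (A : Subset n) → Nonempty A

nonempty⇒∣∣-nonZero : ∀ {n} {A : Subset n} → Nonempty A → ℕ.NonZero Subset.∣ A ∣
nonempty⇒∣∣-nonZero (_ , x∈A) = ℕ.>-nonZero (ℕ.≤-<-trans ℕ.z≤n (x∈p⇒∣p-x∣<∣p∣ x∈A))

-- The distribution of the answer to each query.  This is a specification rather
-- than a function of μ, since whether μ(A) > 0 is undecidable for real masses.
record Oracle {n} (μ : Distribution n) : Set where
  field
    answer      : Query n → Distribution n
    outside     : ∀ A ne {j} → j ∉ A → mass (answer (A , ne)) j ≃ 0ℝ
    conditional : ∀ A ne (μA>0 : 0ℝ < massOf μ A) {j} → j ∈ A →
                  mass (answer (A , ne)) j ≃ mass μ j * massOf μ A ⁻¹⟨ μA>0 ⟩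
    null        : ∀ A ne → massOf μ A ≃ 0ℝ → ∀ {j} → j ∈ A →
                  mass (answer (A , ne)) j ≃
                    fromℚ ((+ 1 ℚ./ Subset.∣ A ∣) {{nonempty⇒∣∣-nonZero ne}})
open Oracle public using (answer)

-- The coin tosses are a uniform seed from Fin seeds.  It fixes the queries
-- before any answer is seen, and is available again for the verdict.
record NonAdaptiveTest (n : ℕ) : Set where
  field
    seeds         : ℕ
    {{seeds≢0}}   : ℕ.NonZero seeds
    queries       : Fin seeds → List (Query n)
    accepts       : ∀ r → Vec (Fin n) (length (queries r)) → Bool
open NonAdaptiveTest public

-- Probability that independent answers to the queries satisfy the event.
answersPr : ∀ {n} {μ : Distribution n} → Oracle μ →
            (As : List (Query n)) → (Vec (Fin n) (length As) → Bool) → ℝ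
answersPr O []       E = if E [] then 1ℝ else 0ℝ
answersPr O (A ∷ As) E = ∑ λ j → mass (answer O A) j * answersPr O As (λ js → E (j ∷ js))

acceptPr rejectPr : ∀ {n} {μ : Distribution n} → NonAdaptiveTest n → Oracle μ → ℝ
acceptPr T O = fromℚ (+ 1 ℚ./ seeds T) * ∑ λ r → answersPr O (queries T r) (accepts T r)
rejectPr T O = fromℚ (+ 1 ℚ./ seeds T) * ∑ λ r → answersPr O (queries T r) (λ js → not (accepts T r js))

record NonAdaptiveTester (P : Property) : Set where
  field
    test     : ∀ ε δ → 0ℝ < ε → 0ℝ < δ → ∀ n → NonAdaptiveTest n
    complete : ∀ ε δ (ε>0 : 0ℝ < ε) (δ>0 : 0ℝ < δ) {n} (μ : Distribution n) (O : Oracle μ) →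
               P n μ → 1ℝ - δ ≤ acceptPr (test ε δ ε>0 δ>0 n) O
    sound    : ∀ ε δ (ε>0 : 0ℝ < ε) (δ>0 : 0ℝ < δ) {n} (μ : Distribution n) (O : Oracle μ) →
               Far P ε μ → 1ℝ - δ ≤ rejectPr (test ε δ ε>0 δ>0 n) O
open NonAdaptiveTester public

{-# OPTIONS --safe #-}
module Submission where

-- The test counts collisions.  Among all distributions on a set A the uniform one
-- has the least collision probability, 1 / |A| (uniform-collision,
-- collision-≥).  A trial draws a random set and queries it twice.  If μ is uniform
-- the expected collision probability q₀ of a trial is known exactly; if μ is far
-- from uniform it is larger by 1 / poly(log n, 1 / ε) (Gain.gain).
--
-- The random set: choose a level k in 0 .. K with 2^K ≥ n, include every point
-- independently with probability r = 2^k / 2^K, and insert one uniformly random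
-- point j.  If μ is e-far from uniform, the heavy points, of mass at least 1 / n,
-- carry mass at least e / 2 (heavy-mass), and a fraction of at least e / 2 of all
-- points is light, of mass at most (1 - γ) / n for γ = e / 4 (light-mass).  Look at
-- a heavy point of mass t at the level where r is about t.  When it is included, the
-- whole set has expected mass of order t, so the conditional probability of the
-- point is bounded below on average; and when j is light, the conditional
-- probability of j is smaller by a factor of 1 - γ.  The answer is then not
-- uniform on the set.  Summed over the levels, the probability of including a heavy
-- point of the right size is of the order of the total heavy mass, so that only a
-- factor of K + 1 is lost by choosing the level at random.
--
-- The excess ∑ p² - 1 / |A| is bounded below by pairing p with fixed weights on the
-- heavy points and on j (square-bound, marked-bound), and the reciprocal of the mass
-- of the set by a tangent line (tangent).  Both bounds are polynomial in the
-- indicators of membership, so their expectation needs first and second moments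
-- only (Random-set.expected-gain).
--
-- The verdict compares with 1 a product of one factor per trial, a likelihood ratio
-- for collision probability q₀ against a larger one.  The mean of the product is a
-- power of a number below 1 if μ is uniform (𝔼-likelihood), and so is the mean of
-- a product of reversed factors if μ is far; since the two products multiply to at
-- least 1 (likelihood-product), Markov's inequality bounds both kinds of error.  The
-- error falls below δ after m a trials, where m is quadratic in the reciprocal of the
-- gain and 2^a is of order 1 / δ.
--
-- Order on the reals is undecidable, so the classes of heavy and light points and
-- the levels are chosen by comparisons with overlapping rational bounds (compare),
-- and the tester works with rational approximations to ε and δ within a factor of
-- four (magnitude).

open import Defs
open import Algebra.Bundles using (CommutativeRing)
import Algebra.Properties.CommutativeSemiring.Exp as Exp
import Algebra.Properties.Semiring.Sum as SemiringSum
import Algebra.Solver.Ring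
open import Algebra.Solver.Ring.AlmostCommutativeRing using (fromCommutativeRing; _-Raw-AlmostCommutative⟶_)
open import Data.Bool using (Bool; true; false; if_then_else_; _∧_; _∨_; not)
open import Data.Fin using (Fin; zero; suc; toℕ; fromℕ<; _↑ˡ_; _↑ʳ_; combine; remQuot; _≟_)
import Data.Fin.Properties as Fin
open import Data.Fin.Subset as Subset using (Subset; _∈_)
open import Data.Integer using (+_; +<+)
open import Data.List using (List; []; _∷_; length)
open import Data.Maybe using (Maybe; just; nothing)
open import Data.Nat as ℕ using (ℕ; zero; suc)
open import Data.Nat.Coprimality using (1-coprimeTo)
import Data.Nat.Properties as ℕ
open import Data.Product using (∃; _×_; _,_; proj₁; proj₂; uncurry)
open import Data.Rational as ℚ using (ℚ; 0ℚ; 1ℚ; ½)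
import Data.Rational.Properties as ℚ
open import Data.Rational.Solver using (module +-*-Solver)
open import Data.Sum using (_⊎_; inj₁; inj₂)
open import Data.Vec as Vec using (Vec; []; _∷_; lookup)
import Data.Vec.Properties as Vec
open import Relation.Binary.Bundles using (Poset)
open import Relation.Binary.PropositionalEquality
  using (_≡_; refl; sym; cong; cong₂; trans; subst; subst₂)
open import Relation.Nullary using (Dec; yes; no; ¬_; contradiction; does)

module ℚL = RationalLemmas
open RationalLemmas using (ι-mono; ι-cancel; ι-+; ι-*; 0≤ι; 0<ι-suc; archimedean; halves; ½-pos)
open LogProofs using (exact; least; n≤2^n)
open SemiringSum (CommutativeRing.semiring ℚ.+-*-commutativeRing) using () renaming (sum to ∑ℚ)
open Exp (CommutativeRing.commutativeSemiring ℚ.+-*-commutativeRing)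
  using () renaming (_^_ to _^ℚ_; ^-assocʳ to ^ℚ-assoc; ^-distrib-* to ^ℚ-distrib)

-- The ordered field of reals

≤-refl : ∀ {x} → x ≤ x
≤-refl = exact (0 , λ _ _ → ℚ.≤-refl)

≤-trans : ∀ {x y z} → x ≤ y → y ≤ z → x ≤ z
≤-trans {x} {y} {z} (*≤* p) (*≤* q) = *≤* λ η 0<η →
  let N , h = both (p (η ℚ.* ½) (½-pos 0<η)) (q (η ℚ.* ½) (½-pos 0<η))
  in N , λ n N≤n → begin
    seq x n                                ≤⟨ proj₁ (h n N≤n) ⟩
    seq y n ℚ.+ η ℚ.* ½                    ≤⟨ ℚ.+-monoˡ-≤ (η ℚ.* ½) (proj₂ (h n N≤n)) ⟩
    seq z n ℚ.+ η ℚ.* ½ ℚ.+ η ℚ.* ½        ≡⟨ ℚ.+-assoc (seq z n) (η ℚ.* ½) (η ℚ.* ½) ⟩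
    seq z n ℚ.+ (η ℚ.* ½ ℚ.+ η ℚ.* ½)      ≡⟨ cong (seq z n ℚ.+_) (halves η) ⟩
    seq z n ℚ.+ η                          ∎
  where open ℚ.≤-Reasoning

≃-refl : ∀ {x} → x ≃ x
≃-refl = ≤-refl , ≤-refl

≃-sym : ∀ {x y} → x ≃ y → y ≃ x
≃-sym (p , q) = q , p

≃-trans : ∀ {x y z} → x ≃ y → y ≃ z → x ≃ z
≃-trans (p , q) (p′ , q′) = ≤-trans p p′ , ≤-trans q′ q

poset : Poset _ _ _
poset = record
  { Carrier = ℝ
  ; _≈_     = _≃_
  ; _≤_     = _≤_
  ; isPartialOrder = record
    { isPreorder = record
      { isEquivalence = record { refl = ≃-refl ; sym = ≃-sym ; trans = ≃-trans }
      ; reflexive     = proj₁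
      ; trans         = ≤-trans
      }
    ; antisym = _,_
    }
  }

module ≤-Reasoning where
  open import Relation.Binary.Reasoning.PartialOrder poset public

termwise : ∀ {x y} → (∀ n → seq x n ≡ seq y n) → x ≃ y
termwise h = exact (0 , λ n _ → ℚ.≤-reflexive (h n)) , exact (0 , λ n _ → ℚ.≤-reflexive (sym (h n)))

fromℚ-mono : ∀ {p q} → p ℚ.≤ q → fromℚ p ≤ fromℚ q
fromℚ-mono h = exact (0 , λ _ _ → h)

fromℚ-+ : ∀ p q → fromℚ (p ℚ.+ q) ≃ fromℚ p + fromℚ q
fromℚ-+ p q = termwise λ n → sym (seq-+ (fromℚ p) (fromℚ q) n)

fromℚ-* : ∀ p q → fromℚ (p ℚ.* q) ≃ fromℚ p * fromℚ q
fromℚ-* p q = termwise λ n → sym (seq-* (fromℚ p) (fromℚ q) n)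

infix 8 -_
-_ : ℝ → ℝ
- x = 0ℝ - x

seq-neg : ∀ x n → seq (- x) n ≡ ℚ.- seq x n
seq-neg x n = trans (seq-- 0ℝ x n) (ℚ.+-identityˡ (ℚ.- seq x n))

fromℚ-neg : ∀ p → fromℚ (ℚ.- p) ≃ - fromℚ p
fromℚ-neg p = termwise λ n → sym (seq-neg (fromℚ p) n)

-≃+- : ∀ x y → x - y ≃ x + - y
-≃+- x y = termwise λ n → trans (seq-- x y n)
  (sym (trans (seq-+ x (- y) n) (cong (seq x n ℚ.+_) (seq-neg y n))))

+-mono : ∀ {x y u v} → x ≤ y → u ≤ v → x + u ≤ y + v
+-mono {x} {y} {u} {v} (*≤* p) (*≤* q) = *≤* λ η 0<η →
  let N , h = both (p (η ℚ.* ½) (½-pos 0<η)) (q (η ℚ.* ½) (½-pos 0<η))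
  in N , λ n N≤n → begin
    seq (x + u) n
      ≡⟨ seq-+ x u n ⟩
    seq x n ℚ.+ seq u n
      ≤⟨ ℚ.+-mono-≤ (proj₁ (h n N≤n)) (proj₂ (h n N≤n)) ⟩
    (seq y n ℚ.+ η ℚ.* ½) ℚ.+ (seq v n ℚ.+ η ℚ.* ½)
      ≡⟨ solve 3 (λ y v h → (y :+ h) :+ (v :+ h) := (y :+ v) :+ (h :+ h)) refl (seq y n) (seq v n) (η ℚ.* ½) ⟩
    (seq y n ℚ.+ seq v n) ℚ.+ (η ℚ.* ½ ℚ.+ η ℚ.* ½)
      ≡⟨ cong₂ ℚ._+_ (sym (seq-+ y v n)) (halves η) ⟩
    seq (y + v) n ℚ.+ η ∎
  where
  open ℚ.≤-Reasoning
  open +-*-Solver using (solve; _:=_; _:+_)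

+-cong : ∀ {x y u v} → x ≃ y → u ≃ v → x + u ≃ y + v
+-cong (p , q) (p′ , q′) = +-mono p p′ , +-mono q q′

neg-anti : ∀ {x y} → x ≤ y → - y ≤ - x
neg-anti {x} {y} (*≤* p) = *≤* λ η 0<η →
  let N , h = p η 0<η
  in N , λ n N≤n → begin
    seq (- y) n                       ≡⟨ seq-neg y n ⟩
    ℚ.- seq y n                       ≡⟨ solve 2 (λ y h → :- y := (:- (y :+ h)) :+ h) refl (seq y n) η ⟩
    ℚ.- (seq y n ℚ.+ η) ℚ.+ η         ≤⟨ ℚ.+-monoˡ-≤ η (ℚ.neg-antimono-≤ (h n N≤n)) ⟩
    ℚ.- seq x n ℚ.+ η                 ≡⟨ cong (ℚ._+ η) (sym (seq-neg x n)) ⟩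
    seq (- x) n ℚ.+ η                 ∎
  where
  open ℚ.≤-Reasoning
  open +-*-Solver using (solve; _:=_; _:+_; :-_)

*-slightly-neg : ∀ a b {B η₁ η} → ℚ.∣ b ∣ ℚ.≤ B → 0ℚ ℚ.≤ a ℚ.+ η₁ → a ℚ.≤ 0ℚ →
                 B ℚ.* η₁ ℚ.≤ η → 0ℚ ℚ.≤ a ℚ.* b ℚ.+ η
*-slightly-neg a b {B} {η₁} {η} ∣b∣≤B h a≤0 Bη≤η = begin
  0ℚ                            ≡⟨ sym (ℚ.+-inverseʳ (a ℚ.* b)) ⟩
  a ℚ.* b ℚ.+ ℚ.- (a ℚ.* b)     ≤⟨ ℚ.+-monoʳ-≤ (a ℚ.* b) (begin
      ℚ.- (a ℚ.* b)             ≡⟨ solve 2 (λ a b → :- (a :* b) := b :* :- a) refl a b ⟩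
      b ℚ.* (ℚ.- a)             ≤⟨ ℚ.*-monoʳ-≤-nonNeg (ℚ.- a) {{ℚ.nonNegative (ℚ.neg-antimono-≤ a≤0)}}
                                     (ℚ.≤-trans (ℚL.p≤∣p∣ b) ∣b∣≤B) ⟩
      B ℚ.* (ℚ.- a)             ≤⟨ ℚL.*-monoˡ (ℚ.≤-trans (ℚ.0≤∣p∣ b) ∣b∣≤B) -a≤η₁ ⟩
      B ℚ.* η₁                  ≤⟨ Bη≤η ⟩
      η                         ∎) ⟩
  a ℚ.* b ℚ.+ η                 ∎
  where
  open ℚ.≤-Reasoning
  open +-*-Solver using (solve; _:=_; _:+_; _:*_; :-_)
  -a≤η₁ : ℚ.- a ℚ.≤ η₁
  -a≤η₁ = begin
    ℚ.- a                    ≡⟨ sym (ℚ.+-identityʳ (ℚ.- a)) ⟩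
    ℚ.- a ℚ.+ 0ℚ             ≤⟨ ℚ.+-monoʳ-≤ (ℚ.- a) h ⟩
    ℚ.- a ℚ.+ (a ℚ.+ η₁)     ≡⟨ solve 2 (λ a h → :- a :+ (a :+ h) := h) refl a η₁ ⟩
    η₁                       ∎

-- A negative product needs a negative factor, which its lower bound keeps so
-- close to zero that the bound on the other factor makes the product small.
*-almost-nonneg : ∀ a b {A B η₁ η₂ η} → ℚ.∣ a ∣ ℚ.≤ A → ℚ.∣ b ∣ ℚ.≤ B → 0ℚ ℚ.≤ η →
  0ℚ ℚ.≤ a ℚ.+ η₁ → 0ℚ ℚ.≤ b ℚ.+ η₂ → B ℚ.* η₁ ℚ.≤ η → A ℚ.* η₂ ℚ.≤ η → 0ℚ ℚ.≤ a ℚ.* b ℚ.+ η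
*-almost-nonneg a b {η = η} ∣a∣≤A ∣b∣≤B 0≤η h₁ h₂ Bη₁≤η Aη₂≤η with ℚ.≤-total 0ℚ a | ℚ.≤-total 0ℚ b
... | inj₁ 0≤a | inj₁ 0≤b = ℚ.+-mono-≤ (ℚL.*-nonneg 0≤a 0≤b) 0≤η
... | inj₂ a≤0 | _        = *-slightly-neg a b ∣b∣≤B h₁ a≤0 Bη₁≤η
... | inj₁ _   | inj₂ b≤0 = subst (λ z → 0ℚ ℚ.≤ z ℚ.+ η) (ℚ.*-comm b a)
                              (*-slightly-neg b a ∣a∣≤A h₂ b≤0 Aη₂≤η)

0≤* : ∀ {x y} → 0ℝ ≤ x → 0ℝ ≤ y → 0ℝ ≤ x * y
0≤* {x} {y} (*≤* p) (*≤* q) = *≤* λ η 0<η →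
  let A , ∣x∣≤A = bounded (seq x) (cauchy x)
      B , ∣y∣≤B = bounded (seq y) (cauchy y)
      N , h = both (both ∣x∣≤A ∣y∣≤B) (both (p (frac η B) (frac-pos B 0<η)) (q (frac η A) (frac-pos A 0<η)))
  in N , λ n N≤n → let ((a , b) , (c , d)) = h n N≤n in
    subst (λ z → 0ℚ ℚ.≤ z ℚ.+ η) (sym (seq-* x y n))
      (*-almost-nonneg (seq x n) (seq y n) {ι (suc A)} {ι (suc B)} {frac η B} {frac η A} {η}
        a b (ℚ.<⇒≤ 0<η) c d
        (ℚ.≤-reflexive (frac-* η B)) (ℚ.≤-reflexive (frac-* η A)))

+-assoc : ∀ x y z → (x + y) + z ≃ x + (y + z)
+-assoc x y z = termwise λ n → trans (seq-+ (x + y) z n) (trans (cong (ℚ._+ seq z n) (seq-+ x y n))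
  (trans (ℚ.+-assoc (seq x n) (seq y n) (seq z n))
  (sym (trans (seq-+ x (y + z) n) (cong (seq x n ℚ.+_) (seq-+ y z n))))))

+-comm : ∀ x y → x + y ≃ y + x
+-comm x y = termwise λ n → trans (seq-+ x y n)
  (trans (ℚ.+-comm (seq x n) (seq y n)) (sym (seq-+ y x n)))

+-identityʳ : ∀ x → x + 0ℝ ≃ x
+-identityʳ x = termwise λ n → trans (seq-+ x 0ℝ n) (ℚ.+-identityʳ (seq x n))

+-identityˡ : ∀ x → 0ℝ + x ≃ x
+-identityˡ x = termwise λ n → trans (seq-+ 0ℝ x n) (ℚ.+-identityˡ (seq x n))

+-inverseʳ : ∀ x → x + - x ≃ 0ℝ
+-inverseʳ x = termwise λ n → trans (seq-+ x (- x) n)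
  (trans (cong (seq x n ℚ.+_) (seq-neg x n)) (ℚ.+-inverseʳ (seq x n)))

+-inverseˡ : ∀ x → - x + x ≃ 0ℝ
+-inverseˡ x = ≃-trans (+-comm (- x) x) (+-inverseʳ x)

*-assoc : ∀ x y z → (x * y) * z ≃ x * (y * z)
*-assoc x y z = termwise λ n → trans (seq-* (x * y) z n) (trans (cong (ℚ._* seq z n) (seq-* x y n))
  (trans (ℚ.*-assoc (seq x n) (seq y n) (seq z n))
  (sym (trans (seq-* x (y * z) n) (cong (seq x n ℚ.*_) (seq-* y z n))))))

*-comm : ∀ x y → x * y ≃ y * x
*-comm x y = termwise λ n → trans (seq-* x y n)
  (trans (ℚ.*-comm (seq x n) (seq y n)) (sym (seq-* y x n)))

*-identityˡ : ∀ x → 1ℝ * x ≃ x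
*-identityˡ x = termwise λ n → trans (seq-* 1ℝ x n) (ℚ.*-identityˡ (seq x n))

*-identityʳ : ∀ x → x * 1ℝ ≃ x
*-identityʳ x = ≃-trans (*-comm x 1ℝ) (*-identityˡ x)

distribˡ : ∀ x y z → x * (y + z) ≃ x * y + x * z
distribˡ x y z = termwise λ n → trans (seq-* x (y + z) n) (trans (cong (seq x n ℚ.*_) (seq-+ y z n))
  (trans (ℚ.*-distribˡ-+ (seq x n) (seq y n) (seq z n))
  (sym (trans (seq-+ (x * y) (x * z) n) (cong₂ ℚ._+_ (seq-* x y n) (seq-* x z n))))))

distribʳ : ∀ x y z → (y + z) * x ≃ y * x + z * x
distribʳ x y z = ≃-trans (*-comm (y + z) x)
  (≃-trans (distribˡ x y z) (+-cong (*-comm x y) (*-comm x z)))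

≤⇒0≤- : ∀ {x y} → x ≤ y → 0ℝ ≤ y + - x
≤⇒0≤- {x} {y} h = ≤-trans (proj₂ (+-inverseʳ x)) (+-mono h (≤-refl { - x}))

0≤-⇒≤ : ∀ {x y} → 0ℝ ≤ y + - x → x ≤ y
0≤-⇒≤ {x} {y} h = begin
  x                 ≈⟨ +-identityˡ x ⟨
  0ℝ + x            ≤⟨ +-mono h ≤-refl ⟩
  (y + - x) + x     ≈⟨ +-assoc y (- x) x ⟩
  y + (- x + x)     ≈⟨ +-cong ≃-refl (+-inverseˡ x) ⟩
  y + 0ℝ            ≈⟨ +-identityʳ y ⟩
  y                 ∎
  where open ≤-Reasoning

*-neg : ∀ x y → x * - y ≃ - (x * y)
*-neg x y = termwise λ n → trans (seq-* x (- y) n) (trans (cong (seq x n ℚ.*_) (seq-neg y n))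
  (sym (trans (seq-neg (x * y) n) (trans (cong ℚ.-_ (seq-* x y n)) (ℚ.neg-distribʳ-* (seq x n) (seq y n))))))

*-monoʳ : ∀ {c x y} → 0ℝ ≤ c → x ≤ y → c * x ≤ c * y
*-monoʳ {c} {x} {y} 0≤c x≤y = 0≤-⇒≤ (begin
  0ℝ                  ≤⟨ 0≤* 0≤c (≤⇒0≤- x≤y) ⟩
  c * (y + - x)       ≈⟨ distribˡ c y (- x) ⟩
  c * y + c * - x     ≈⟨ +-cong ≃-refl (*-neg c x) ⟩
  c * y + - (c * x)   ∎)
  where open ≤-Reasoning

*-monoˡ : ∀ {c x y} → 0ℝ ≤ c → x ≤ y → x * c ≤ y * c
*-monoˡ {c} {x} {y} 0≤c x≤y = ≤-trans (proj₁ (*-comm x c)) (≤-trans (*-monoʳ 0≤c x≤y) (proj₁ (*-comm c y)))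

*-mono : ∀ {x y u v} → 0ℝ ≤ y → 0ℝ ≤ u → x ≤ y → u ≤ v → x * u ≤ y * v
*-mono 0≤y 0≤u x≤y u≤v = ≤-trans (*-monoˡ 0≤u x≤y) (*-monoʳ 0≤y u≤v)

-- A factor of unknown sign is not monotone, so the bound uses both
-- inequalities between x and y.
*-congˡ : ∀ {c x y} → x ≃ y → c * x ≃ c * y
*-congˡ {c} (p , q) = one p q , one q p
  where
  open ℚ.≤-Reasoning
  open +-*-Solver using (solve; _:=_; _:+_; _:*_; :-_; _:-_)
  close : ∀ a b d → a ℚ.≤ b ℚ.+ d → a ℚ.- b ℚ.≤ d
  close a b d h = begin
    a ℚ.- b             ≤⟨ ℚ.+-monoˡ-≤ (ℚ.- b) h ⟩
    b ℚ.+ d ℚ.- b       ≡⟨ solve 2 (λ b d → b :+ d :- b := d) refl b d ⟩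
    d                   ∎
  near : ∀ c x y C d → 0ℚ ℚ.≤ d → ℚ.∣ c ∣ ℚ.≤ C → x ℚ.≤ y ℚ.+ d → y ℚ.≤ x ℚ.+ d →
         c ℚ.* x ℚ.≤ c ℚ.* y ℚ.+ C ℚ.* d
  near c x y C d 0≤d ∣c∣≤C x≤ y≤ = begin
    c ℚ.* x
      ≡⟨ solve 3 (λ c x y → c :* x := c :* y :+ c :* (x :- y)) refl c x y ⟩
    c ℚ.* y ℚ.+ c ℚ.* (x ℚ.- y)
      ≤⟨ ℚ.+-monoʳ-≤ (c ℚ.* y) (ℚL.p≤∣p∣ (c ℚ.* (x ℚ.- y))) ⟩
    c ℚ.* y ℚ.+ ℚ.∣ c ℚ.* (x ℚ.- y) ∣
      ≡⟨ cong (c ℚ.* y ℚ.+_) (ℚ.∣p*q∣≡∣p∣*∣q∣ c (x ℚ.- y)) ⟩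
    c ℚ.* y ℚ.+ ℚ.∣ c ∣ ℚ.* ℚ.∣ x ℚ.- y ∣
      ≤⟨ ℚ.+-monoʳ-≤ (c ℚ.* y) (ℚL.*-mono {ℚ.∣ c ∣} {C} {ℚ.∣ x ℚ.- y ∣} {d} (ℚ.0≤∣p∣ c) 0≤d ∣c∣≤C
           (ℚL.∣∣≤ (close x y d x≤)
             (subst (ℚ._≤ d) (solve 2 (λ x y → y :- x := :- (x :- y)) refl x y) (close y x d y≤)))) ⟩
    c ℚ.* y ℚ.+ C ℚ.* d ∎
  one : ∀ {x y} → x ≤ y → y ≤ x → c * x ≤ c * y
  one {x} {y} (*≤* p) (*≤* q) = *≤* λ η 0<η →
    let B , ∣c∣≤B = bounded (seq c) (cauchy c)
        d = frac η B
        N , h = both ∣c∣≤B (both (p d (frac-pos B 0<η)) (q d (frac-pos B 0<η)))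
    in N , λ n N≤n → let (b , (u , v)) = h n N≤n in
      subst₂ (λ s t → s ℚ.≤ t ℚ.+ η) (sym (seq-* c x n)) (sym (seq-* c y n))
        (subst (λ t → seq c n ℚ.* seq x n ℚ.≤ seq c n ℚ.* seq y n ℚ.+ t) (frac-* η B)
          (near (seq c n) (seq x n) (seq y n) (ι (suc B)) d (ℚ.<⇒≤ (frac-pos B 0<η)) b u v))

*-cong : ∀ {x y u v} → x ≃ y → u ≃ v → x * u ≃ y * v
*-cong {x} {y} {u} {v} p q = ≃-trans (*-congˡ {x} q)
  (≃-trans (*-comm x v) (≃-trans (*-congˡ {v} p) (*-comm v y)))

ℝ-ring : CommutativeRing _ _
ℝ-ring = record
  { Carrier = ℝ
  ; _≈_ = _≃_
  ; _+_ = _+_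
  ; _*_ = _*_
  ; -_ = -_
  ; 0# = 0ℝ
  ; 1# = 1ℝ
  ; isCommutativeRing = record
    { isRing = record
      { +-isAbelianGroup = record
        { isGroup = record
          { isMonoid = record
            { isSemigroup = record
              { isMagma = record
                { isEquivalence = record { refl = ≃-refl ; sym = ≃-sym ; trans = ≃-trans }
                ; ∙-cong = +-cong
                }
              ; assoc = +-assoc
              }
            ; identity = +-identityˡ , +-identityʳ
            }
          ; inverse = +-inverseˡ , +-inverseʳ
          ; ⁻¹-cong = λ (p , q) → neg-anti q , neg-anti p
          }
        ; comm = +-comm
        }
      ; *-cong = *-cong
      ; *-assoc = *-assoc
      ; *-identity = *-identityˡ , *-identityʳ
      ; distrib = distribˡ , distribʳ
      }
    ; *-comm = *-comm
    }
  }

constants : CommutativeRing.rawRing ℚ.+-*-commutativeRing -Raw-AlmostCommutative⟶ fromCommutativeRing ℝ-ring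
constants = record
  { ⟦_⟧ = fromℚ
  ; +-homo = fromℚ-+
  ; *-homo = fromℚ-*
  ; -‿homo = fromℚ-neg
  ; 0-homo = ≃-refl
  ; 1-homo = ≃-refl
  }

_≟ᶜ_ : ∀ p q → Maybe (fromℚ p ≃ fromℚ q)
p ≟ᶜ q with p ℚ.≟ q
... | yes refl = just ≃-refl
... | no _     = nothing

open Algebra.Solver.Ring (CommutativeRing.rawRing ℚ.+-*-commutativeRing)
  (fromCommutativeRing ℝ-ring) constants _≟ᶜ_
  using (Polynomial; solve; _:=_; _:+_; _:*_; :-_; _:-_; con)

-- Order

0≤1 : 0ℝ ≤ 1ℝ
0≤1 = fromℚ-mono (ℚ.nonNegative⁻¹ 1ℚ)

+-monoʳ : ∀ {x y z} → y ≤ z → x + y ≤ x + z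
+-monoʳ = +-mono ≤-refl

+-nonneg : ∀ {x y} → 0ℝ ≤ x → 0ℝ ≤ y → 0ℝ ≤ x + y
+-nonneg p q = ≤-trans (proj₂ (+-identityʳ 0ℝ)) (+-mono p q)

x≤x+y : ∀ {x y} → 0ℝ ≤ y → x ≤ x + y
x≤x+y {x} h = ≤-trans (proj₂ (+-identityʳ x)) (+-monoʳ h)

≤+⇒-≤ : ∀ {x y z} → x ≤ y + z → x + - z ≤ y
≤+⇒-≤ {x} {y} {z} h = ≤-trans (+-mono h ≤-refl) (proj₁ (solve 2 (λ y z → (y :+ z) :- z := y) ≃-refl y z))

0≤x² : ∀ x → 0ℝ ≤ x * x
0≤x² x = exact (0 , λ n _ → subst (0ℚ ℚ.≤_) (sym (seq-* x x n)) (square (seq x n)))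
  where
  open +-*-Solver using () renaming (solve to solveℚ; _:=_ to _:=ℚ_; _:*_ to _:*ℚ_; :-_ to :-ℚ_)
  square : ∀ a → 0ℚ ℚ.≤ a ℚ.* a
  square a with ℚ.≤-total 0ℚ a
  ... | inj₁ 0≤a = ℚL.*-nonneg 0≤a 0≤a
  ... | inj₂ a≤0 = subst (0ℚ ℚ.≤_) (solveℚ 1 (λ a → :-ℚ a :*ℚ :-ℚ a :=ℚ a :*ℚ a) refl a)
    (ℚL.*-nonneg (ℚ.neg-antimono-≤ a≤0) (ℚ.neg-antimono-≤ a≤0))

∣∣-least : ∀ {x y} → x ≤ y → - x ≤ y → ∣ x ∣ ≤ y
∣∣-least {x} {y} (*≤* p) (*≤* q) = *≤* λ η 0<η →
  let N , h = both (p η 0<η) (q η 0<η)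
  in N , λ n N≤n → subst (ℚ._≤ seq y n ℚ.+ η) (sym (seq-∣∣ x n))
       (ℚL.∣∣≤ (proj₁ (h n N≤n)) (subst (ℚ._≤ seq y n ℚ.+ η) (seq-neg x n) (proj₂ (h n N≤n))))

≤-+-close : ∀ {a b d} → ℚ.∣ a ℚ.- b ∣ ℚ.≤ d → a ℚ.≤ b ℚ.+ d
≤-+-close {a} {b} {d} = ℚL.∣-∣≤⇒≤+ {a} {b} {d}

-- A term of the sequence that is within half of b - a of all later ones lies on
-- one side of the midpoint, and this settles one of the alternatives.
compare : ∀ x {a b} → a ℚ.< b → fromℚ a ≤ x ⊎ x ≤ fromℚ b
compare x {a} {b} a<b = decide (ℚ.≤-total (a ℚ.+ h) (seq x N))
  where
  open ℚ.≤-Reasoning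
  open +-*-Solver using () renaming (solve to solveℚ; _:=_ to _:=ℚ_; _:+_ to _:+ℚ_; _:-_ to _:-ℚ_)
  h = (b ℚ.- a) ℚ.* ½
  0<h : 0ℚ ℚ.< h
  0<h = ½-pos (subst (ℚ._< b ℚ.- a) (ℚ.+-inverseʳ a) (ℚ.+-monoˡ-< (ℚ.- a) a<b))
  N = proj₁ (cauchy x h 0<h)
  close : ∀ m n → N ℕ.≤ m → N ℕ.≤ n → seq x m ℚ.≤ seq x n ℚ.+ h
  close m n N≤m N≤n = ≤-+-close {seq x m} {seq x n} {h} (proj₂ (cauchy x h 0<h) m n N≤m N≤n)
  cancel : ∀ p r → p ℚ.+ r ℚ.- r ≡ p
  cancel = solveℚ 2 (λ p r → p :+ℚ r :-ℚ r :=ℚ p) refl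
  a+2h≡b : a ℚ.+ h ℚ.+ h ≡ b
  a+2h≡b = trans (ℚ.+-assoc a h h) (trans (cong (a ℚ.+_) (halves (b ℚ.- a)))
    (solveℚ 2 (λ a b → a :+ℚ (b :-ℚ a) :=ℚ b) refl a b))
  decide : a ℚ.+ h ℚ.≤ seq x N ⊎ seq x N ℚ.≤ a ℚ.+ h → fromℚ a ≤ x ⊎ x ≤ fromℚ b
  decide (inj₁ mid≤) = inj₁ (exact (N , λ n N≤n →
    subst₂ ℚ._≤_ (cancel a h) (cancel (seq x n) h)
      (ℚ.+-monoˡ-≤ (ℚ.- h) (ℚ.≤-trans mid≤ (close N n ℕ.≤-refl N≤n)))))
  decide (inj₂ ≤mid) = inj₂ (exact (N , λ n N≤n →
    subst (seq x n ℚ.≤_) a+2h≡b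
      (ℚ.≤-trans (close n N N≤n ℕ.≤-refl) (ℚ.+-monoˡ-≤ h ≤mid))))

ℚ≤⇒< : ∀ {x a b} → x ≤ fromℚ a → a ℚ.< b → x < fromℚ b
ℚ≤⇒< {x} {a} {b} (*≤* h) a<b = *<* c 0<c (map-eventually (h c 0<c))
  where
  open ℚ.≤-Reasoning
  open +-*-Solver using () renaming (solve to solveℚ; _:=_ to _:=ℚ_; _:+_ to _:+ℚ_; _:-_ to _:-ℚ_)
  c = (b ℚ.- a) ℚ.* ½
  0<c : 0ℚ ℚ.< c
  0<c = ½-pos (subst (ℚ._< b ℚ.- a) (ℚ.+-inverseʳ a) (ℚ.+-monoˡ-< (ℚ.- a) a<b))
  map-eventually : Eventually (λ n → seq x n ℚ.≤ a ℚ.+ c) → Eventually (λ n → seq x n ℚ.+ c ℚ.≤ b)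
  map-eventually (N , g) = N , λ n N≤n → begin
    seq x n ℚ.+ c            ≤⟨ ℚ.+-monoˡ-≤ c (g n N≤n) ⟩
    a ℚ.+ c ℚ.+ c            ≡⟨ ℚ.+-assoc a c c ⟩
    a ℚ.+ (c ℚ.+ c)          ≡⟨ cong (a ℚ.+_) (halves (b ℚ.- a)) ⟩
    a ℚ.+ (b ℚ.- a)          ≡⟨ solveℚ 2 (λ a b → a :+ℚ (b :-ℚ a) :=ℚ b) refl a b ⟩
    b                        ∎

0<fromℚ≤ : ∀ {x c} → 0ℚ ℚ.< c → fromℚ c ≤ x → 0ℝ < x
0<fromℚ≤ {x} {c} 0<c (*≤* h) = *<* (c ℚ.* ½) (½-pos 0<c) (proj₁ ev , λ n N≤n → begin
    0ℚ ℚ.+ c ℚ.* ½                       ≡⟨ ℚ.+-identityˡ (c ℚ.* ½) ⟩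
    c ℚ.* ½                              ≡⟨ solveℚ 1 (λ c → c :*ℚ conℚ ½ :=ℚ c :-ℚ c :*ℚ conℚ ½) refl c ⟩
    c ℚ.- c ℚ.* ½                        ≤⟨ ℚ.+-monoˡ-≤ (ℚ.- (c ℚ.* ½)) (proj₂ ev n N≤n) ⟩
    seq x n ℚ.+ c ℚ.* ½ ℚ.- c ℚ.* ½      ≡⟨ solveℚ 2 (λ x c → x :+ℚ c :-ℚ c :=ℚ x) refl (seq x n) (c ℚ.* ½) ⟩
    seq x n                              ∎)
  where
  open ℚ.≤-Reasoning
  open +-*-Solver using () renaming (solve to solveℚ; _:=_ to _:=ℚ_; _:+_ to _:+ℚ_; _:-_ to _:-ℚ_; _:*_ to _:*ℚ_; con to conℚ)
  ev = h (c ℚ.* ½) (½-pos 0<c)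

<-fromℚ-cancel : ∀ {a b} → fromℚ a < fromℚ b → a ℚ.< b
<-fromℚ-cancel {a} (*<* c 0<c (N , g)) =
  ℚ.<-≤-trans (subst (ℚ._< a ℚ.+ c) (ℚ.+-identityʳ a) (ℚ.+-monoʳ-< a 0<c)) (g N ℕ.≤-refl)

fromℚ-cancel : ∀ {a b} → fromℚ a ≤ fromℚ b → a ℚ.≤ b
fromℚ-cancel {a} {b} h = ℚ.≮⇒≥ λ b<a →
  ℚ.<-irrefl refl (<-fromℚ-cancel {a} {a} (ℚ≤⇒< {fromℚ a} {b} {a} h b<a))

<⇒≤ : ∀ {x y} → x < y → x ≤ y
<⇒≤ {x} {y} (*<* c 0<c (N , h)) = exact (N , λ n N≤n → begin
  seq x n            ≡⟨ sym (ℚ.+-identityʳ (seq x n)) ⟩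
  seq x n ℚ.+ 0ℚ     ≤⟨ ℚ.+-monoʳ-≤ (seq x n) (ℚ.<⇒≤ 0<c) ⟩
  seq x n ℚ.+ c      ≤⟨ h n N≤n ⟩
  seq y n            ∎)
  where open ℚ.≤-Reasoning

-- Inverses

eventually-pos : ∀ {x} → 0ℝ < x → Eventually λ n → 0ℚ ℚ.< seq x n
eventually-pos {x} (*<* c 0<c (N , h)) = N , λ n N≤n →
  ℚ.<-≤-trans 0<c (subst (ℚ._≤ seq x n) (ℚ.+-identityˡ c) (h n N≤n))

⁻¹-inverse : ∀ {x} (x>0 : 0ℝ < x) → x * x ⁻¹⟨ x>0 ⟩ ≃ 1ℝ
⁻¹-inverse {x} x>0 = let N , h = eventually-pos x>0 in
  exact (N , λ n N≤n → ℚ.≤-reflexive (eq n (h n N≤n))) ,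
  exact (N , λ n N≤n → ℚ.≤-reflexive (sym (eq n (h n N≤n))))
  where
  eq : ∀ n → 0ℚ ℚ.< seq x n → seq (x * x ⁻¹⟨ x>0 ⟩) n ≡ 1ℚ
  eq n 0<xn = trans (seq-* x (x ⁻¹⟨ x>0 ⟩) n)
    (trans (cong (seq x n ℚ.*_) (seq-⁻¹ x x>0 n)) (1/₀-inverse 0<xn))

⁻¹-nonneg : ∀ {x} (x>0 : 0ℝ < x) → 0ℝ ≤ x ⁻¹⟨ x>0 ⟩
⁻¹-nonneg {x} x>0 = let N , h = eventually-pos x>0 in exact (N , λ n N≤n →
  subst (0ℚ ℚ.≤_) (sym (seq-⁻¹ x x>0 n)) (nonneg (seq x n) (h n N≤n)))
  where
  nonneg : ∀ a → 0ℚ ℚ.< a → 0ℚ ℚ.≤ 1/₀ a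
  nonneg a 0<a = ℚ.*-cancelˡ-≤-pos a {{ℚ.positive 0<a}} (begin
    a ℚ.* 0ℚ       ≡⟨ ℚ.*-zeroʳ a ⟩
    0ℚ             ≤⟨ ℚ.nonNegative⁻¹ 1ℚ ⟩
    1ℚ             ≡⟨ sym (1/₀-inverse 0<a) ⟩
    a ℚ.* 1/₀ a    ∎)
    where open ℚ.≤-Reasoning

*-cancelʳ-≤ : ∀ {x y z} → 0ℝ < z → x * z ≤ y * z → x ≤ y
*-cancelʳ-≤ {x} {y} {z} z>0 h = begin
  x                           ≈⟨ expand x ⟩
  (x * z) * z ⁻¹⟨ z>0 ⟩       ≤⟨ *-monoˡ (⁻¹-nonneg z>0) h ⟩
  (y * z) * z ⁻¹⟨ z>0 ⟩       ≈⟨ expand y ⟨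
  y                           ∎
  where
  open ≤-Reasoning
  expand : ∀ x → x ≃ (x * z) * z ⁻¹⟨ z>0 ⟩
  expand x = ≃-trans (≃-sym (*-identityʳ x))
    (≃-trans (*-congˡ {x} (≃-sym (⁻¹-inverse z>0))) (≃-sym (*-assoc x z (z ⁻¹⟨ z>0 ⟩))))

-- The witness of x > 0 may be far below x, so d is half of a term of the
-- sequence that is late enough to be within half of that witness of all later ones.
magnitude : ∀ {x} → 0ℝ < x → ∃ λ d → 0ℚ ℚ.< d × fromℚ d ≤ x × x ≤ fromℚ (ι 4 ℚ.* d)
magnitude {x} (*<* c 0<c (N , h)) = d , ½-pos (ℚ.<-≤-trans 0<c c≤xm) ,
  exact (m , λ n m≤n → lower (seq x m) (seq x n) c≤xm (close m n ℕ.≤-refl m≤n)) ,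
  exact (m , λ n m≤n → upper (seq x m) (seq x n) c≤xm (close n m m≤n ℕ.≤-refl))
  where
  open ℚ.≤-Reasoning
  open +-*-Solver using () renaming (solve to solveℚ; _:=_ to _:=ℚ_; _:+_ to _:+ℚ_; _:-_ to _:-ℚ_; _:*_ to _:*ℚ_; con to conℚ)
  M = proj₁ (cauchy x (c ℚ.* ½) (½-pos 0<c))
  m = M ℕ.⊔ N
  d = seq x m ℚ.* ½
  c≤xm : c ℚ.≤ seq x m
  c≤xm = subst (ℚ._≤ seq x m) (ℚ.+-identityˡ c) (h m (ℕ.m≤n⊔m M N))
  close : ∀ i j → m ℕ.≤ i → m ℕ.≤ j → ℚ.∣ seq x i ℚ.- seq x j ∣ ℚ.≤ c ℚ.* ½
  close i j m≤i m≤j = proj₂ (cauchy x (c ℚ.* ½) (½-pos 0<c)) i j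
    (ℕ.≤-trans (ℕ.m≤m⊔n M N) m≤i) (ℕ.≤-trans (ℕ.m≤m⊔n M N) m≤j)
  halve : ∀ {a b} → a ℚ.≤ b → a ℚ.* ½ ℚ.≤ b ℚ.* ½
  halve = ℚ.*-monoʳ-≤-nonNeg ½
  lower : ∀ a b → c ℚ.≤ a → ℚ.∣ a ℚ.- b ∣ ℚ.≤ c ℚ.* ½ → a ℚ.* ½ ℚ.≤ b
  lower a b c≤a g = begin
    a ℚ.* ½                                ≡⟨ solveℚ 1 (λ a → a :*ℚ conℚ ½ :=ℚ a :-ℚ a :*ℚ conℚ ½) refl a ⟩
    a ℚ.- a ℚ.* ½                          ≤⟨ ℚ.+-monoˡ-≤ (ℚ.- (a ℚ.* ½)) (≤-+-close {a} {b} g) ⟩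
    b ℚ.+ c ℚ.* ½ ℚ.- a ℚ.* ½              ≤⟨ ℚ.+-monoˡ-≤ (ℚ.- (a ℚ.* ½)) (ℚ.+-monoʳ-≤ b (halve c≤a)) ⟩
    b ℚ.+ a ℚ.* ½ ℚ.- a ℚ.* ½              ≡⟨ solveℚ 2 (λ b a → b :+ℚ a :-ℚ a :=ℚ b) refl b (a ℚ.* ½) ⟩
    b                                      ∎
  upper : ∀ a b → c ℚ.≤ a → ℚ.∣ b ℚ.- a ∣ ℚ.≤ c ℚ.* ½ → b ℚ.≤ ι 4 ℚ.* (a ℚ.* ½)
  upper a b c≤a g = begin
    b                               ≤⟨ ≤-+-close {b} {a} g ⟩
    a ℚ.+ c ℚ.* ½                   ≤⟨ ℚ.+-monoʳ-≤ a (halve c≤a) ⟩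
    a ℚ.+ a ℚ.* ½                   ≡⟨ sym (ℚ.+-identityʳ (a ℚ.+ a ℚ.* ½)) ⟩
    a ℚ.+ a ℚ.* ½ ℚ.+ 0ℚ            ≤⟨ ℚ.+-monoʳ-≤ (a ℚ.+ a ℚ.* ½) (ℚ.≤-trans (ℚ.<⇒≤ (½-pos 0<c)) (halve c≤a)) ⟩
    a ℚ.+ a ℚ.* ½ ℚ.+ a ℚ.* ½       ≡⟨ solveℚ 1 (λ a → a :+ℚ a :*ℚ conℚ ½ :+ℚ a :*ℚ conℚ ½ :=ℚ conℚ (ι 4) :*ℚ (a :*ℚ conℚ ½)) refl a ⟩
    ι 4 ℚ.* (a ℚ.* ½)               ∎

-- Finite sums

open SemiringSum (CommutativeRing.semiring ℝ-ring)
  using () renaming (∑-distrib-+ to ∑-+; ∑-comm to ∑-swap; *-distribˡ-sum to ∑-*ˡ; *-distribʳ-sum to ∑-*ʳ)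

∑-mono : ∀ {n} {f g : Fin n → ℝ} → (∀ i → f i ≤ g i) → ∑ f ≤ ∑ g
∑-mono {zero}  h = ≤-refl
∑-mono {suc n} h = +-mono (h zero) (∑-mono λ i → h (suc i))

∑-cong : ∀ {n} {f g : Fin n → ℝ} → (∀ i → f i ≃ g i) → ∑ f ≃ ∑ g
∑-cong h = ∑-mono (λ i → proj₁ (h i)) , ∑-mono (λ i → proj₂ (h i))

*-zeroʳ : ∀ x → x * 0ℝ ≃ 0ℝ
*-zeroʳ x = solve 1 (λ x → x :* con 0ℚ := con 0ℚ) ≃-refl x

*-zeroˡ : ∀ x → 0ℝ * x ≃ 0ℝ
*-zeroˡ x = solve 1 (λ x → con 0ℚ :* x := con 0ℚ) ≃-refl x

fromℕ-suc : ∀ n → fromℕ (suc n) ≃ 1ℝ + fromℕ n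
fromℕ-suc n = ≃-trans (termwise λ _ → ι-+ 1 n) (fromℚ-+ 1ℚ (ι n))

∑-const : ∀ n c → ∑ {n} (λ _ → c) ≃ fromℕ n * c
∑-const zero    c = ≃-sym (*-zeroˡ c)
∑-const (suc n) c = begin-equality
  c + ∑ {n} (λ _ → c)    ≈⟨ +-cong ≃-refl (∑-const n c) ⟩
  c + fromℕ n * c        ≈⟨ solve 2 (λ c n → c :+ n :* c := (con 1ℚ :+ n) :* c) ≃-refl c (fromℕ n) ⟩
  (1ℝ + fromℕ n) * c     ≈⟨ *-cong (fromℕ-suc n) ≃-refl ⟨
  fromℕ (suc n) * c      ∎
  where open ≤-Reasoning

∑-zero : ∀ {n} {f : Fin n → ℝ} → (∀ i → f i ≃ 0ℝ) → ∑ f ≃ 0ℝ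
∑-zero {n} h = ≃-trans (∑-cong h) (≃-trans (∑-const n 0ℝ) (*-zeroʳ (fromℕ n)))

∑-nonneg : ∀ {n} {f : Fin n → ℝ} → (∀ i → 0ℝ ≤ f i) → 0ℝ ≤ ∑ f
∑-nonneg {n} h = ≤-trans (proj₂ (∑-zero {n} λ _ → ≃-refl)) (∑-mono h)

𝟙 : Bool → ℝ
𝟙 b = if b then 1ℝ else 0ℝ

0≤𝟙 : ∀ b → 0ℝ ≤ 𝟙 b
0≤𝟙 true  = 0≤1
0≤𝟙 false = ≤-refl

𝟙-idem : ∀ b → 𝟙 b * 𝟙 b ≃ 𝟙 b
𝟙-idem true  = *-identityˡ 1ℝ
𝟙-idem false = *-zeroˡ 0ℝ

if-𝟙 : ∀ b x → (if b then x else 0ℝ) ≃ 𝟙 b * x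
if-𝟙 true  x = ≃-sym (*-identityˡ x)
if-𝟙 false x = ≃-sym (*-zeroˡ x)

δ : ∀ {n} → Fin n → Fin n → ℝ
δ i j = 𝟙 (does (i ≟ j))

∑-δ : ∀ {n} j (f : Fin n → ℝ) → (∑ λ i → δ i j * f i) ≃ f j
∑-δ {suc n} zero f = begin-equality
  1ℝ * f zero + (∑ λ i → 0ℝ * f (suc i))
    ≈⟨ +-cong (*-identityˡ (f zero)) (∑-zero λ i → *-zeroˡ (f (suc i))) ⟩
  f zero + 0ℝ
    ≈⟨ +-identityʳ (f zero) ⟩
  f zero ∎
  where open ≤-Reasoning
∑-δ {suc n} (suc j) f = begin-equality
  0ℝ * f zero + (∑ λ i → δ i j * f (suc i))
    ≈⟨ +-cong (*-zeroˡ (f zero)) (∑-δ j (λ i → f (suc i))) ⟩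
  0ℝ + f (suc j)
    ≈⟨ +-identityˡ (f (suc j)) ⟩
  f (suc j) ∎
  where open ≤-Reasoning

∑-term : ∀ {n} {f : Fin n → ℝ} → (∀ i → 0ℝ ≤ f i) → ∀ j → f j ≤ ∑ f
∑-term {suc n} {f} h zero    = x≤x+y (∑-nonneg λ i → h (suc i))
∑-term {suc n} {f} h (suc j) = ≤-trans (∑-term (λ i → h (suc i)) j)
  (≤-trans (x≤x+y (h zero)) (proj₁ (+-comm _ (f zero))))

∑-+-split : ∀ m {n} (f : Fin (m ℕ.+ n) → ℝ) → ∑ f ≃ (∑ λ i → f (i ↑ˡ n)) + (∑ λ j → f (m ↑ʳ j))
∑-+-split zero    f = ≃-sym (+-identityˡ (∑ f))
∑-+-split (suc m) f = ≃-trans (+-cong ≃-refl (∑-+-split m (λ i → f (suc i))))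
  (≃-sym (+-assoc (f zero) _ _))

∑-*-split : ∀ m {n} (f : Fin (m ℕ.* n) → ℝ) → ∑ f ≃ ∑ λ i → ∑ λ j → f (combine {m} {n} i j)
∑-*-split zero        f = ≃-refl
∑-*-split (suc m) {n} f = ≃-trans (∑-+-split n f) (+-cong ≃-refl (∑-*-split m (λ k → f (n ↑ʳ k))))

-- Reciprocals of naturals

recip : ∀ n .{{_ : ℕ.NonZero n}} → ℚ
recip n = + 1 ℚ./ n

recip-inverse : ∀ n .{{_ : ℕ.NonZero n}} → ι n ℚ.* recip n ≡ 1ℚ
recip-inverse (suc k) = trans
  (cong (ι (suc k) ℚ.*_) (ℚ.normalize-coprime {1} {k} (1-coprimeTo (suc k))))
  (ℚ.*-inverseʳ (ι (suc k)))

recip-unique : ∀ n .{{_ : ℕ.NonZero n}} {q} → ι n ℚ.* q ≡ 1ℚ → recip n ≡ q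
recip-unique n {q} h = trans (sym (ℚ.*-identityʳ (recip n)))
  (trans (cong (recip n ℚ.*_) (sym h))
  (trans (solveℚ 3 (λ r n q → r :*ℚ (n :*ℚ q) :=ℚ (n :*ℚ r) :*ℚ q) refl (recip n) (ι n) q)
  (trans (cong (ℚ._* q) (recip-inverse n)) (ℚ.*-identityˡ q))))
  where open +-*-Solver using () renaming (solve to solveℚ; _:=_ to _:=ℚ_; _:*_ to _:*ℚ_)

recip-* : ∀ m n .{{_ : ℕ.NonZero m}} .{{_ : ℕ.NonZero n}} .{{_ : ℕ.NonZero (m ℕ.* n)}} →
          recip (m ℕ.* n) ≡ recip m ℚ.* recip n
recip-* m n = recip-unique (m ℕ.* n) (trans (cong (ℚ._* (recip m ℚ.* recip n)) (ι-* m n))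
  (trans (solveℚ 4 (λ m n a b → (m :*ℚ n) :*ℚ (a :*ℚ b) :=ℚ (m :*ℚ a) :*ℚ (n :*ℚ b)) refl
           (ι m) (ι n) (recip m) (recip n))
  (cong₂ ℚ._*_ (recip-inverse m) (recip-inverse n))))
  where open +-*-Solver using () renaming (solve to solveℚ; _:=_ to _:=ℚ_; _:*_ to _:*ℚ_)

0<recip : ∀ n .{{_ : ℕ.NonZero n}} → 0ℚ ℚ.< recip n
0<recip n@(suc _) = ℚ.*-cancelˡ-<-nonNeg (ι n)
  (subst₂ ℚ._<_ (sym (ℚ.*-zeroʳ (ι n))) (sym (recip-inverse n)) (ℚ.positive⁻¹ 1ℚ))

-- Means: positive normalised linear functionals, that is, expectations

-- Seeds and answers are treated alike through these four laws, so that no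
-- probability space has to be described.
record Mean (A : Set) : Set where
  field
    𝔼     : (A → ℝ) → ℝ
    mono  : ∀ {f g} → (∀ a → f a ≤ g a) → 𝔼 f ≤ 𝔼 g
    add   : ∀ f g → 𝔼 (λ a → f a + g a) ≃ 𝔼 f + 𝔼 g
    scale : ∀ c f → 𝔼 (λ a → c * f a) ≃ c * 𝔼 f
    unit  : 𝔼 (λ _ → 1ℝ) ≃ 1ℝ

  same : ∀ {f g} → (∀ a → f a ≃ g a) → 𝔼 f ≃ 𝔼 g
  same h = mono (λ a → proj₁ (h a)) , mono (λ a → proj₂ (h a))

  const : ∀ c → 𝔼 (λ _ → c) ≃ c
  const c = begin-equality
    𝔼 (λ _ → c)         ≈⟨ same (λ _ → *-identityʳ c) ⟨
    𝔼 (λ _ → c * 1ℝ)    ≈⟨ scale c (λ _ → 1ℝ) ⟩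
    c * 𝔼 (λ _ → 1ℝ)    ≈⟨ *-congˡ {c} unit ⟩
    c * 1ℝ              ≈⟨ *-identityʳ c ⟩
    c                   ∎
    where open ≤-Reasoning

  nonneg : ∀ {f} → (∀ a → 0ℝ ≤ f a) → 0ℝ ≤ 𝔼 f
  nonneg h = ≤-trans (proj₂ (const 0ℝ)) (mono h)

  affine : ∀ c d f → 𝔼 (λ a → c + d * f a) ≃ c + d * 𝔼 f
  affine c d f = ≃-trans (add (λ _ → c) (λ a → d * f a)) (+-cong (const c) (scale d f))

  sum : ∀ {n} (f : Fin n → A → ℝ) → 𝔼 (λ a → ∑ λ i → f i a) ≃ ∑ λ i → 𝔼 (f i)
  sum {zero}  f = const 0ℝ
  sum {suc n} f = ≃-trans (add (f zero) (λ a → ∑ λ i → f (suc i) a))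
    (+-cong ≃-refl (sum (λ i → f (suc i))))

open Mean using (𝔼)

always : ∀ {A} → A → Mean A
always a = record
  { 𝔼 = λ f → f a ; mono = λ h → h a ; add = λ _ _ → ≃-refl ; scale = λ _ _ → ≃-refl ; unit = ≃-refl }

bind : ∀ {A B} → Mean A → (A → Mean B) → Mean B
bind M K = record
  { 𝔼     = λ f → 𝔼 M λ a → 𝔼 (K a) f
  ; mono  = λ h → M.mono λ a → Mean.mono (K a) h
  ; add   = λ f g → ≃-trans (M.same λ a → Mean.add (K a) f g) (M.add (λ a → 𝔼 (K a) f) (λ a → 𝔼 (K a) g))
  ; scale = λ c f → ≃-trans (M.same λ a → Mean.scale (K a) c f) (M.scale c (λ a → 𝔼 (K a) f))
  ; unit  = ≃-trans (M.same λ a → Mean.unit (K a)) M.unit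
  }
  where module M = Mean M

mapMean : ∀ {A B} → (A → B) → Mean A → Mean B
mapMean h M = bind M λ a → always (h a)

weighted : ∀ {n} → Distribution n → Mean (Fin n)
weighted {n} μ = record
  { 𝔼     = λ f → ∑ λ i → mass μ i * f i
  ; mono  = λ h → ∑-mono λ i → *-monoʳ (Distribution.nonneg μ i) (h i)
  ; add   = λ f g → ≃-trans (∑-cong λ i → distribˡ (mass μ i) (f i) (g i))
                      (∑-+ (λ i → mass μ i * f i) (λ i → mass μ i * g i))
  ; scale = λ c f → ≃-trans
      (∑-cong λ i → solve 3 (λ m c f → m :* (c :* f) := c :* (m :* f)) ≃-refl (mass μ i) c (f i))
      (≃-sym (∑-*ˡ c (λ i → mass μ i * f i)))
  ; unit  = ≃-trans (∑-cong λ i → *-identityʳ (mass μ i)) (Distribution.total μ)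
  }

recip-real : ∀ n .{{_ : ℕ.NonZero n}} → fromℚ (recip n) * fromℕ n ≃ 1ℝ
recip-real n = ≃-trans (≃-sym (fromℚ-* (recip n) (ι n)))
  (termwise λ _ → trans (ℚ.*-comm (recip n) (ι n)) (recip-inverse n))

uniform : ∀ n .{{_ : ℕ.NonZero n}} → Mean (Fin n)
uniform n = record
  { 𝔼     = λ f → fromℚ (recip n) * ∑ f
  ; mono  = λ h → *-monoʳ 0≤r (∑-mono h)
  ; add   = λ f g → ≃-trans (*-congˡ {fromℚ (recip n)} (∑-+ f g)) (distribˡ (fromℚ (recip n)) (∑ f) (∑ g))
  ; scale = λ c f → ≃-trans (*-congˡ {fromℚ (recip n)} (≃-sym (∑-*ˡ c f)))
      (solve 3 (λ r c s → r :* (c :* s) := c :* (r :* s)) ≃-refl (fromℚ (recip n)) c (∑ f))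
  ; unit  = ≃-trans (*-congˡ {fromℚ (recip n)} (≃-trans (∑-const n 1ℝ) (*-identityʳ (fromℕ n)))) (recip-real n)
  }
  where
  0≤r : 0ℝ ≤ fromℚ (recip n)
  0≤r = fromℚ-mono (ℚ.<⇒≤ (0<recip n))

-- Samplers: random objects computed from a uniform seed

record Sampler (A : Set) : Set where
  field
    size     : ℕ
    {{pos}}  : ℕ.NonZero size
    draw     : Fin size → A
open Sampler

law : ∀ {A} → Sampler A → Mean A
law S = mapMean (draw S) (uniform (size S))

seed : ∀ n .{{_ : ℕ.NonZero n}} → Sampler (Fin n)
seed n@(suc _) = record { size = n ; draw = λ i → i }

mapSampler : ∀ {A B} → (A → B) → Sampler A → Sampler B
mapSampler h S = record { size = size S ; draw = λ r → h (draw S r) }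

infixr 4 _⊗_
_⊗_ : ∀ {A B} → Sampler A → Sampler B → Sampler (A × B)
S ⊗ T = record
  { size = size S ℕ.* size T
  ; pos  = ℕ.m*n≢0 (size S) (size T)
  ; draw = λ r → let (i , j) = remQuot {size S} (size T) r in draw S i , draw T j
  }

-- The product of the reciprocals of the sizes is the reciprocal of their product,
-- and the seeds of the pair are the pairs of seeds.
⊗-law : ∀ {A B} (S : Sampler A) (T : Sampler B) f →
        𝔼 (law (S ⊗ T)) f ≃ 𝔼 (law S) λ a → 𝔼 (law T) λ b → f (a , b)
⊗-law S T f = begin-equality
  fromℚ (recip (m ℕ.* n)) * (∑ λ r → g (remQuot {m} n r))
    ≈⟨ *-cong (≃-trans (termwise λ _ → recip-* m n) (fromℚ-* (recip m) (recip n)))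
              (≃-trans (∑-*-split m {n} (λ r → g (remQuot {m} n r)))
                (∑-cong λ i → ∑-cong λ j → ≡⇒≃ (cong g (Fin.remQuot-combine {m} {n} i j)))) ⟩
  (fromℚ (recip m) * fromℚ (recip n)) * (∑ λ i → ∑ λ j → g (i , j))
    ≈⟨ *-assoc (fromℚ (recip m)) (fromℚ (recip n)) _ ⟩
  fromℚ (recip m) * (fromℚ (recip n) * (∑ λ i → ∑ λ j → g (i , j)))
    ≈⟨ *-congˡ {fromℚ (recip m)} (∑-*ˡ (fromℚ (recip n)) (λ i → ∑ λ j → g (i , j))) ⟩
  fromℚ (recip m) * (∑ λ i → fromℚ (recip n) * ∑ λ j → g (i , j)) ∎
  where
  open ≤-Reasoning
  m = size S
  n = size T
  instance
    mn≢0 : ℕ.NonZero (m ℕ.* n)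
    mn≢0 = ℕ.m*n≢0 m n
  g : Fin m × Fin n → ℝ
  g (i , j) = f (draw S i , draw T j)
  ≡⇒≃ : ∀ {x y} → x ≡ y → x ≃ y
  ≡⇒≃ refl = ≃-refl

independent : ∀ {A} k → Sampler A → Sampler (Vec A k)
independent zero    S = record { size = 1 ; draw = λ _ → [] }
independent (suc k) S = mapSampler (uncurry _∷_) (S ⊗ independent k S)

independent-zero : ∀ {A} (S : Sampler A) f → 𝔼 (law (independent 0 S)) f ≃ f []
independent-zero S f = Mean.const (uniform 1) (f [])

independent-suc : ∀ {A} k (S : Sampler A) f →
  𝔼 (law (independent (suc k) S)) f ≃ 𝔼 (law S) λ a → 𝔼 (law (independent k S)) λ as → f (a ∷ as)
independent-suc k S f = ⊗-law S (independent k S) (λ (a , as) → f (a ∷ as))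

-- Collision probability of one conditional distribution

∑-lin : ∀ {n} c (f : Fin n → ℝ) d (g : Fin n → ℝ) →
        (∑ λ i → c * f i + d * g i) ≃ c * ∑ f + d * ∑ g
∑-lin c f d g = ≃-trans (∑-+ (λ i → c * f i) (λ i → d * g i)) (+-cong (≃-sym (∑-*ˡ c f)) (≃-sym (∑-*ˡ d g)))

2ℝ : ℝ
2ℝ = fromℕ 2

-- This is the inequality 0 ≤ ∑ (p - c a - w)², where a is the indicator of the
-- support and c the reciprocal of its size.  The weights w sum to zero, which is
-- why only the uniform part c of p remains.
square-bound : ∀ {n} (p a w : Fin n → ℝ) (c : ℝ) →
  (∀ v → a v * a v ≃ a v) → (∀ v → a v * p v ≃ p v) → (∀ v → a v * w v ≃ w v) →
  ∑ p ≃ 1ℝ → c * ∑ a ≃ 1ℝ → ∑ w ≃ 0ℝ →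
  c + 2ℝ * (∑ λ v → w v * p v) ≤ (∑ λ v → p v * p v) + (∑ λ v → w v * w v)
square-bound p a w c aa ap aw ∑p ∑a ∑w = begin
  c + 2ℝ * W                                            ≈⟨ solve 2 (λ c W → c :+ con (ι 2) :* W := (con (ι 2) :* c :* con 1ℚ :+ con (ι 2) :* W) :- c :* con 1ℚ) ≃-refl c W ⟩
  (2ℝ * c * 1ℝ + 2ℝ * W) + - (c * 1ℝ)                   ≈⟨ +-cong (+-cong (*-congˡ {2ℝ * c} ∑p) ≃-refl) ≃-refl ⟨
  (2ℝ * c * ∑ p + 2ℝ * W) + - (c * 1ℝ)                  ≤⟨ +-mono summed ≤-refl ⟩
  ((P + Q) + (c * c * ∑ a + 2ℝ * c * ∑ w)) + - (c * 1ℝ) ≈⟨ solve 5 (λ P Q c A w → ((P :+ Q) :+ (c :* c :* A :+ con (ι 2) :* c :* w)) :- c :* con 1ℚ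
                                                             := (P :+ Q) :+ (c :* (c :* A) :+ con (ι 2) :* c :* w) :- c :* con 1ℚ) ≃-refl P Q c (∑ a) (∑ w) ⟩
  (P + Q) + (c * (c * ∑ a) + 2ℝ * c * ∑ w) + - (c * 1ℝ) ≈⟨ +-cong (+-cong ≃-refl (+-cong (*-congˡ {c} ∑a) (*-congˡ {2ℝ * c} ∑w))) ≃-refl ⟩
  (P + Q) + (c * 1ℝ + 2ℝ * c * 0ℝ) + - (c * 1ℝ)         ≈⟨ solve 2 (λ s c → s :+ (c :* con 1ℚ :+ con (ι 2) :* c :* con 0ℚ) :- c :* con 1ℚ := s) ≃-refl (P + Q) c ⟩
  P + Q ∎
  where
  open ≤-Reasoning
  P = ∑ λ v → p v * p v
  Q = ∑ λ v → w v * w v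
  W = ∑ λ v → w v * p v
  pointwise : ∀ v → 2ℝ * c * p v + 2ℝ * (w v * p v) ≤ (p v * p v + w v * w v) + (c * c * a v + 2ℝ * c * w v)
  pointwise v = begin
    2ℝ * c * p v + 2ℝ * (w v * p v)
      ≈⟨ +-cong (*-congˡ {2ℝ * c} (ap v)) ≃-refl ⟨
    2ℝ * c * (a v * p v) + 2ℝ * (w v * p v)
      ≤⟨ 0≤-⇒≤ (≤-trans (0≤x² (p v + - (c * a v) + - w v)) (proj₁ (solve 4 (λ p a w c →
           (p :- c :* a :- w) :* (p :- c :* a :- w) :=
           (p :* p :+ w :* w) :+ (c :* c :* (a :* a) :+ con (ι 2) :* c :* (a :* w))
             :- (con (ι 2) :* c :* (a :* p) :+ con (ι 2) :* (w :* p))) ≃-refl (p v) (a v) (w v) c))) ⟩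
    (p v * p v + w v * w v) + (c * c * (a v * a v) + 2ℝ * c * (a v * w v))
      ≈⟨ +-cong ≃-refl (+-cong (*-congˡ {c * c} (aa v)) (*-congˡ {2ℝ * c} (aw v))) ⟩
    (p v * p v + w v * w v) + (c * c * a v + 2ℝ * c * w v) ∎
  summed : 2ℝ * c * ∑ p + 2ℝ * W ≤ (P + Q) + (c * c * ∑ a + 2ℝ * c * ∑ w)
  summed = begin
    2ℝ * c * ∑ p + 2ℝ * W
      ≈⟨ ∑-lin (2ℝ * c) p 2ℝ (λ v → w v * p v) ⟨
    (∑ λ v → 2ℝ * c * p v + 2ℝ * (w v * p v))
      ≤⟨ ∑-mono pointwise ⟩
    (∑ λ v → (p v * p v + w v * w v) + (c * c * a v + 2ℝ * c * w v))
      ≈⟨ ≃-trans (∑-+ (λ v → p v * p v + w v * w v) (λ v → c * c * a v + 2ℝ * c * w v))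
           (+-cong (∑-+ (λ v → p v * p v) (λ v → w v * w v)) (∑-lin (c * c) a (2ℝ * c) w)) ⟩
    (P + Q) + (c * c * ∑ a + 2ℝ * c * ∑ w) ∎

-- The weights are θ on the points marked by g, and their balance - θ N is put on
-- the single point j.  By the gap the linear term is at least θ γ ∑ g p, and the
-- squares of the weights cost at most θ² (N + N²).
marked-bound : ∀ {n} (p a g : Fin n → ℝ) (c θ γ : ℝ) j →
  (∀ v → a v * a v ≃ a v) → (∀ v → a v * p v ≃ p v) → (∀ v → a v * g v ≃ g v) → a j ≃ 1ℝ →
  (∀ v → g v * g v ≃ g v) → (∀ v → 0ℝ ≤ g v) →
  ∑ p ≃ 1ℝ → c * ∑ a ≃ 1ℝ → 0ℝ ≤ θ →
  (∀ v → g v * (γ * p v) ≤ g v * (p v + - p j)) →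
  c + 2ℝ * θ * γ * (∑ λ v → g v * p v) ≤ (∑ λ v → p v * p v) + θ * θ * (∑ g + ∑ g * ∑ g)
marked-bound {n} p a g c θ γ j aa ap ag aj gg 0≤g ∑p ∑a 0≤θ gap = begin
  c + 2ℝ * θ * γ * (∑ λ v → g v * p v)
    ≤⟨ +-monoʳ (≤-trans (proj₁ regroup) (*-monoʳ 0≤2 wp)) ⟩
  c + 2ℝ * (∑ λ v → w v * p v)
    ≤⟨ square-bound p a w c aa ap aw ∑p ∑a ∑w ⟩
  P + (∑ λ v → w v * w v)
    ≤⟨ +-monoʳ ww ⟩
  P + θ * θ * (N + N * N) ∎
  where
  open ≤-Reasoning
  N = ∑ g
  P = ∑ λ v → p v * p v
  w : Fin n → ℝ
  w v = θ * (g v + - N * δ v j)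
  0≤2 : 0ℝ ≤ 2ℝ
  0≤2 = fromℚ-mono (ℚ.nonNegative⁻¹ (ι 2))
  regroup : 2ℝ * θ * γ * (∑ λ v → g v * p v) ≃ 2ℝ * (θ * (γ * ∑ λ v → g v * p v))
  regroup = solve 4 (λ t a b s → t :* a :* b :* s := t :* (a :* (b :* s))) ≃-refl 2ℝ θ γ (∑ λ v → g v * p v)
  aδ : ∀ v → a v * δ v j ≃ δ v j
  aδ v with v ≟ j
  ... | yes refl = ≃-trans (*-identityʳ (a v)) aj
  ... | no  _    = *-zeroʳ (a v)
  aw : ∀ v → a v * w v ≃ w v
  aw v = ≃-trans (solve 5 (λ a t g N d → a :* (t :* (g :+ :- N :* d)) := t :* (a :* g :+ :- N :* (a :* d))) ≃-refl
                   (a v) θ (g v) N (δ v j))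
           (*-congˡ {θ} (+-cong (ag v) (*-congˡ { - N} (aδ v))))
  ∑δ : (f : Fin n → ℝ) → (∑ λ v → δ v j * f v) ≃ f j
  ∑δ = ∑-δ j
  ∑w : ∑ w ≃ 0ℝ
  ∑w = begin-equality
    ∑ w
      ≈⟨ ∑-cong (λ v → solve 4 (λ t g N d → t :* (g :+ :- N :* d) := t :* g :+ (:- (t :* N)) :* (d :* con 1ℚ)) ≃-refl θ (g v) N (δ v j)) ⟩
    (∑ λ v → θ * g v + - (θ * N) * (δ v j * 1ℝ))
      ≈⟨ ∑-lin θ g (- (θ * N)) (λ v → δ v j * 1ℝ) ⟩
    θ * N + - (θ * N) * (∑ λ v → δ v j * 1ℝ)
      ≈⟨ +-cong ≃-refl (*-congˡ { - (θ * N)} (∑δ (λ _ → 1ℝ))) ⟩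
    θ * N + - (θ * N) * 1ℝ
      ≈⟨ solve 1 (λ s → s :+ :- s :* con 1ℚ := con 0ℚ) ≃-refl (θ * N) ⟩
    0ℝ ∎
  wp : θ * (γ * ∑ λ v → g v * p v) ≤ ∑ λ v → w v * p v
  wp = begin
    θ * (γ * ∑ λ v → g v * p v)
      ≤⟨ *-monoʳ 0≤θ (begin
          γ * (∑ λ v → g v * p v)
            ≈⟨ ∑-*ˡ γ (λ v → g v * p v) ⟩
          (∑ λ v → γ * (g v * p v))
            ≤⟨ ∑-mono (λ v → ≤-trans (proj₁ (solve 3 (λ y g p → y :* (g :* p) := g :* (y :* p)) ≃-refl γ (g v) (p v)))
                 (≤-trans (gap v) (proj₁ (solve 3 (λ g p q → g :* (p :- q) := con 1ℚ :* (g :* p) :+ :- q :* g) ≃-refl (g v) (p v) (p j))))) ⟩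
          (∑ λ v → 1ℝ * (g v * p v) + - p j * g v)
            ≈⟨ ∑-lin 1ℝ (λ v → g v * p v) (- p j) g ⟩
          1ℝ * (∑ λ v → g v * p v) + - p j * N ∎) ⟩
    θ * (1ℝ * (∑ λ v → g v * p v) + - p j * N)
      ≈⟨ solve 4 (λ t s q N → t :* (con 1ℚ :* s :+ :- q :* N) := t :* s :+ (:- (t :* N)) :* q) ≃-refl θ (∑ λ v → g v * p v) (p j) N ⟩
    θ * (∑ λ v → g v * p v) + - (θ * N) * p j
      ≈⟨ +-cong ≃-refl (*-congˡ { - (θ * N)} (∑δ p)) ⟨
    θ * (∑ λ v → g v * p v) + - (θ * N) * (∑ λ v → δ v j * p v)
      ≈⟨ ∑-lin θ (λ v → g v * p v) (- (θ * N)) (λ v → δ v j * p v) ⟨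
    (∑ λ v → θ * (g v * p v) + - (θ * N) * (δ v j * p v))
      ≈⟨ ∑-cong (λ v → solve 5 (λ t g N d p → t :* (g :* p) :+ (:- (t :* N)) :* (d :* p) := (t :* (g :+ :- N :* d)) :* p) ≃-refl θ (g v) N (δ v j) (p v)) ⟩
    (∑ λ v → w v * p v) ∎
  0≤N : 0ℝ ≤ N
  0≤N = ∑-nonneg 0≤g
  ww : (∑ λ v → w v * w v) ≤ θ * θ * (N + N * N)
  ww = begin
    (∑ λ v → w v * w v)
      ≤⟨ ∑-mono (λ v → begin
          w v * w v
            ≈⟨ solve 4 (λ t g N d → (t :* (g :+ :- N :* d)) :* (t :* (g :+ :- N :* d)) :=
                 t :* t :* ((g :* g) :+ N :* N :* (d :* d)) :- (con (ι 2) :* t :* t) :* (N :* d :* g)) ≃-refl θ (g v) N (δ v j) ⟩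
          θ * θ * (g v * g v + N * N * (δ v j * δ v j)) + - (2ℝ * θ * θ * (N * δ v j * g v))
            ≤⟨ ≤+⇒-≤ (x≤x+y (0≤* (0≤* (0≤* 0≤2 0≤θ) 0≤θ) (0≤* (0≤* 0≤N (0≤𝟙 (does (v ≟ j)))) (0≤g v)))) ⟩
          θ * θ * (g v * g v + N * N * (δ v j * δ v j))
            ≈⟨ *-congˡ {θ * θ} (+-cong (gg v) (*-congˡ {N * N} (𝟙-idem (does (v ≟ j))))) ⟩
          θ * θ * (g v + N * N * δ v j)
            ≈⟨ solve 4 (λ t g N d → t :* t :* (g :+ N :* N :* d) := (t :* t) :* g :+ (t :* t :* N :* N) :* (d :* con 1ℚ)) ≃-refl θ (g v) N (δ v j) ⟩
          (θ * θ) * g v + (θ * θ * N * N) * (δ v j * 1ℝ) ∎) ⟩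
    (∑ λ v → (θ * θ) * g v + (θ * θ * N * N) * (δ v j * 1ℝ))
      ≈⟨ ≃-trans (∑-lin (θ * θ) g (θ * θ * N * N) (λ v → δ v j * 1ℝ))
          (+-cong ≃-refl (*-congˡ {θ * θ * N * N} (∑δ (λ _ → 1ℝ)))) ⟩
    (θ * θ) * N + (θ * θ * N * N) * 1ℝ
      ≈⟨ solve 2 (λ t N → (t :* t) :* N :+ (t :* t :* N :* N) :* con 1ℚ := t :* t :* (N :+ N :* N)) ≃-refl θ N ⟩
    θ * θ * (N + N * N) ∎

-- What the oracle says about one query

lookup-false⇒∉ : ∀ {n} {A : Subset n} {v} → lookup A v ≡ false → ¬ v ∈ A
lookup-false⇒∉ Av v∈A with trans (sym Av) (Vec.[]=⇒lookup v∈A)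
... | ()

indicator : ∀ {n} → Subset n → Fin n → ℝ
indicator A v = 𝟙 (lookup A v)

massOf-∑ : ∀ {n} (μ : Distribution n) A → massOf μ A ≃ ∑ λ v → indicator A v * mass μ v
massOf-∑ μ A = ∑-cong λ v → if-𝟙 (lookup A v) (mass μ v)

module _ {n} {μ : Distribution n} (O : Oracle μ) (A : Subset n) (ne : Subset.Nonempty A) where

  answer-support : ∀ v → indicator A v * mass (answer O (A , ne)) v ≃ mass (answer O (A , ne)) v
  answer-support v = go (lookup A v) refl
    where
    p = mass (answer O (A , ne)) v
    go : ∀ b → lookup A v ≡ b → 𝟙 b * p ≃ p
    go true  _  = *-identityˡ p
    go false Av = ≃-trans (*-zeroˡ p) (≃-sym (Oracle.outside O A ne (lookup-false⇒∉ Av)))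

  answer-ratio : 0ℝ < massOf μ A → ∀ v → lookup A v ≡ true →
                 mass (answer O (A , ne)) v * massOf μ A ≃ mass μ v
  answer-ratio m>0 v Av = begin-equality
    mass (answer O (A , ne)) v * m         ≈⟨ *-cong (Oracle.conditional O A ne m>0 (Vec.lookup⇒[]= v A Av)) ≃-refl ⟩
    (mass μ v * m ⁻¹⟨ m>0 ⟩) * m           ≈⟨ solve 3 (λ t i m → (t :* i) :* m := t :* (m :* i)) ≃-refl (mass μ v) (m ⁻¹⟨ m>0 ⟩) m ⟩
    mass μ v * (m * m ⁻¹⟨ m>0 ⟩)           ≈⟨ *-congˡ {mass μ v} (⁻¹-inverse m>0) ⟩
    mass μ v * 1ℝ                          ≈⟨ *-identityʳ (mass μ v) ⟩
    mass μ v                               ∎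
    where
    open ≤-Reasoning
    m = massOf μ A

collision : ∀ {n} {μ : Distribution n} → Oracle μ → Query n → ℝ
collision O Q = ∑ λ v → mass (answer O Q) v * mass (answer O Q) v

𝟙-case : ∀ b {x y : ℝ} → (b ≡ true → x ≤ y) → 𝟙 b * x ≤ 𝟙 b * y
𝟙-case true  h = *-monoʳ 0≤1 (h refl)
𝟙-case false {x} {y} _ = ≤-trans (proj₁ (*-zeroˡ x)) (proj₂ (*-zeroˡ y))

𝟙-∧ : ∀ b c → 𝟙 (b ∧ c) ≃ 𝟙 b * 𝟙 c
𝟙-∧ true  c = ≃-sym (*-identityˡ (𝟙 c))
𝟙-∧ false c = ≃-sym (*-zeroˡ (𝟙 c))

∧-true : ∀ {b c} → b ∧ c ≡ true → b ≡ true × c ≡ true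
∧-true {true} {true} _ = refl , refl

-- The tangent to 1/m at 1/y: p = t/m is at least t (2 y - y² m).
tangent : ∀ p t m y → p * m ≃ t → 0ℝ ≤ p → 2ℝ * y * t ≤ p + y * y * (t * m)
tangent p t m y pm 0≤p = begin
  2ℝ * y * t
    ≈⟨ *-congˡ {2ℝ * y} pm ⟨
  2ℝ * y * (p * m)
    ≤⟨ 0≤-⇒≤ (≤-trans (0≤* 0≤p (0≤x² (1ℝ + - (y * m)))) (proj₁ (solve 3 (λ p m y →
         p :* ((con 1ℚ :- y :* m) :* (con 1ℚ :- y :* m)) :=
         (p :+ y :* y :* ((p :* m) :* m)) :- con (ι 2) :* y :* (p :* m)) ≃-refl p m y))) ⟩
  p + y * y * ((p * m) * m)
    ≈⟨ +-cong ≃-refl (*-congˡ {y * y} (*-cong pm ≃-refl)) ⟩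
  p + y * y * (t * m) ∎
  where open ≤-Reasoning

-- A heavy set H of points and a light point j with a gap γ between them, in a
-- query whose set contains the set B, the point j, and nothing else.
module Query-bound {n} {μ : Distribution n} (O : Oracle μ) (A : Subset n) (ne : Subset.Nonempty A)
  (B H : Fin n → Bool) (j : Fin n) (c θ γ y : ℝ) {u : ℚ} (0<u : 0ℚ ℚ.< u)
  (0≤θ : 0ℝ ≤ θ) (0≤γ : 0ℝ ≤ γ)
  (c-size : c * ∑ (indicator A) ≃ 1ℝ)
  (j∈A : lookup A j ≡ true)
  (B⊆A : ∀ v → B v ≡ true → lookup A v ≡ true)
  (A⊆B+j : ∀ v → indicator A v ≤ δ v j + 𝟙 (B v))
  (heavy : ∀ v → H v ≡ true → fromℚ u ≤ mass μ v)
  (gap : ∀ v → H v ≡ true → mass μ j + γ * mass μ v ≤ mass μ v)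
  where

  private
    t p a b h g : Fin n → ℝ
    t = mass μ
    p = mass (answer O (A , ne))
    a = indicator A
    b v = 𝟙 (B v)
    h v = 𝟙 (H v)
    g v = h v * b v
    m M N : ℝ
    m = massOf μ A
    M = t j + ∑ λ v → t v * b v
    N = ∑ g

    0≤t : ∀ v → 0ℝ ≤ t v
    0≤t = Distribution.nonneg μ

    0≤p : ∀ v → 0ℝ ≤ p v
    0≤p = Distribution.nonneg (answer O (A , ne))

    0≤g : ∀ v → 0ℝ ≤ g v
    0≤g v = 0≤* (0≤𝟙 (H v)) (0≤𝟙 (B v))

    gg : ∀ v → g v * g v ≃ g v
    gg v = ≃-trans (solve 2 (λ h b → (h :* b) :* (h :* b) := (h :* h) :* (b :* b)) ≃-refl (h v) (b v))
      (*-cong (𝟙-idem (H v)) (𝟙-idem (B v)))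

    ag : ∀ v → a v * g v ≃ g v
    ag v = go (B v) refl
      where
      go : ∀ x → B v ≡ x → a v * (h v * 𝟙 x) ≃ h v * 𝟙 x
      go true  Bv = ≃-trans (*-cong {u = h v * 1ℝ} (a≃1 (B⊆A v Bv)) ≃-refl) (*-identityˡ (h v * 1ℝ))
        where
        a≃1 : lookup A v ≡ true → a v ≃ 1ℝ
        a≃1 e rewrite e = ≃-refl
      go false _  = solve 2 (λ a h → a :* (h :* con 0ℚ) := h :* con 0ℚ) ≃-refl (a v) (h v)

    g-case : ∀ v {x y : ℝ} → (H v ≡ true → B v ≡ true → x ≤ y) → g v * x ≤ g v * y
    g-case v {x} {y} k = ≤-trans (proj₂ (*-cong (𝟙-∧ (H v) (B v)) (≃-refl {x})))
      (≤-trans (𝟙-case (H v ∧ B v) (λ e → let (Hv , Bv) = ∧-true e in k Hv Bv))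
        (proj₁ (*-cong (𝟙-∧ (H v) (B v)) (≃-refl {y}))))

    a-true : ∀ {v} → lookup A v ≡ true → a v ≃ 1ℝ
    a-true e rewrite e = ≃-refl

    t≤m : ∀ v → lookup A v ≡ true → t v ≤ m
    t≤m v Av = begin
      t v                     ≈⟨ *-identityˡ (t v) ⟨
      1ℝ * t v                ≈⟨ *-cong (a-true Av) ≃-refl ⟨
      a v * t v               ≤⟨ ∑-term (λ w → 0≤* (0≤𝟙 (lookup A w)) (0≤t w)) v ⟩
      (∑ λ w → a w * t w)     ≈⟨ massOf-∑ μ A ⟨
      m                       ∎
      where open ≤-Reasoning

    m>0 : ∀ v → H v ≡ true → B v ≡ true → 0ℝ < m
    m>0 v Hv Bv = 0<fromℚ≤ 0<u (≤-trans (heavy v Hv) (t≤m v (B⊆A v Bv)))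

    m≤M : m ≤ M
    m≤M = begin
      m                                               ≈⟨ massOf-∑ μ A ⟩
      (∑ λ v → a v * t v)                             ≤⟨ ∑-mono (λ v → *-monoˡ (0≤t v) (A⊆B+j v)) ⟩
      (∑ λ v → (δ v j + b v) * t v)                   ≈⟨ ∑-cong (λ v → solve 3 (λ d b t → (d :+ b) :* t := d :* t :+ t :* b) ≃-refl (δ v j) (b v) (t v)) ⟩
      (∑ λ v → δ v j * t v + t v * b v)               ≈⟨ ∑-+ (λ v → δ v j * t v) (λ v → t v * b v) ⟩
      (∑ λ v → δ v j * t v) + (∑ λ v → t v * b v)     ≈⟨ +-cong (∑-δ j t) ≃-refl ⟩
      M                                               ∎
      where open ≤-Reasoning

    -- Both probabilities have the same denominator m, so the gap between the masses
    -- is inherited.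
    p-gap : ∀ v → g v * (γ * p v) ≤ g v * (p v + - p j)
    p-gap v = g-case v λ Hv Bv → *-cancelʳ-≤ (m>0 v Hv Bv) (begin
      γ * p v * m                  ≈⟨ *-assoc γ (p v) m ⟩
      γ * (p v * m)                ≈⟨ *-congˡ {γ} (answer-ratio O A ne (m>0 v Hv Bv) v (B⊆A v Bv)) ⟩
      γ * t v                      ≈⟨ solve 2 (λ x y → x := (y :+ x) :- y) ≃-refl (γ * t v) (t j) ⟩
      (t j + γ * t v) + - t j      ≤⟨ +-mono (gap v Hv) ≤-refl ⟩
      t v + - t j                  ≈⟨ +-cong (answer-ratio O A ne (m>0 v Hv Bv) v (B⊆A v Bv))
                                        (let (x , y) = answer-ratio O A ne (m>0 v Hv Bv) j j∈A in neg-anti y , neg-anti x) ⟨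
      p v * m + - (p j * m)        ≈⟨ solve 3 (λ p q m → p :* m :- q :* m := (p :- q) :* m) ≃-refl (p v) (p j) m ⟩
      (p v + - p j) * m            ∎)
      where open ≤-Reasoning

    -- The mass m of the set depends on the random set; M bounds it by an expression
    -- that is linear in the indicators of membership.
    p-lower : ∀ v → 2ℝ * y * (g v * t v) ≤ g v * p v + y * y * ((g v * t v) * M)
    p-lower v = begin
      2ℝ * y * (g v * t v)
        ≈⟨ solve 4 (λ c y g t → c :* y :* (g :* t) := g :* (c :* y :* t)) ≃-refl 2ℝ y (g v) (t v) ⟩
      g v * (2ℝ * y * t v)
        ≤⟨ g-case v (λ Hv Bv → ≤-trans
             (tangent (p v) (t v) m y (answer-ratio O A ne (m>0 v Hv Bv) v (B⊆A v Bv)) (0≤p v))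
             (+-monoʳ (*-monoʳ (0≤x² y) (*-monoʳ (0≤t v) m≤M)))) ⟩
      g v * (p v + y * y * (t v * M))
        ≈⟨ solve 5 (λ g p y t M → g :* (p :+ y :* y :* (t :* M)) := g :* p :+ y :* y :* ((g :* t) :* M)) ≃-refl (g v) (p v) y (t v) M ⟩
      g v * p v + y * y * ((g v * t v) * M) ∎
      where open ≤-Reasoning

  bound : c + 2ℝ * θ * γ * (2ℝ * y * ∑ λ v → g v * t v)
        ≤ collision O (A , ne) + θ * θ * (N + N * N) + 2ℝ * θ * γ * (y * y * ((∑ λ v → g v * t v) * M))
  bound = begin
    c + 2ℝ * θ * γ * (2ℝ * y * G)
      ≤⟨ +-monoʳ (*-monoʳ 0≤2θγ lower) ⟩
    c + 2ℝ * θ * γ * (S + y * y * (G * M))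
      ≈⟨ solve 4 (λ c k s r → c :+ k :* (s :+ r) := (c :+ k :* s) :+ k :* r) ≃-refl c (2ℝ * θ * γ) S (y * y * (G * M)) ⟩
    (c + 2ℝ * θ * γ * S) + 2ℝ * θ * γ * (y * y * (G * M))
      ≤⟨ +-mono (marked-bound p a g c θ γ j (λ v → 𝟙-idem (lookup A v)) (answer-support O A ne) ag
           (a-true j∈A) gg 0≤g (Distribution.total (answer O (A , ne))) c-size 0≤θ p-gap) ≤-refl ⟩
    collision O (A , ne) + θ * θ * (N + N * N) + 2ℝ * θ * γ * (y * y * (G * M)) ∎
    where
    open ≤-Reasoning
    G S : ℝ
    G = ∑ λ v → g v * t v
    S = ∑ λ v → g v * p v
    0≤2θγ : 0ℝ ≤ 2ℝ * θ * γ
    0≤2θγ = 0≤* (0≤* (fromℚ-mono (ℚ.nonNegative⁻¹ (ι 2))) 0≤θ) 0≤γ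
    lower : 2ℝ * y * G ≤ S + y * y * (G * M)
    lower = begin
      2ℝ * y * G                                                        ≈⟨ ∑-*ˡ (2ℝ * y) (λ v → g v * t v) ⟩
      (∑ λ v → 2ℝ * y * (g v * t v))                                    ≤⟨ ∑-mono p-lower ⟩
      (∑ λ v → g v * p v + y * y * ((g v * t v) * M))                   ≈⟨ ∑-+ (λ v → g v * p v) (λ v → y * y * ((g v * t v) * M)) ⟩
      S + (∑ λ v → y * y * ((g v * t v) * M))                           ≈⟨ +-cong ≃-refl (∑-*ˡ (y * y) (λ v → (g v * t v) * M)) ⟨
      S + y * y * (∑ λ v → (g v * t v) * M)                             ≈⟨ +-cong ≃-refl (*-congˡ {y * y} (∑-*ʳ M (λ v → g v * t v))) ⟨
      S + y * y * (G * M)                                               ∎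

-- Zero weights give the Cauchy-Schwarz bound.
collision-≥ : ∀ {n} {μ : Distribution n} (O : Oracle μ) A ne c →
              c * ∑ (indicator A) ≃ 1ℝ → c ≤ collision O (A , ne)
collision-≥ {n} O A ne c c-size = begin
  c                                     ≈⟨ ≃-trans (+-cong ≃-refl (*-congˡ {2ℝ} (∑-zero λ v → *-zeroˡ (p v)))) (solve 1 (λ c → c :+ con (ι 2) :* con 0ℚ := c) ≃-refl c) ⟨
  c + 2ℝ * (∑ λ v → 0ℝ * p v)           ≤⟨ square-bound p (indicator A) (λ _ → 0ℝ) c (λ v → 𝟙-idem (lookup A v))
                                             (answer-support O A ne) (λ v → *-zeroʳ (indicator A v))
                                             (Distribution.total (answer O (A , ne))) c-size (∑-zero {n} λ _ → ≃-refl) ⟩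
  collision O (A , ne) + ∑ {n} (λ _ → 0ℝ * 0ℝ)  ≈⟨ ≃-trans (+-cong ≃-refl (∑-zero {n} λ _ → *-zeroˡ 0ℝ)) (+-identityʳ _) ⟩
  collision O (A , ne) ∎
  where
  open ≤-Reasoning
  p = mass (answer O (A , ne))

-- Coordinates of a vector of independent samples

𝔼-lookup : ∀ {A} k (S : Sampler A) (φ : A → ℝ) i →
           𝔼 (law (independent k S)) (λ as → φ (lookup as i)) ≃ 𝔼 (law S) φ
𝔼-lookup (suc k) S φ zero = ≃-trans (independent-suc k S λ as → φ (lookup as zero))
  (Mean.same (law S) λ a → Mean.const (law (independent k S)) (φ a))
𝔼-lookup (suc k) S φ (suc i) = ≃-trans (independent-suc k S λ as → φ (lookup as (suc i)))
  (≃-trans (Mean.const (law S) _) (𝔼-lookup k S φ i))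

-- On the diagonal the product is φ by idempotence, and off the diagonal the
-- samples are independent.
𝔼-lookup₂ : ∀ {A} k (S : Sampler A) (φ : A → ℝ) r → (∀ a → φ a * φ a ≃ φ a) → 0ℝ ≤ r → 𝔼 (law S) φ ≃ r →
            ∀ i j → 𝔼 (law (independent k S)) (λ as → φ (lookup as i) * φ (lookup as j)) ≤ r * r + δ j i * r
𝔼-lookup₂ {A} k S φ r φφ 0≤r Eφ = go k
  where
  open ≤-Reasoning
  P : ∀ k → Fin k → Fin k → Vec A k → ℝ
  P k i j as = φ (lookup as i) * φ (lookup as j)
  off-diagonal : r * r ≃ r * r + 0ℝ * r
  off-diagonal = solve 1 (λ r → r :* r := r :* r :+ con 0ℚ :* r) ≃-refl r
  go : ∀ k i j → 𝔼 (law (independent k S)) (P k i j) ≤ r * r + δ j i * r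
  go (suc k) zero zero = begin
    𝔼 (law (independent (suc k) S)) (P (suc k) zero zero)
      ≈⟨ independent-suc k S (P (suc k) zero zero) ⟩
    𝔼 (law S) (λ a → 𝔼 (law (independent k S)) λ _ → φ a * φ a)
      ≈⟨ Mean.same (law S) (λ a → ≃-trans (Mean.const (law (independent k S)) (φ a * φ a)) (φφ a)) ⟩
    𝔼 (law S) φ
      ≈⟨ Eφ ⟩
    r
      ≈⟨ ≃-trans (+-identityˡ (1ℝ * r)) (*-identityˡ r) ⟨
    0ℝ + 1ℝ * r
      ≤⟨ +-mono (0≤* 0≤r 0≤r) ≤-refl ⟩
    r * r + 1ℝ * r ∎
  go (suc k) zero (suc j) = begin
    𝔼 (law (independent (suc k) S)) (P (suc k) zero (suc j))
      ≈⟨ independent-suc k S (P (suc k) zero (suc j)) ⟩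
    𝔼 (law S) (λ a → 𝔼 (law (independent k S)) λ as → φ a * φ (lookup as j))
      ≈⟨ Mean.same (law S) (λ a → ≃-trans (Mean.scale (law (independent k S)) (φ a) (λ as → φ (lookup as j)))
           (≃-trans (*-congˡ {φ a} (≃-trans (𝔼-lookup k S φ j) Eφ)) (*-comm (φ a) r))) ⟩
    𝔼 (law S) (λ a → r * φ a)
      ≈⟨ ≃-trans (Mean.scale (law S) r φ) (*-congˡ {r} Eφ) ⟩
    r * r
      ≈⟨ off-diagonal ⟩
    r * r + 0ℝ * r ∎
  go (suc k) (suc i) zero = begin
    𝔼 (law (independent (suc k) S)) (P (suc k) (suc i) zero)
      ≈⟨ independent-suc k S (P (suc k) (suc i) zero) ⟩
    𝔼 (law S) (λ a → 𝔼 (law (independent k S)) λ as → φ (lookup as i) * φ a)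
      ≈⟨ Mean.same (law S) (λ a → ≃-trans (Mean.same (law (independent k S)) (λ as → *-comm (φ (lookup as i)) (φ a)))
           (≃-trans (Mean.scale (law (independent k S)) (φ a) (λ as → φ (lookup as i)))
           (≃-trans (*-congˡ {φ a} (≃-trans (𝔼-lookup k S φ i) Eφ)) (*-comm (φ a) r)))) ⟩
    𝔼 (law S) (λ a → r * φ a)
      ≈⟨ ≃-trans (Mean.scale (law S) r φ) (*-congˡ {r} Eφ) ⟩
    r * r
      ≈⟨ off-diagonal ⟩
    r * r + 0ℝ * r ∎
  go (suc k) (suc i) (suc j) = begin
    𝔼 (law (independent (suc k) S)) (P (suc k) (suc i) (suc j))
      ≈⟨ independent-suc k S (P (suc k) (suc i) (suc j)) ⟩
    𝔼 (law S) (λ _ → 𝔼 (law (independent k S)) (P k i j))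
      ≈⟨ Mean.const (law S) (𝔼 (law (independent k S)) (P k i j)) ⟩
    𝔼 (law (independent k S)) (P k i j)
      ≤⟨ go k i j ⟩
    r * r + δ j i * r ∎

-- The expected gain over all random sets B of one density r

module Random-set {Ω : Set} (E : Mean Ω) {n} (B : Ω → Fin n → Bool) (r : ℝ) (0≤r : 0ℝ ≤ r)
  (first  : ∀ v → 𝔼 E (λ ω → 𝟙 (B ω v)) ≃ r)
  (second : ∀ v w → 𝔼 E (λ ω → 𝟙 (B ω v) * 𝟙 (B ω w)) ≤ r * r + δ w v * r)
  where

  private
    b : Fin n → Ω → ℝ
    b v ω = 𝟙 (B ω v)

    pull : ∀ (f : Fin n → ℝ) (X : Ω → ℝ) →
           𝔼 E (λ ω → (∑ λ v → f v * b v ω) * X ω) ≃ ∑ λ v → f v * 𝔼 E (λ ω → b v ω * X ω)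
    pull f X = begin-equality
      𝔼 E (λ ω → (∑ λ v → f v * b v ω) * X ω)
        ≈⟨ Mean.same E (λ ω → ≃-trans (∑-*ʳ (X ω) (λ v → f v * b v ω)) (∑-cong λ v → *-assoc (f v) (b v ω) (X ω))) ⟩
      𝔼 E (λ ω → ∑ λ v → f v * (b v ω * X ω))
        ≈⟨ Mean.sum E (λ v ω → f v * (b v ω * X ω)) ⟩
      (∑ λ v → 𝔼 E (λ ω → f v * (b v ω * X ω)))
        ≈⟨ ∑-cong (λ v → Mean.scale E (f v) (λ ω → b v ω * X ω)) ⟩
      (∑ λ v → f v * 𝔼 E (λ ω → b v ω * X ω)) ∎
      where open ≤-Reasoning

    linear : ∀ f → 𝔼 E (λ ω → ∑ λ v → f v * b v ω) ≃ r * ∑ f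
    linear f = begin-equality
      𝔼 E (λ ω → ∑ λ v → f v * b v ω)       ≈⟨ Mean.sum E (λ v ω → f v * b v ω) ⟩
      (∑ λ v → 𝔼 E (λ ω → f v * b v ω))     ≈⟨ ∑-cong (λ v → ≃-trans (Mean.scale E (f v) (b v)) (≃-trans (*-congˡ {f v} (first v)) (*-comm (f v) r))) ⟩
      (∑ λ v → r * f v)                     ≈⟨ ∑-*ˡ r f ⟨
      r * ∑ f                               ∎
      where open ≤-Reasoning

    correlated : ∀ v (f : Fin n → ℝ) → (∀ w → 0ℝ ≤ f w) →
                 𝔼 E (λ ω → b v ω * ∑ λ w → f w * b w ω) ≤ r * r * ∑ f + r * f v
    correlated v f 0≤f = begin
      𝔼 E (λ ω → b v ω * ∑ λ w → f w * b w ω)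
        ≈⟨ Mean.same E (λ ω → *-comm (b v ω) _) ⟩
      𝔼 E (λ ω → (∑ λ w → f w * b w ω) * b v ω)
        ≈⟨ pull f (b v) ⟩
      (∑ λ w → f w * 𝔼 E (λ ω → b w ω * b v ω))
        ≤⟨ ∑-mono (λ w → *-monoʳ (0≤f w) (≤-trans (proj₁ (Mean.same E λ ω → *-comm (b w ω) (b v ω))) (second v w))) ⟩
      (∑ λ w → f w * (r * r + δ w v * r))
        ≈⟨ ∑-cong (λ w → solve 3 (λ f r d → f :* (r :* r :+ d :* r) := r :* r :* f :+ r :* (d :* f)) ≃-refl (f w) r (δ w v)) ⟩
      (∑ λ w → r * r * f w + r * (δ w v * f w))
        ≈⟨ ∑-lin (r * r) f r (λ w → δ w v * f w) ⟩
      r * r * ∑ f + r * (∑ λ w → δ w v * f w)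
        ≈⟨ +-cong ≃-refl (*-congˡ {r} (∑-δ v f)) ⟩
      r * r * ∑ f + r * f v ∎
      where open ≤-Reasoning

  module _ (μ : Distribution n) (H : Fin n → Bool) (j : Fin n)
    (r≤t  : ∀ v → H v ≡ true → r ≤ mass μ v)
    (t≤4r : ∀ v → H v ≡ true → mass μ v ≤ fromℕ 4 * r)
    (j≤t  : ∀ v → H v ≡ true → mass μ j ≤ mass μ v)
    where

    private
      t h : Fin n → ℝ
      t = mass μ
      h v = 𝟙 (H v)
      0≤t : ∀ v → 0ℝ ≤ t v
      0≤t = Distribution.nonneg μ
      0≤h : ∀ v → 0ℝ ≤ h v
      0≤h v = 0≤𝟙 (H v)
      T ρ : ℝ
      T = ∑ λ v → h v * t v
      ρ = r * ∑ h
      N G M : Ω → ℝ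
      N ω = ∑ λ v → h v * b v ω
      G ω = ∑ λ v → (h v * b v ω) * t v
      M ω = t j + ∑ λ v → t v * b v ω

    -- T is the mass of H, and ρ is the expected number N of points of H in B.
    T≤1 : T ≤ 1ℝ
    T≤1 = ≤-trans (∑-mono λ v → h≤1 (H v) (0≤t v)) (proj₁ (Distribution.total μ))
      where
      h≤1 : ∀ b {x} → 0ℝ ≤ x → 𝟙 b * x ≤ x
      h≤1 true  {x} _   = proj₁ (*-identityˡ x)
      h≤1 false {x} 0≤x = ≤-trans (proj₁ (*-zeroˡ x)) 0≤x

    private
      0≤ρ : 0ℝ ≤ ρ
      0≤ρ = 0≤* 0≤r (∑-nonneg 0≤h)

      ρ≤T : ρ ≤ T
      ρ≤T = begin
        r * ∑ h             ≈⟨ ∑-*ˡ r h ⟩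
        (∑ λ v → r * h v)   ≤⟨ ∑-mono (λ v → ≤-trans (proj₁ (*-comm r (h v))) (𝟙-case (H v) (r≤t v))) ⟩
        T                   ∎
        where open ≤-Reasoning

      𝔼N² : 𝔼 E (λ ω → N ω * N ω) ≤ ρ * ρ + ρ
      𝔼N² = begin
        𝔼 E (λ ω → N ω * N ω)
          ≈⟨ pull h N ⟩
        (∑ λ v → h v * 𝔼 E (λ ω → b v ω * N ω))
          ≤⟨ ∑-mono (λ v → *-monoʳ (0≤h v) (correlated v h 0≤h)) ⟩
        (∑ λ v → h v * (r * r * ∑ h + r * h v))
          ≈⟨ ∑-cong (λ v → ≃-trans (solve 4 (λ h r s k → h :* (k :* s :+ r :* h) := (k :* s) :* h :+ r :* (h :* h)) ≃-refl (h v) r (∑ h) (r * r))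
               (+-cong ≃-refl (*-congˡ {r} (𝟙-idem (H v))))) ⟩
        (∑ λ v → (r * r * ∑ h) * h v + r * h v)
          ≈⟨ ∑-lin (r * r * ∑ h) h r h ⟩
        (r * r * ∑ h) * ∑ h + r * ∑ h
          ≈⟨ +-cong (solve 2 (λ r s → (r :* r :* s) :* s := (r :* s) :* (r :* s)) ≃-refl r (∑ h)) ≃-refl ⟩
        ρ * ρ + ρ ∎
        where open ≤-Reasoning

      𝔼NN : 𝔼 E (λ ω → N ω + N ω * N ω) ≤ fromℕ 3 * T
      𝔼NN = begin
        𝔼 E (λ ω → N ω + N ω * N ω)             ≈⟨ Mean.add E N (λ ω → N ω * N ω) ⟩
        𝔼 E N + 𝔼 E (λ ω → N ω * N ω)           ≤⟨ +-mono (proj₁ (linear h)) 𝔼N² ⟩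
        ρ + (ρ * ρ + ρ)                          ≤⟨ +-monoʳ (+-mono (*-monoʳ 0≤ρ (≤-trans ρ≤T T≤1)) ≤-refl) ⟩
        ρ + (ρ * 1ℝ + ρ)                         ≈⟨ solve 1 (λ x → x :+ (x :* con 1ℚ :+ x) := con (ι 3) :* x) ≃-refl ρ ⟩
        fromℕ 3 * ρ                              ≤⟨ *-monoʳ (fromℚ-mono (ℚ.nonNegative⁻¹ (ι 3))) ρ≤T ⟩
        fromℕ 3 * T                              ∎
        where open ≤-Reasoning

      regroup : ∀ ω → G ω ≃ ∑ λ v → (h v * t v) * b v ω
      regroup ω = ∑-cong λ v → solve 3 (λ h b t → (h :* b) :* t := (h :* t) :* b) ≃-refl (h v) (b v ω) (t v)

      𝔼G : 𝔼 E G ≃ r * T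
      𝔼G = ≃-trans (Mean.same E regroup) (linear (λ v → h v * t v))

      -- Nine is 4 + 1 + 4: the point j, the independently included points, and v.
      𝔼bM : ∀ v → H v ≡ true → 𝔼 E (λ ω → b v ω * M ω) ≤ fromℕ 9 * (r * r)
      𝔼bM v Hv = begin
        𝔼 E (λ ω → b v ω * M ω)
          ≈⟨ Mean.same E (λ ω → solve 3 (λ b t s → b :* (t :+ s) := t :* b :+ b :* s) ≃-refl (b v ω) (t j) (∑ λ w → t w * b w ω)) ⟩
        𝔼 E (λ ω → t j * b v ω + b v ω * ∑ λ w → t w * b w ω)
          ≈⟨ Mean.add E (λ ω → t j * b v ω) (λ ω → b v ω * ∑ λ w → t w * b w ω) ⟩
        𝔼 E (λ ω → t j * b v ω) + 𝔼 E (λ ω → b v ω * ∑ λ w → t w * b w ω)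
          ≤⟨ +-mono (proj₁ (≃-trans (Mean.scale E (t j) (b v)) (*-congˡ {t j} (first v)))) (correlated v t 0≤t) ⟩
        t j * r + (r * r * ∑ t + r * t v)
          ≤⟨ +-mono (*-monoˡ 0≤r (≤-trans (j≤t v Hv) (t≤4r v Hv)))
               (+-mono (proj₁ (*-congˡ {r * r} (Distribution.total μ))) (*-monoʳ 0≤r (t≤4r v Hv))) ⟩
        fromℕ 4 * r * r + (r * r * 1ℝ + r * (fromℕ 4 * r))
          ≈⟨ solve 1 (λ r → con (ι 4) :* r :* r :+ (r :* r :* con 1ℚ :+ r :* (con (ι 4) :* r)) := con (ι 9) :* (r :* r)) ≃-refl r ⟩
        fromℕ 9 * (r * r) ∎
        where open ≤-Reasoning

      𝔼GM : 𝔼 E (λ ω → G ω * M ω) ≤ fromℕ 9 * (r * r) * T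
      𝔼GM = begin
        𝔼 E (λ ω → G ω * M ω)
          ≈⟨ Mean.same E (λ ω → *-cong (regroup ω) (≃-refl {M ω})) ⟩
        𝔼 E (λ ω → (∑ λ v → (h v * t v) * b v ω) * M ω)
          ≈⟨ pull (λ v → h v * t v) M ⟩
        (∑ λ v → (h v * t v) * 𝔼 E (λ ω → b v ω * M ω))
          ≤⟨ ∑-mono (λ v → begin
              (h v * t v) * 𝔼 E (λ ω → b v ω * M ω)       ≈⟨ *-assoc (h v) (t v) _ ⟩
              h v * (t v * 𝔼 E (λ ω → b v ω * M ω))       ≤⟨ 𝟙-case (H v) (λ Hv → *-monoʳ (0≤t v) (𝔼bM v Hv)) ⟩
              h v * (t v * (fromℕ 9 * (r * r)))           ≈⟨ solve 3 (λ h t c → h :* (t :* c) := c :* (h :* t)) ≃-refl (h v) (t v) (fromℕ 9 * (r * r)) ⟩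
              fromℕ 9 * (r * r) * (h v * t v)             ∎) ⟩
        (∑ λ v → fromℕ 9 * (r * r) * (h v * t v))
          ≈⟨ ∑-*ˡ (fromℕ 9 * (r * r)) (λ v → h v * t v) ⟨
        fromℕ 9 * (r * r) * T ∎
        where open ≤-Reasoning

    -- With y = 1 / (9 r) the tangents give 4 / 243 and cost 2 / 243, and the weights
    -- θ = γ / 27 cost 1 / 243, all in units of γ² T.
    expected-gain : ∀ (c Q : Ω → ℝ) γ y → 0ℝ ≤ γ → y * r ≃ fromℚ (recip 9) →
      (∀ ω → c ω + 2ℝ * (fromℚ (recip 27) * γ) * γ * (2ℝ * y * G ω)
           ≤ Q ω + (fromℚ (recip 27) * γ) * (fromℚ (recip 27) * γ) * (N ω + N ω * N ω)
                 + 2ℝ * (fromℚ (recip 27) * γ) * γ * (y * y * (G ω * M ω))) →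
      𝔼 E c + fromℚ (recip 243) * (γ * γ) * T ≤ 𝔼 E Q
    expected-gain c Q γ y 0≤γ yr bound = begin
      𝔼 E c + fromℚ (recip 243) * (γ * γ) * T
        ≈⟨ solve 3 (λ c g T → c :+ con (recip 243) :* (g :* g) :* T :=
             (c :+ k₁ g :* (con (recip 9) :* T)) :- (k₂ g :* (con (ι 3) :* T) :+ k₃ g :* (con (ι 9) :* (con (recip 9) :* con (recip 9)) :* T)))
             ≃-refl (𝔼 E c) γ T ⟩
      (𝔼 E c + K₁ * (fromℚ (recip 9) * T)) + - (K₂ * (fromℕ 3 * T) + K₃ * (fromℕ 9 * (fromℚ (recip 9) * fromℚ (recip 9)) * T))
        ≤⟨ ≤+⇒-≤ (begin
          𝔼 E c + K₁ * (fromℚ (recip 9) * T)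
            ≈⟨ +-cong ≃-refl (*-congˡ {K₁} (*-cong yr ≃-refl)) ⟨
          𝔼 E c + K₁ * (y * r * T)
            ≈⟨ +-cong ≃-refl (solve 4 (λ g y r T → k₁ g :* (y :* r :* T) := (con (ι 2) :* (con (recip 27) :* g) :* g :* (con (ι 2) :* y)) :* (r :* T)) ≃-refl γ y r T) ⟩
          𝔼 E c + L * (r * T)
            ≈⟨ +-cong ≃-refl (*-congˡ {L} 𝔼G) ⟨
          𝔼 E c + L * 𝔼 E G
            ≈⟨ +-cong ≃-refl (Mean.scale E L G) ⟨
          𝔼 E c + 𝔼 E (λ ω → L * G ω)
            ≈⟨ Mean.add E c (λ ω → L * G ω) ⟨
          𝔼 E (λ ω → c ω + L * G ω)
            ≤⟨ Mean.mono E (λ ω → ≤-trans (proj₁ (+-cong ≃-refl (*-assoc (2ℝ * (fromℚ (recip 27) * γ) * γ) (2ℝ * y) (G ω)))) (bound ω)) ⟩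
          𝔼 E (λ ω → Q ω + θ² * (N ω + N ω * N ω) + 2ℝ * (fromℚ (recip 27) * γ) * γ * (y * y * (G ω * M ω)))
            ≈⟨ ≃-trans (Mean.add E (λ ω → Q ω + θ² * (N ω + N ω * N ω)) (λ ω → K₃ * (y * y * (G ω * M ω))))
                 (+-cong (≃-trans (Mean.add E Q (λ ω → θ² * (N ω + N ω * N ω))) (+-cong ≃-refl (Mean.scale E θ² (λ ω → N ω + N ω * N ω))))
                   (≃-trans (Mean.scale E K₃ (λ ω → y * y * (G ω * M ω))) (*-congˡ {K₃} (Mean.scale E (y * y) (λ ω → G ω * M ω))))) ⟩
          𝔼 E Q + θ² * 𝔼 E (λ ω → N ω + N ω * N ω) + K₃ * (y * y * 𝔼 E (λ ω → G ω * M ω))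
            ≤⟨ +-mono (+-monoʳ (*-monoʳ (0≤x² (fromℚ (recip 27) * γ)) 𝔼NN))
                 (*-monoʳ 0≤K₃ (*-monoʳ (0≤x² y) 𝔼GM)) ⟩
          𝔼 E Q + θ² * (fromℕ 3 * T) + K₃ * (y * y * (fromℕ 9 * (r * r) * T))
            ≈⟨ +-cong (+-cong ≃-refl (solve 2 (λ g T → (con (recip 27) :* g) :* (con (recip 27) :* g) :* (con (ι 3) :* T) := k₂ g :* (con (ι 3) :* T)) ≃-refl γ T))
                 (≃-trans (solve 4 (λ k y r T → k :* (y :* y :* (con (ι 9) :* (r :* r) :* T)) := k :* (con (ι 9) :* ((y :* r) :* (y :* r)) :* T)) ≃-refl K₃ y r T)
                   (*-congˡ {K₃} (*-cong (*-congˡ {fromℕ 9} (*-cong yr yr)) ≃-refl))) ⟩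
          𝔼 E Q + K₂ * (fromℕ 3 * T) + K₃ * (fromℕ 9 * (fromℚ (recip 9) * fromℚ (recip 9)) * T)
            ≈⟨ +-assoc (𝔼 E Q) _ _ ⟩
          𝔼 E Q + (K₂ * (fromℕ 3 * T) + K₃ * (fromℕ 9 * (fromℚ (recip 9) * fromℚ (recip 9)) * T)) ∎) ⟩
      𝔼 E Q ∎
      where
      open ≤-Reasoning
      -- K₁, K₂ and K₃ as functions of γ, in the syntax of ring expressions.
      k₁ k₂ k₃ : ∀ {m} → Polynomial m → Polynomial m
      k₁ g = con (ι 2) :* (con (recip 27) :* g) :* g :* con (ι 2)
      k₂ g = (con (recip 27) :* g) :* (con (recip 27) :* g)
      k₃ g = con (ι 2) :* (con (recip 27) :* g) :* g
      K₁ K₂ K₃ L θ² : ℝ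
      K₁ = 2ℝ * (fromℚ (recip 27) * γ) * γ * 2ℝ
      K₂ = (fromℚ (recip 27) * γ) * (fromℚ (recip 27) * γ)
      K₃ = 2ℝ * (fromℚ (recip 27) * γ) * γ
      L = 2ℝ * (fromℚ (recip 27) * γ) * γ * (2ℝ * y)
      θ² = K₂
      0≤K₃ : 0ℝ ≤ K₃
      0≤K₃ = 0≤* (0≤* (fromℚ-mono (ℚ.nonNegative⁻¹ (ι 2))) (0≤* (fromℚ-mono (ℚ.<⇒≤ (0<recip 27))) 0≤γ)) 0≤γ

-- One trial: a random set of random density, queried twice

2^-nonZero : ∀ K → ℕ.NonZero (2 ℕ.^ K)
2^-nonZero K = ℕ.m^n≢0 2 K

recip2^ : ℕ → ℚ
recip2^ K = recip (2 ℕ.^ K) {{2^-nonZero K}}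

-- A level, the inserted point, and one number below 2^K for every point.  A number
-- falls below 2^k with probability 2^k / 2^K, so the same coins serve all levels.
Coins : ℕ → ℕ → Set
Coins n K = Fin (suc K) × Fin n × Vec (Fin (2 ℕ.^ K)) n

coins : ∀ n .{{_ : ℕ.NonZero n}} K → Sampler (Coins n K)
coins n K = seed (suc K) ⊗ seed n ⊗ independent n (seed (2 ℕ.^ K) {{2^-nonZero K}})

below : ∀ {M} → ℕ → Fin M → Bool
below k d = toℕ d ℕ.<ᵇ 2 ℕ.^ k

setOf : ∀ {n K} → Coins n K → Subset n
setOf (k , j , ds) = Vec.map (below (toℕ k)) ds Vec.[ j ]≔ true

-- The inserted point makes the set nonempty, and its independence of the other
-- coins makes it light with the frequency of light points.
query : ∀ {n K} → Coins n K → Query n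
query ω@(k , j , ds) = setOf ω , j , Vec.[]≔-updates (Vec.map (below (toℕ k)) ds) j

reciprocalSize : ∀ {n} → Query n → ℚ
reciprocalSize (A , ne) = recip Subset.∣ A ∣ {{nonempty⇒∣∣-nonZero ne}}

∑-indicator : ∀ {n} (A : Subset n) → ∑ (indicator A) ≃ fromℕ Subset.∣ A ∣
∑-indicator []          = ≃-refl
∑-indicator (true ∷ A)  = ≃-trans (+-cong ≃-refl (∑-indicator A)) (≃-sym (fromℕ-suc Subset.∣ A ∣))
∑-indicator (false ∷ A) = ≃-trans (+-identityˡ (∑ (indicator A))) (∑-indicator A)

reciprocalSize-inverse : ∀ {n} (Q : Query n) → fromℚ (reciprocalSize Q) * ∑ (indicator (proj₁ Q)) ≃ 1ℝ
reciprocalSize-inverse (A , ne) = ≃-trans (*-congˡ {fromℚ (reciprocalSize (A , ne))} (∑-indicator A))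
  (recip-real Subset.∣ A ∣ {{nonempty⇒∣∣-nonZero ne}})

-- Under the uniform distribution the answer is uniform on the queried set, so a
-- collision has exactly the reciprocal of its size as probability.
uniform-collision : ∀ {n} {μ : Distribution n} (O : Oracle μ) → IsUniform n μ → ∀ Q →
                    collision O Q ≃ fromℚ (reciprocalSize Q)
uniform-collision {n} {μ} O unif (A , ne@(j , j∈A)) = begin-equality
  (∑ λ v → p v * p v)   ≈⟨ ∑-cong square ⟩
  (∑ λ v → c * p v)     ≈⟨ ∑-*ˡ c p ⟨
  c * ∑ p               ≈⟨ *-congˡ {c} (Distribution.total (answer O (A , ne))) ⟩
  c * 1ℝ                ≈⟨ *-identityʳ c ⟩
  c                     ∎
  where
  open ≤-Reasoning
  instance
    n≢0 : ℕ.NonZero n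
    n≢0 = Fin.nonZeroIndex j
  p a : Fin n → ℝ
  p = mass (answer O (A , ne))
  a = indicator A
  c m u S : ℝ
  c = fromℚ (reciprocalSize (A , ne))
  m = massOf μ A
  u = fromℚ (recip n)
  S = ∑ a
  Aj : lookup A j ≡ true
  Aj = Vec.[]=⇒lookup j∈A
  m≃uS : m ≃ u * S
  m≃uS = ≃-trans (massOf-∑ μ A)
    (≃-trans (∑-cong λ v → ≃-trans (*-congˡ {a v} (unif v)) (*-comm (a v) u)) (≃-sym (∑-*ˡ u a)))
  m>0 : 0ℝ < m
  m>0 = 0<fromℚ≤ (0<recip n) (begin
    u                        ≈⟨ *-identityʳ u ⟨
    u * 1ℝ                   ≡⟨ cong (λ b → u * 𝟙 b) (sym Aj) ⟩
    u * a j                  ≤⟨ *-monoʳ (fromℚ-mono (ℚ.<⇒≤ (0<recip n))) (∑-term (λ v → 0≤𝟙 (lookup A v)) j) ⟩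
    u * S                    ≈⟨ m≃uS ⟨
    m                        ∎)
  p≃c : ∀ v → lookup A v ≡ true → p v ≃ c
  p≃c v Av = begin-equality
    p v                                  ≈⟨ *-identityʳ (p v) ⟨
    p v * 1ℝ                             ≈⟨ *-congˡ {p v} (reciprocalSize-inverse (A , ne)) ⟨
    p v * (c * S)                        ≈⟨ solve 3 (λ p c S → p :* (c :* S) := (c :* con 1ℚ) :* (p :* S)) ≃-refl (p v) c S ⟩
    (c * 1ℝ) * (p v * S)                 ≈⟨ *-cong (*-congˡ {c} (recip-real n)) ≃-refl ⟨
    (c * (u * fromℕ n)) * (p v * S)      ≈⟨ solve 5 (λ c u n p S → (c :* (u :* n)) :* (p :* S) := (c :* n) :* (p :* (u :* S))) ≃-refl c u (fromℕ n) (p v) S ⟩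
    (c * fromℕ n) * (p v * (u * S))      ≈⟨ *-congˡ {c * fromℕ n} (*-congˡ {p v} m≃uS) ⟨
    (c * fromℕ n) * (p v * m)            ≈⟨ *-congˡ {c * fromℕ n} (≃-trans (answer-ratio O A ne m>0 v Av) (unif v)) ⟩
    (c * fromℕ n) * u                    ≈⟨ solve 3 (λ c n u → (c :* n) :* u := c :* (u :* n)) ≃-refl c (fromℕ n) u ⟩
    c * (u * fromℕ n)                    ≈⟨ *-congˡ {c} (recip-real n) ⟩
    c * 1ℝ                               ≈⟨ *-identityʳ c ⟩
    c                                    ∎
  square : ∀ v → p v * p v ≃ c * p v
  square v = go (lookup A v) refl
    where
    go : ∀ b → lookup A v ≡ b → p v * p v ≃ c * p v
    go true  Av = *-cong (p≃c v Av) ≃-refl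
    go false Av = ≃-trans (*-congˡ {p v} p≃0) (≃-trans (*-zeroʳ (p v)) (≃-trans (≃-sym (*-zeroʳ c)) (*-congˡ {c} (≃-sym p≃0))))
      where
      p≃0 : p v ≃ 0ℝ
      p≃0 = Oracle.outside O A ne (lookup-false⇒∉ Av)

-- Densities

𝔼-below : ∀ m c → c ℕ.≤ m → (∑ {m} λ d → 𝟙 (toℕ d ℕ.<ᵇ c)) ≃ fromℕ c
𝔼-below m       zero    _         = ∑-zero {m} λ _ → ≃-refl
𝔼-below (suc m) (suc c) (ℕ.s≤s h) = ≃-trans (+-cong ≃-refl (𝔼-below m c h)) (≃-sym (fromℕ-suc c))

density : ℕ → ℕ → ℚ
density K k = recip2^ K ℚ.* ι (2 ℕ.^ k)

law-seed : ∀ m .{{_ : ℕ.NonZero m}} f → 𝔼 (law (seed m)) f ≃ fromℚ (recip m) * ∑ f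
law-seed (suc m) f = ≃-refl

𝔼-density : ∀ K k → k ℕ.≤ K → 𝔼 (law (seed (2 ℕ.^ K) {{2^-nonZero K}})) (λ d → 𝟙 (below k d)) ≃ fromℚ (density K k)
𝔼-density K k k≤K = ≃-trans (law-seed (2 ℕ.^ K) {{2^-nonZero K}} (λ d → 𝟙 (below k d)))
  (≃-trans (*-congˡ {fromℚ (recip2^ K)} (𝔼-below (2 ℕ.^ K) (2 ℕ.^ k) (ℕ.^-monoʳ-≤ 2 k≤K)))
    (≃-sym (fromℚ-* (recip2^ K) (ι (2 ℕ.^ k)))))

0<density : ∀ K k → 0ℚ ℚ.< density K k
0<density K k = ℚL.*-pos (0<recip (2 ℕ.^ K) {{2^-nonZero K}}) (ℚ.<-≤-trans (0<ι-suc 0) (ι-mono (ℕ.m^n>0 2 k)))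

density-suc : ∀ K k → density K (suc k) ≡ ι 2 ℚ.* density K k
density-suc K k = trans (cong (recip2^ K ℚ.*_) (ι-* 2 (2 ℕ.^ k)))
  (solveℚ 2 (λ r s → r :*ℚ (conℚ (ι 2) :*ℚ s) :=ℚ conℚ (ι 2) :*ℚ (r :*ℚ s)) refl (recip2^ K) (ι (2 ℕ.^ k)))
  where open +-*-Solver using () renaming (solve to solveℚ; _:=_ to _:=ℚ_; _:*_ to _:*ℚ_; con to conℚ)

density-full : ∀ K → density K K ≡ 1ℚ
density-full K = trans (ℚ.*-comm (recip2^ K) (ι (2 ℕ.^ K))) (recip-inverse (2 ℕ.^ K) {{2^-nonZero K}})

-- Lowering k from K, each step either stops or halves the upper bound on x.
density-near : ∀ K x → fromℚ (density K 0) ≤ x → x ≤ 1ℝ →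
  ∃ λ (k : Fin (suc K)) → fromℚ (density K (toℕ k)) ≤ x × x ≤ fromℚ (ι 4 ℚ.* density K (toℕ k))
density-near K x x≥ x≤1 = toFin (search K ℕ.≤-refl (≤-trans x≤1 (fromℚ-mono (begin
    1ℚ                       ≡⟨ sym (density-full K) ⟩
    density K K              ≤⟨ enlarge (0<density K K) 3 ⟩
    ι 4 ℚ.* density K K      ∎))))
  where
  open ℚ.≤-Reasoning
  open +-*-Solver using () renaming (solve to solveℚ; _:=_ to _:=ℚ_; _:*_ to _:*ℚ_; con to conℚ)
  Near : ℕ → Set
  Near k = fromℚ (density K k) ≤ x × x ≤ fromℚ (ι 4 ℚ.* density K k)
  enlarge : ∀ {a} → 0ℚ ℚ.< a → ∀ m → a ℚ.≤ ι (suc m) ℚ.* a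
  enlarge {a} 0<a m = subst (ℚ._≤ ι (suc m) ℚ.* a) (ℚ.*-identityˡ a)
    (ℚ.*-monoʳ-≤-nonNeg a {{ℚ.nonNegative (ℚ.<⇒≤ 0<a)}} (ι-mono {1} {suc m} (ℕ.s≤s ℕ.z≤n)))
  double : ∀ {a} → 0ℚ ℚ.< a → a ℚ.< ι 2 ℚ.* a
  double {a} 0<a = subst (ℚ._< ι 2 ℚ.* a) (ℚ.*-identityˡ a)
    (ℚ.*-monoˡ-<-pos a {{ℚ.positive 0<a}} {1ℚ} {ι 2} (ℚ.*<* (+<+ (ℕ.s≤s (ℕ.s≤s ℕ.z≤n)))))
  search : ∀ k → k ℕ.≤ K → x ≤ fromℚ (ι 4 ℚ.* density K k) → ∃ λ k → k ℕ.≤ K × Near k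
  step : ∀ k → suc k ℕ.≤ K → x ≤ fromℚ (ι 4 ℚ.* density K (suc k)) →
         fromℚ (density K (suc k)) ≤ x ⊎ x ≤ fromℚ (ι 2 ℚ.* density K (suc k)) →
         ∃ λ k → k ℕ.≤ K × Near k
  search zero    k≤K h = zero , k≤K , x≥ , h
  search (suc k) k≤K h = step k k≤K h (compare x (double (0<density K (suc k))))
  step k k≤K h (inj₁ g) = suc k , k≤K , g , h
  step k k≤K h (inj₂ g) = search k (ℕ.≤-trans (ℕ.n≤1+n k) k≤K) (subst (λ z → x ≤ fromℚ z)
    (trans (cong (ι 2 ℚ.*_) (density-suc K k))
      (solveℚ 1 (λ d → conℚ (ι 2) :*ℚ (conℚ (ι 2) :*ℚ d) :=ℚ conℚ (ι 4) :*ℚ d) refl (density K k))) g)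
  toFin : (∃ λ k → k ℕ.≤ K × Near k) → ∃ λ (k : Fin (suc K)) → Near (toℕ k)
  toFin (k , k≤K , near) = fromℕ< (ℕ.s≤s k≤K) , subst Near (sym (Fin.toℕ-fromℕ< (ℕ.s≤s k≤K))) near

-- Membership after an insertion

lookup-insert : ∀ {n} (xs : Vec Bool n) j v → lookup (xs Vec.[ j ]≔ true) v ≡ does (v ≟ j) ∨ lookup xs v
lookup-insert (x ∷ xs) zero    zero    = refl
lookup-insert (x ∷ xs) zero    (suc v) = refl
lookup-insert (x ∷ xs) (suc j) zero    = refl
lookup-insert (x ∷ xs) (suc j) (suc v) = lookup-insert xs j v

∨-introʳ : ∀ b {c} → c ≡ true → b ∨ c ≡ true
∨-introʳ true  _ = refl
∨-introʳ false h = h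

𝟙-∨ : ∀ b c → 𝟙 (b ∨ c) ≤ 𝟙 b + 𝟙 c
𝟙-∨ true  c = x≤x+y (0≤𝟙 c)
𝟙-∨ false c = proj₂ (+-identityˡ (𝟙 c))

-- Heavy and light points of a distribution that is far from uniform

left? : ∀ {A B : Set} → A ⊎ B → Bool
left? (inj₁ _) = true
left? (inj₂ _) = false

∣-∣-least : ∀ {x y z} → x + - y ≤ z → y + - x ≤ z → ∣ x - y ∣ ≤ z
∣-∣-least {x} {y} {z} h₁ h₂ = ∣∣-least (≤-trans (proj₁ (-≃+- x y)) h₁)
  (≤-trans (proj₁ (≃-trans (let (p , q) = -≃+- x y in neg-anti q , neg-anti p)
    (solve 2 (λ x y → :- (x :- y) := y :- x) ≃-refl x y))) h₂)

module Far-from-uniform {n} .{{n≢0 : ℕ.NonZero n}}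
  (μ : Distribution n) (e : ℚ) (0<e : 0ℚ ℚ.< e)
  (far : fromℚ e ≤ fromℚ ½ * ∑ λ i → ∣ mass μ i - fromℚ (recip n) ∣) where

  γ u : ℚ
  γ = recip 4 ℚ.* e
  u = recip n

  private
    t : Fin n → ℝ
    t = mass μ
    0≤t : ∀ v → 0ℝ ≤ t v
    0≤t = Distribution.nonneg μ

    0<γ : 0ℚ ℚ.< γ
    0<γ = ℚL.*-pos (0<recip 4) 0<e
    0<u : 0ℚ ℚ.< u
    0<u = 0<recip n
    0<γu : 0ℚ ℚ.< γ ℚ.* u
    0<γu = ℚL.*-pos 0<γ 0<u
    0≤U : 0ℝ ≤ fromℚ u
    0≤U = fromℚ-mono (ℚ.<⇒≤ 0<u)
    0≤ΓU : 0ℝ ≤ fromℚ (γ ℚ.* u)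
    0≤ΓU = fromℚ-mono (ℚ.<⇒≤ 0<γu)

    a<a+b : ∀ {a b} → 0ℚ ℚ.< b → a ℚ.< a ℚ.+ b
    a<a+b {a} {b} 0<b = subst (ℚ._< a ℚ.+ b) (ℚ.+-identityʳ a) (ℚ.+-monoʳ-< a 0<b)

    -- A light point has mass at most hi, and any other point at least lo.
    lo hi : ℚ
    lo = u ℚ.+ ℚ.- (γ ℚ.* u ℚ.+ γ ℚ.* u)
    hi = lo ℚ.+ γ ℚ.* u

    lo-real : fromℚ lo ≃ fromℚ u + - (fromℚ (γ ℚ.* u) + fromℚ (γ ℚ.* u))
    lo-real = ≃-trans (fromℚ-+ u (ℚ.- (γ ℚ.* u ℚ.+ γ ℚ.* u))) (+-cong ≃-refl (≃-trans (fromℚ-neg _)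
      (let (p , q) = fromℚ-+ (γ ℚ.* u) (γ ℚ.* u) in neg-anti q , neg-anti p)))

    hi-real : fromℚ hi ≃ fromℚ u + - fromℚ (γ ℚ.* u)
    hi-real = ≃-trans (fromℚ-+ lo (γ ℚ.* u)) (≃-trans (+-cong lo-real ≃-refl)
      (solve 2 (λ u g → (u :- (g :+ g)) :+ g := u :- g) ≃-refl (fromℚ u) (fromℚ (γ ℚ.* u))))

  heaviness : ∀ i → fromℚ u ≤ t i ⊎ t i ≤ fromℚ (u ℚ.+ γ ℚ.* u)
  heaviness i = compare (t i) (a<a+b 0<γu)

  lightness : ∀ i → fromℚ lo ≤ t i ⊎ t i ≤ fromℚ hi
  lightness i = compare (t i) (a<a+b 0<γu)

  heavy light : Fin n → Bool
  heavy i = left? (heaviness i)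
  light i = not (left? (lightness i))

  heavy⇒ : ∀ i → heavy i ≡ true → fromℚ u ≤ t i
  heavy⇒ i = go (heaviness i)
    where
    go : (c : fromℚ u ≤ t i ⊎ t i ≤ fromℚ (u ℚ.+ γ ℚ.* u)) → left? c ≡ true → fromℚ u ≤ t i
    go (inj₁ h) _ = h

  light⇒ : ∀ j → light j ≡ true → t j ≤ fromℚ hi
  light⇒ j = go (lightness j)
    where
    go : (c : fromℚ lo ≤ t j ⊎ t j ≤ fromℚ hi) → not (left? c) ≡ true → t j ≤ fromℚ hi
    go (inj₂ h) _ = h

  light≤heavy : ∀ j v → light j ≡ true → heavy v ≡ true → t j ≤ t v
  light≤heavy j v lj hv = begin
    t j                                 ≤⟨ light⇒ j lj ⟩
    fromℚ hi                            ≈⟨ hi-real ⟩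
    fromℚ u + - fromℚ (γ ℚ.* u)         ≤⟨ ≤+⇒-≤ (x≤x+y 0≤ΓU) ⟩
    fromℚ u                             ≤⟨ heavy⇒ v hv ⟩
    t v                                 ∎
    where open ≤-Reasoning

  -- The light mass is at most (1 - γ) u, and u is at most the heavy mass.
  light-heavy-gap : fromℚ γ ≤ 1ℝ → ∀ j v → light j ≡ true → heavy v ≡ true → t j + fromℚ γ * t v ≤ t v
  light-heavy-gap γ≤1 j v lj hv = begin
    t j + Γ * t v                       ≤⟨ +-mono (≤-trans (light⇒ j lj) (proj₁ hi-real)) ≤-refl ⟩
    (U + - fromℚ (γ ℚ.* u)) + Γ * t v   ≈⟨ +-cong (+-cong ≃-refl (let (p , q) = fromℚ-* γ u in neg-anti q , neg-anti p)) ≃-refl ⟩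
    (U + - (Γ * U)) + Γ * t v           ≈⟨ solve 3 (λ u g t → (u :- g :* u) :+ g :* t := (con 1ℚ :- g) :* u :+ g :* t) ≃-refl U Γ (t v) ⟩
    (1ℝ + - Γ) * U + Γ * t v            ≤⟨ +-mono (*-monoʳ (≤⇒0≤- γ≤1) (heavy⇒ v hv)) ≤-refl ⟩
    (1ℝ + - Γ) * t v + Γ * t v          ≈⟨ solve 2 (λ g t → (con 1ℚ :- g) :* t :+ g :* t := t) ≃-refl Γ (t v) ⟩
    t v                                 ∎
    where
    open ≤-Reasoning
    Γ U : ℝ
    Γ = fromℚ γ
    U = fromℚ u

  private
    S : ℝ
    S = ∑ λ i → ∣ t i - fromℚ u ∣

    2e≤S : 2ℝ * fromℚ e ≤ S
    2e≤S = ≤-trans (*-monoʳ (fromℚ-mono (ℚ.nonNegative⁻¹ (ι 2))) far)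
      (proj₁ (solve 1 (λ s → con (ι 2) :* (con ½ :* s) := s) ≃-refl S))

    nu≃1 : fromℕ n * fromℚ u ≃ 1ℝ
    nu≃1 = ≃-trans (*-comm (fromℕ n) (fromℚ u)) (recip-real n)

    nγu≃γ : fromℕ n * fromℚ (γ ℚ.* u) ≃ fromℚ γ
    nγu≃γ = ≃-trans (*-congˡ {fromℕ n} (fromℚ-* γ u))
      (≃-trans (solve 3 (λ n g u → n :* (g :* u) := g :* (n :* u)) ≃-refl (fromℕ n) (fromℚ γ) (fromℚ u))
      (≃-trans (*-congˡ {fromℚ γ} nu≃1) (*-identityʳ (fromℚ γ))))

    Γ≃e/4 : fromℚ γ ≃ fromℚ (recip 4) * fromℚ e
    Γ≃e/4 = fromℚ-* (recip 4) e

    -- |z| is twice the positive part of z minus z.  For z = t i - u the positive part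
    -- is at most t i, and at most γ u unless i is heavy; the z cancel in the sum.
    heavy-term : ∀ i → ∣ t i - fromℚ u ∣ ≤ 2ℝ * (𝟙 (heavy i) * t i) + (2ℝ * fromℚ (γ ℚ.* u) + (fromℚ u + - t i))
    heavy-term i = go (heaviness i)
      where
      U W : ℝ
      U = fromℚ u
      W = fromℚ (γ ℚ.* u)
      go : (c : U ≤ t i ⊎ t i ≤ fromℚ (u ℚ.+ γ ℚ.* u)) →
           ∣ t i - U ∣ ≤ 2ℝ * (𝟙 (left? c) * t i) + (2ℝ * W + (U + - t i))
      go (inj₁ _) = ∣-∣-least
        (0≤-⇒≤ (≤-trans (+-nonneg (+-nonneg 0≤U 0≤U) (+-nonneg 0≤ΓU 0≤ΓU)) (proj₁ (solve 3 (λ t u w →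
          (u :+ u) :+ (w :+ w) := (con (ι 2) :* (con 1ℚ :* t) :+ (con (ι 2) :* w :+ (u :- t))) :- (t :- u)) ≃-refl (t i) U W))))
        (0≤-⇒≤ (≤-trans (+-nonneg (+-nonneg (0≤t i) (0≤t i)) (+-nonneg 0≤ΓU 0≤ΓU)) (proj₁ (solve 3 (λ t u w →
          (t :+ t) :+ (w :+ w) := (con (ι 2) :* (con 1ℚ :* t) :+ (con (ι 2) :* w :+ (u :- t))) :- (u :- t)) ≃-refl (t i) U W))))
      go (inj₂ h) = ∣-∣-least
        (0≤-⇒≤ (≤-trans (+-nonneg d d) (proj₁ (solve 3 (λ t u w →
          ((u :+ w) :- t) :+ ((u :+ w) :- t) := (con (ι 2) :* (con 0ℚ :* t) :+ (con (ι 2) :* w :+ (u :- t))) :- (t :- u)) ≃-refl (t i) U W))))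
        (0≤-⇒≤ (≤-trans (+-nonneg 0≤ΓU 0≤ΓU) (proj₁ (solve 3 (λ t u w →
          w :+ w := (con (ι 2) :* (con 0ℚ :* t) :+ (con (ι 2) :* w :+ (u :- t))) :- (u :- t)) ≃-refl (t i) U W))))
        where
        d : 0ℝ ≤ (U + W) + - t i
        d = ≤⇒0≤- (≤-trans h (proj₁ (fromℚ-+ u (γ ℚ.* u))))

    -- Likewise |z| is twice the negative part of z plus z, and for z = t i - u the
    -- negative part is at most u, and at most 2 γ u unless i is light.
    light-term : ∀ i → ∣ t i - fromℚ u ∣ ≤ 2ℝ * (𝟙 (light i) * fromℚ u) + (fromℕ 4 * fromℚ (γ ℚ.* u) + (t i + - fromℚ u))
    light-term i = go (lightness i)
      where
      U W : ℝ
      U = fromℚ u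
      W = fromℚ (γ ℚ.* u)
      0≤4W : 0ℝ ≤ fromℕ 4 * W
      0≤4W = 0≤* (fromℚ-mono (ℚ.nonNegative⁻¹ (ι 4))) 0≤ΓU
      go : (c : fromℚ lo ≤ t i ⊎ t i ≤ fromℚ hi) →
           ∣ t i - U ∣ ≤ 2ℝ * (𝟙 (not (left? c)) * U) + (fromℕ 4 * W + (t i + - U))
      go (inj₂ _) = ∣-∣-least
        (0≤-⇒≤ (≤-trans (+-nonneg (+-nonneg 0≤U 0≤U) 0≤4W) (proj₁ (solve 3 (λ t u w →
          (u :+ u) :+ con (ι 4) :* w := (con (ι 2) :* (con 1ℚ :* u) :+ (con (ι 4) :* w :+ (t :- u))) :- (t :- u)) ≃-refl (t i) U W))))
        (0≤-⇒≤ (≤-trans (+-nonneg (+-nonneg (0≤t i) (0≤t i)) 0≤4W) (proj₁ (solve 3 (λ t u w →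
          (t :+ t) :+ con (ι 4) :* w := (con (ι 2) :* (con 1ℚ :* u) :+ (con (ι 4) :* w :+ (t :- u))) :- (u :- t)) ≃-refl (t i) U W))))
      go (inj₁ h) = ∣-∣-least
        (0≤-⇒≤ (≤-trans 0≤4W (proj₁ (solve 3 (λ t u w →
          con (ι 4) :* w := (con (ι 2) :* (con 0ℚ :* u) :+ (con (ι 4) :* w :+ (t :- u))) :- (t :- u)) ≃-refl (t i) U W))))
        (0≤-⇒≤ (≤-trans (+-nonneg d d) (proj₁ (solve 3 (λ t u w →
          (t :- (u :- (w :+ w))) :+ (t :- (u :- (w :+ w))) := (con (ι 2) :* (con 0ℚ :* u) :+ (con (ι 4) :* w :+ (t :- u))) :- (u :- t)) ≃-refl (t i) U W))))
        where
        d : 0ℝ ≤ t i + - (U + - (W + W))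
        d = ≤⇒0≤- (≤-trans (proj₂ lo-real) h)

    ½e≤e-γ : fromℚ ½ * fromℚ e ≤ fromℚ e + - fromℚ γ
    ½e≤e-γ = 0≤-⇒≤ (≤-trans (0≤* (fromℚ-mono (ℚ.<⇒≤ (0<recip 4))) (fromℚ-mono (ℚ.<⇒≤ 0<e)))
      (≤-trans (proj₁ (solve 1 (λ e → con (recip 4) :* e := (e :- con (recip 4) :* e) :- con ½ :* e) ≃-refl (fromℚ e)))
        (proj₂ (+-cong (+-cong (≃-refl {fromℚ e}) (let (p , q) = Γ≃e/4 in neg-anti q , neg-anti p)) ≃-refl))))

    halve : ∀ {x y} → 2ℝ * x ≤ 2ℝ * y → x ≤ y
    halve {x} {y} h = ≤-trans (proj₁ (solve 1 (λ x → x := con ½ :* (con (ι 2) :* x)) ≃-refl x))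
      (≤-trans (*-monoʳ (fromℚ-mono (ℚ.nonNegative⁻¹ ½)) h) (proj₁ (solve 1 (λ x → con ½ :* (con (ι 2) :* x) := x) ≃-refl y)))

    ∑-terms : ∀ (x y : Fin n → ℝ) k → (∑ λ i → 2ℝ * x i + (k + y i)) ≃ 2ℝ * ∑ x + (fromℕ n * k + ∑ y)
    ∑-terms x y k = ≃-trans (∑-+ (λ i → 2ℝ * x i) (λ i → k + y i))
      (+-cong (≃-sym (∑-*ˡ 2ℝ x)) (≃-trans (∑-+ (λ _ → k) y) (+-cong (∑-const n k) ≃-refl)))

    ∑-diff : ∀ (x y : Fin n → ℝ) → ∑ x ≃ 1ℝ → ∑ y ≃ 1ℝ → (∑ λ i → x i + - y i) ≃ 0ℝ
    ∑-diff x y ∑x ∑y = begin-equality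
      (∑ λ i → x i + - y i)              ≈⟨ ∑-cong (λ i → solve 2 (λ x y → x :- y := con 1ℚ :* x :+ :- con 1ℚ :* y) ≃-refl (x i) (y i)) ⟩
      (∑ λ i → 1ℝ * x i + - 1ℝ * y i)    ≈⟨ ∑-lin 1ℝ x (- 1ℝ) y ⟩
      1ℝ * ∑ x + - 1ℝ * ∑ y              ≈⟨ +-cong (*-congˡ {1ℝ} ∑x) (*-congˡ { - 1ℝ} ∑y) ⟩
      1ℝ * 1ℝ + - 1ℝ * 1ℝ                ≈⟨ solve 0 (con 1ℚ :* con 1ℚ :+ :- con 1ℚ :* con 1ℚ := con 0ℚ) ≃-refl ⟩
      0ℝ                                 ∎
      where open ≤-Reasoning

    ∑u≃1 : ∑ {n} (λ _ → fromℚ u) ≃ 1ℝ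
    ∑u≃1 = ≃-trans (∑-const n (fromℚ u)) nu≃1

  heavy-mass : fromℚ ½ * fromℚ e ≤ ∑ λ i → 𝟙 (heavy i) * t i
  heavy-mass = ≤-trans ½e≤e-γ (≤+⇒-≤ (halve (begin
    2ℝ * fromℚ e                                   ≤⟨ 2e≤S ⟩
    S                                              ≤⟨ ∑-mono heavy-term ⟩
    (∑ λ i → 2ℝ * (𝟙 (heavy i) * t i) + (2ℝ * W + (fromℚ u + - t i)))
                                                   ≈⟨ ∑-terms (λ i → 𝟙 (heavy i) * t i) (λ i → fromℚ u + - t i) (2ℝ * W) ⟩
    2ℝ * T + (fromℕ n * (2ℝ * W) + ∑ λ i → fromℚ u + - t i)
                                                   ≈⟨ +-cong ≃-refl (+-cong (≃-trans (solve 2 (λ n w → n :* (con (ι 2) :* w) := con (ι 2) :* (n :* w)) ≃-refl (fromℕ n) W)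
                                                        (*-congˡ {2ℝ} nγu≃γ)) (∑-diff (λ _ → fromℚ u) t ∑u≃1 (Distribution.total μ))) ⟩
    2ℝ * T + (2ℝ * fromℚ γ + 0ℝ)                   ≈⟨ solve 2 (λ T g → con (ι 2) :* T :+ (con (ι 2) :* g :+ con 0ℚ) := con (ι 2) :* (T :+ g)) ≃-refl T (fromℚ γ) ⟩
    2ℝ * (T + fromℚ γ)                             ∎)))
    where
    open ≤-Reasoning
    W T : ℝ
    W = fromℚ (γ ℚ.* u)
    T = ∑ λ i → 𝟙 (heavy i) * t i

  light-mass : fromℚ ½ * fromℚ e ≤ ∑ λ i → 𝟙 (light i) * fromℚ u
  light-mass = ≤-trans (proj₁ (≃-trans (solve 1 (λ e → con ½ :* e := e :- con (ι 2) :* (con (recip 4) :* e)) ≃-refl (fromℚ e))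
      (+-cong ≃-refl (let (p , q) = *-congˡ {2ℝ} Γ≃e/4 in neg-anti p , neg-anti q)))) (≤+⇒-≤ (halve (begin
    2ℝ * fromℚ e                                   ≤⟨ 2e≤S ⟩
    S                                              ≤⟨ ∑-mono light-term ⟩
    (∑ λ i → 2ℝ * (𝟙 (light i) * fromℚ u) + (fromℕ 4 * W + (t i + - fromℚ u)))
                                                   ≈⟨ ∑-terms (λ i → 𝟙 (light i) * fromℚ u) (λ i → t i + - fromℚ u) (fromℕ 4 * W) ⟩
    2ℝ * T + (fromℕ n * (fromℕ 4 * W) + ∑ λ i → t i + - fromℚ u)
                                                   ≈⟨ +-cong ≃-refl (+-cong (≃-trans (solve 2 (λ n w → n :* (con (ι 4) :* w) := con (ι 4) :* (n :* w)) ≃-refl (fromℕ n) W)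
                                                        (*-congˡ {fromℕ 4} nγu≃γ)) (∑-diff t (λ _ → fromℚ u) (Distribution.total μ) ∑u≃1)) ⟩
    2ℝ * T + (fromℕ 4 * fromℚ γ + 0ℝ)              ≈⟨ solve 2 (λ T g → con (ι 2) :* T :+ (con (ι 4) :* g :+ con 0ℚ) := con (ι 2) :* (T :+ con (ι 2) :* g)) ≃-refl T (fromℚ γ) ⟩
    2ℝ * (T + 2ℝ * fromℚ γ)                        ∎)))
    where
    open ≤-Reasoning
    W T : ℝ
    W = fromℚ (γ ℚ.* u)
    T = ∑ λ i → 𝟙 (light i) * fromℚ u

-- The expected collision probability of a trial far from uniform

0<fromℚ : ∀ {q} → 0ℚ ℚ.< q → 0ℝ < fromℚ q
0<fromℚ 0<q = 0<fromℚ≤ 0<q ≤-refl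

∑-δ-one : ∀ {n} (j : Fin n) → (∑ λ k → δ k j) ≃ 1ℝ
∑-δ-one j = ≃-trans (∑-cong λ k → ≃-sym (*-identityʳ (δ k j))) (∑-δ j (λ _ → 1ℝ))

≟⇒≡ : ∀ {n} (i j : Fin n) → does (i ≟ j) ≡ true → i ≡ j
≟⇒≡ i j h with i ≟ j
... | yes i≡j = i≡j

module Gain {n} .{{n≢0 : ℕ.NonZero n}} (K : ℕ) (n≤2^K : n ℕ.≤ 2 ℕ.^ K)
  {μ : Distribution n} (O : Oracle μ) (e : ℚ) (0<e : 0ℚ ℚ.< e) (e≤1 : e ℚ.≤ 1ℚ)
  (far : fromℚ e ≤ fromℚ ½ * ∑ λ i → ∣ mass μ i - fromℚ (recip n) ∣) where

  open Far-from-uniform μ e 0<e far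

  private
    t : Fin n → ℝ
    t = mass μ
    0≤t : ∀ v → 0ℝ ≤ t v
    0≤t = Distribution.nonneg μ
    Ω : Set
    Ω = Vec (Fin (2 ℕ.^ K)) n
    bit : Sampler (Fin (2 ℕ.^ K))
    bit = seed (2 ℕ.^ K) {{2^-nonZero K}}
    E : Mean Ω
    E = law (independent n bit)
    Γ U κ : ℝ
    Γ = fromℚ γ
    U = fromℚ u
    κ = fromℚ (recip 243) * (Γ * Γ)

    0≤Γ : 0ℝ ≤ Γ
    0≤Γ = fromℚ-mono (ℚ.<⇒≤ (ℚL.*-pos (0<recip 4) 0<e))
    0≤κ : 0ℝ ≤ κ
    0≤κ = 0≤* (fromℚ-mono (ℚ.<⇒≤ (0<recip 243))) (0≤* 0≤Γ 0≤Γ)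
    Γ≤1 : Γ ≤ 1ℝ
    Γ≤1 = fromℚ-mono (ℚL.*-mono {recip 4} {1ℚ} {e} {1ℚ} (ℚ.<⇒≤ (0<recip 4)) (ℚ.nonNegative⁻¹ 1ℚ) (ℚ.≤ᵇ⇒≤ _) e≤1)

    t≤1 : ∀ v → t v ≤ 1ℝ
    t≤1 v = ≤-trans (∑-term 0≤t v) (proj₁ (Distribution.total μ))

    density-least : fromℚ (density K 0) ≤ U
    density-least = ≤-trans (proj₁ (≃-trans (termwise λ _ → ℚ.*-identityʳ (recip2^ K)) (≃-sym (*-identityʳ (fromℚ (recip2^ K))))))
      (≤-trans (proj₂ (*-congˡ {fromℚ (recip2^ K)} (recip-real n)))
      (≤-trans (proj₁ (solve 3 (λ r u n → r :* (u :* n) := u :* (r :* n)) ≃-refl (fromℚ (recip2^ K)) U (fromℕ n)))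
      (≤-trans (*-monoʳ (fromℚ-mono (ℚ.<⇒≤ (0<recip n))) (≤-trans
          (*-monoʳ (fromℚ-mono (ℚ.<⇒≤ (0<recip (2 ℕ.^ K) {{2^-nonZero K}}))) (fromℚ-mono (ι-mono n≤2^K)))
          (proj₁ (recip-real (2 ℕ.^ K) {{2^-nonZero K}}))))
        (proj₁ (*-identityʳ U)))))

    level : ∀ i → heavy i ≡ true → ∃ λ (k : Fin (suc K)) →
            fromℚ (density K (toℕ k)) ≤ t i × t i ≤ fromℚ (ι 4 ℚ.* density K (toℕ k))
    level i h = density-near K (t i) (≤-trans density-least (heavy⇒ i h)) (t≤1 i)

    -- The value zero is a default, which H masks.
    levelOf : ∀ i b → heavy i ≡ b → Fin (suc K)
    levelOf i true  h = proj₁ (level i h)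
    levelOf i false _ = zero

    -- Every heavy point belongs to a single level, so the masses of the levels add
    -- up to the mass of all heavy points.
    H : Fin (suc K) → Fin n → Bool
    H k i = heavy i ∧ does (k ≟ levelOf i (heavy i) refl)

    H⇒ : ∀ k i → H k i ≡ true → heavy i ≡ true ×
         fromℚ (density K (toℕ k)) ≤ t i × t i ≤ fromℚ (ι 4 ℚ.* density K (toℕ k))
    H⇒ k i = go (heavy i) refl
      where
      go : ∀ b (eq : heavy i ≡ b) → b ∧ does (k ≟ levelOf i b eq) ≡ true → heavy i ≡ true ×
           fromℚ (density K (toℕ k)) ≤ t i × t i ≤ fromℚ (ι 4 ℚ.* density K (toℕ k))
      go true eq h = eq , subst (λ k → fromℚ (density K (toℕ k)) ≤ t i × t i ≤ fromℚ (ι 4 ℚ.* density K (toℕ k)))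
        (sym (≟⇒≡ k (proj₁ (level i eq)) h)) (proj₂ (level i eq))

    T : Fin (suc K) → ℝ
    T k = ∑ λ v → 𝟙 (H k v) * t v

    ∑T : (∑ T) ≃ ∑ λ v → 𝟙 (heavy v) * t v
    ∑T = begin-equality
      (∑ λ k → ∑ λ v → 𝟙 (H k v) * t v)
        ≈⟨ ∑-swap (λ k v → 𝟙 (H k v) * t v) ⟩
      (∑ λ v → ∑ λ k → 𝟙 (H k v) * t v)
        ≈⟨ ∑-cong (λ v → ≃-sym (∑-*ʳ (t v) (λ k → 𝟙 (H k v)))) ⟩
      (∑ λ v → (∑ λ k → 𝟙 (H k v)) * t v)
        ≈⟨ ∑-cong (λ v → *-cong (level-count v) (≃-refl {t v})) ⟩
      (∑ λ v → 𝟙 (heavy v) * t v) ∎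
      where
      open ≤-Reasoning
      level-count : ∀ v → (∑ λ k → 𝟙 (H k v)) ≃ 𝟙 (heavy v)
      level-count v = begin-equality
        (∑ λ k → 𝟙 (H k v))              ≈⟨ ∑-cong (λ k → 𝟙-∧ (heavy v) (does (k ≟ ℓ))) ⟩
        (∑ λ k → 𝟙 (heavy v) * δ k ℓ)    ≈⟨ ∑-*ˡ (𝟙 (heavy v)) (λ k → δ k ℓ) ⟨
        𝟙 (heavy v) * (∑ λ k → δ k ℓ)    ≈⟨ *-congˡ {𝟙 (heavy v)} (∑-δ-one ℓ) ⟩
        𝟙 (heavy v) * 1ℝ                 ≈⟨ *-identityʳ (𝟙 (heavy v)) ⟩
        𝟙 (heavy v)                      ∎
        where ℓ = levelOf v (heavy v) refl

    spread collisions : Coins n K → ℝ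
    spread ω = fromℚ (reciprocalSize (query ω))
    collisions ω = collision O (query ω)

    collisions-≥ : ∀ ω → spread ω ≤ collisions ω
    collisions-≥ ω = collision-≥ O (setOf ω) (proj₂ (query ω)) (spread ω) (reciprocalSize-inverse (query ω))

    light-gain : ∀ k j → light j ≡ true → 𝔼 E (λ ds → spread (k , j , ds)) + κ * T k ≤ 𝔼 E (λ ds → collisions (k , j , ds))
    light-gain k j lj = expected-gain μ (H k) j
        (λ v h → proj₁ (proj₂ (H⇒ k v h)))
        (λ v h → ≤-trans (proj₂ (proj₂ (H⇒ k v h))) (proj₁ (fromℚ-* (ι 4) (density K (toℕ k)))))
        (λ v h → light≤heavy j v lj (proj₁ (H⇒ k v h)))
        (λ ds → spread (k , j , ds)) (λ ds → collisions (k , j , ds)) Γ y 0≤Γ yr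
        (λ ds → Query-bound.bound O (setOf (k , j , ds)) (proj₂ (query (k , j , ds))) (B ds) (H k) j
          (spread (k , j , ds)) (fromℚ (recip 27) * Γ) Γ y (0<recip n)
          (0≤* (fromℚ-mono (ℚ.<⇒≤ (0<recip 27))) 0≤Γ) 0≤Γ
          (reciprocalSize-inverse (query (k , j , ds)))
          (Vec.[]=⇒lookup (proj₂ (proj₂ (query (k , j , ds)))))
          (λ v Bv → trans (inserted ds v) (∨-introʳ (does (v ≟ j)) Bv))
          (λ v → subst (λ b → 𝟙 b ≤ δ v j + 𝟙 (B ds v)) (sym (inserted ds v)) (𝟙-∨ (does (v ≟ j)) (B ds v)))
          (λ v h → heavy⇒ v (proj₁ (H⇒ k v h)))
          (λ v h → light-heavy-gap Γ≤1 j v lj (proj₁ (H⇒ k v h))))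
      where
      r y : ℝ
      r = fromℚ (density K (toℕ k))
      r>0 : 0ℝ < r
      r>0 = 0<fromℚ (0<density K (toℕ k))
      0≤r : 0ℝ ≤ r
      0≤r = <⇒≤ r>0
      -- The tangent touches 1 / m at m = 9 r, the bound on the expected mass of a set
      -- that contains a given heavy point of this level.
      y = fromℚ (recip 9) * r ⁻¹⟨ r>0 ⟩
      yr : y * r ≃ fromℚ (recip 9)
      yr = ≃-trans (solve 3 (λ a i r → (a :* i) :* r := a :* (r :* i)) ≃-refl (fromℚ (recip 9)) (r ⁻¹⟨ r>0 ⟩) r)
        (≃-trans (*-congˡ {fromℚ (recip 9)} (⁻¹-inverse r>0)) (*-identityʳ (fromℚ (recip 9))))
      B : Ω → Fin n → Bool
      B ds v = below (toℕ k) (lookup ds v)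
      inserted : ∀ ds v → lookup (setOf {n} {K} (k , j , ds)) v ≡ does (v ≟ j) ∨ B ds v
      inserted ds v = trans (lookup-insert (Vec.map (below (toℕ k)) ds) j v)
        (cong (does (v ≟ j) ∨_) (Vec.lookup-map v (below (toℕ k)) ds))
      probability : 𝔼 (law bit) (λ d → 𝟙 (below (toℕ k) d)) ≃ r
      probability = 𝔼-density K (toℕ k) (Fin.toℕ≤pred[n] k)
      open Random-set E B r 0≤r
        (λ v → ≃-trans (𝔼-lookup n bit (λ d → 𝟙 (below (toℕ k) d)) v) probability)
        (𝔼-lookup₂ n bit (λ d → 𝟙 (below (toℕ k) d)) r (λ d → 𝟙-idem (below (toℕ k) d)) 0≤r probability)

    gain-at : ∀ k j → 𝔼 E (λ ds → spread (k , j , ds)) + κ * T k * 𝟙 (light j) ≤ 𝔼 E (λ ds → collisions (k , j , ds))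
    gain-at k j = go (light j) refl
      where
      go : ∀ b → light j ≡ b → 𝔼 E (λ ds → spread (k , j , ds)) + κ * T k * 𝟙 b ≤ 𝔼 E (λ ds → collisions (k , j , ds))
      go true  lj = ≤-trans (+-monoʳ (proj₁ (*-identityʳ (κ * T k)))) (light-gain k j lj)
      go false _  = ≤-trans (proj₁ (≃-trans (+-cong ≃-refl (*-zeroʳ (κ * T k))) (+-identityʳ _)))
        (Mean.mono E λ ds → collisions-≥ (k , j , ds))

    0≤T : ∀ k → 0ℝ ≤ T k
    0≤T k = ∑-nonneg λ v → 0≤* (0≤𝟙 (H k v)) (0≤t v)

    ½e : ℝ
    ½e = fromℚ ½ * fromℚ e

    Eⱼ : Mean (Fin n)
    Eⱼ = law (seed n)
    Eₖ : Mean (Fin (suc K))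
    Eₖ = law (seed (suc K))

    light-probability : ½e ≤ 𝔼 Eⱼ (λ j → 𝟙 (light j))
    light-probability = ≤-trans light-mass (proj₁ (≃-trans
      (≃-trans (∑-cong λ i → *-comm (𝟙 (light i)) U) (≃-sym (∑-*ˡ U (λ i → 𝟙 (light i)))))
      (≃-sym (law-seed n (λ j → 𝟙 (light j))))))

    gain-of : ∀ k → 𝔼 Eⱼ (λ j → 𝔼 E λ ds → spread (k , j , ds)) + κ * ½e * T k ≤ 𝔼 Eⱼ (λ j → 𝔼 E λ ds → collisions (k , j , ds))
    gain-of k = begin
      X + κ * ½e * T k
        ≈⟨ +-cong ≃-refl (solve 3 (λ a b c → a :* b :* c := a :* c :* b) ≃-refl κ ½e (T k)) ⟩
      X + κ * T k * ½e
        ≤⟨ +-monoʳ (*-monoʳ (0≤* 0≤κ (0≤T k)) light-probability) ⟩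
      X + κ * T k * 𝔼 Eⱼ (λ j → 𝟙 (light j))
        ≈⟨ +-cong ≃-refl (Mean.scale Eⱼ (κ * T k) (λ j → 𝟙 (light j))) ⟨
      X + 𝔼 Eⱼ (λ j → κ * T k * 𝟙 (light j))
        ≈⟨ Mean.add Eⱼ (λ j → 𝔼 E λ ds → spread (k , j , ds)) (λ j → κ * T k * 𝟙 (light j)) ⟨
      𝔼 Eⱼ (λ j → 𝔼 E (λ ds → spread (k , j , ds)) + κ * T k * 𝟙 (light j))
        ≤⟨ Mean.mono Eⱼ (gain-at k) ⟩
      𝔼 Eⱼ (λ j → 𝔼 E λ ds → collisions (k , j , ds)) ∎
      where
      open ≤-Reasoning
      X = 𝔼 Eⱼ (λ j → 𝔼 E λ ds → spread (k , j , ds))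

    coins-law : ∀ f → 𝔼 (law (coins n K)) f ≃ 𝔼 Eₖ λ k → 𝔼 Eⱼ λ j → 𝔼 E λ ds → f (k , j , ds)
    coins-law f = ≃-trans (⊗-law (seed (suc K)) (seed n ⊗ independent n bit) f)
      (Mean.same Eₖ λ k → ⊗-law (seed n) (independent n bit) (λ (j , ds) → f (k , j , ds)))

  -- Averaging over j gains the fraction of light points, at least e / 2, and averaging
  -- over the levels the mass of heavy points, at least e / 2, divided by K + 1.
  gain : 𝔼 (law (coins n K)) (λ ω → fromℚ (reciprocalSize (query ω))) + κ * ½e * (fromℚ (recip (suc K)) * ½e)
       ≤ 𝔼 (law (coins n K)) (λ ω → collision O (query ω))
  gain = begin
    𝔼 (law (coins n K)) spread + κ * ½e * (fromℚ (recip (suc K)) * ½e)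
      ≤⟨ +-mono (proj₁ (coins-law spread)) (*-monoʳ (0≤* 0≤κ 0≤½e) (begin
          fromℚ (recip (suc K)) * ½e      ≤⟨ *-monoʳ (fromℚ-mono (ℚ.<⇒≤ (0<recip (suc K)))) (≤-trans heavy-mass (proj₂ ∑T)) ⟩
          fromℚ (recip (suc K)) * ∑ T     ≈⟨ law-seed (suc K) T ⟨
          𝔼 Eₖ T                          ∎)) ⟩
    X + κ * ½e * 𝔼 Eₖ T
      ≈⟨ +-cong ≃-refl (Mean.scale Eₖ (κ * ½e) T) ⟨
    X + 𝔼 Eₖ (λ k → κ * ½e * T k)
      ≈⟨ Mean.add Eₖ (λ k → 𝔼 Eⱼ (λ j → 𝔼 E λ ds → spread (k , j , ds))) (λ k → κ * ½e * T k) ⟨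
    𝔼 Eₖ (λ k → 𝔼 Eⱼ (λ j → 𝔼 E λ ds → spread (k , j , ds)) + κ * ½e * T k)
      ≤⟨ Mean.mono Eₖ gain-of ⟩
    𝔼 Eₖ (λ k → 𝔼 Eⱼ λ j → 𝔼 E λ ds → collisions (k , j , ds))
      ≈⟨ coins-law collisions ⟨
    𝔼 (law (coins n K)) collisions ∎
    where
    open ≤-Reasoning
    0≤½e : 0ℝ ≤ ½e
    0≤½e = 0≤* (fromℚ-mono (ℚ.nonNegative⁻¹ ½)) (fromℚ-mono (ℚ.<⇒≤ 0<e))
    X = 𝔼 Eₖ (λ k → 𝔼 Eⱼ (λ j → 𝔼 E λ ds → spread (k , j , ds)))

-- Rational estimates behind the exponential bound

module ℚ-Estimates where
  open import Data.Rational using () renaming (_+_ to _⊕_; _*_ to _⊛_; _-_ to _⊖_; -_ to ⊝_; _≤_ to _≼_)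
  open +-*-Solver using () renaming (solve to solveℚ; _:=_ to _:=ℚ_; _:+_ to _:+ℚ_; _:*_ to _:*ℚ_; _:-_ to _:-ℚ_; con to conℚ)

  0≤1ℚ : 0ℚ ≼ 1ℚ
  0≤1ℚ = ℚ.nonNegative⁻¹ 1ℚ

  from-gap : ∀ {p q d} → q ⊖ p ≡ d → 0ℚ ≼ d → p ≼ q
  from-gap {p} {q} {d} e 0≤d = subst₂ _≼_ (ℚ.+-identityʳ p) (trans (cong (p ⊕_) (sym e)) (solveℚ 2 (λ p q → p :+ℚ (q :-ℚ p) :=ℚ q) refl p q))
    (ℚ.+-monoʳ-≤ p 0≤d)

  gap : ∀ {p q} → p ≼ q → 0ℚ ≼ q ⊖ p
  gap {p} {q} h = subst (_≼ q ⊖ p) (ℚ.+-inverseʳ p) (ℚ.+-monoˡ-≤ (⊝ p) h)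

  +-nonnegℚ : ∀ {p q} → 0ℚ ≼ p → 0ℚ ≼ q → 0ℚ ≼ p ⊕ q
  +-nonnegℚ = ℚ.+-mono-≤ {0ℚ} {_} {0ℚ}

  bernoulli : ∀ {s} → 0ℚ ≼ s → ∀ m → 1ℚ ⊕ ι m ⊛ s ≼ (1ℚ ⊕ s) ^ℚ m
  bernoulli {s} 0≤s zero    = from-gap {d = 0ℚ} (solveℚ 1 (λ s → conℚ 1ℚ :-ℚ (conℚ 1ℚ :+ℚ conℚ 0ℚ :*ℚ s) :=ℚ conℚ 0ℚ) refl s) ℚ.≤-refl
  bernoulli {s} 0≤s (suc m) = ℚ.≤-trans
    (from-gap (trans (cong (λ k → (1ℚ ⊕ s) ⊛ (1ℚ ⊕ ι m ⊛ s) ⊖ (1ℚ ⊕ k ⊛ s)) (ι-+ 1 m))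
        (solveℚ 2 (λ s m → (conℚ 1ℚ :+ℚ s) :*ℚ (conℚ 1ℚ :+ℚ m :*ℚ s) :-ℚ (conℚ 1ℚ :+ℚ (conℚ 1ℚ :+ℚ m) :*ℚ s) :=ℚ m :*ℚ (s :*ℚ s)) refl s (ι m)))
      (ℚL.*-nonneg (0≤ι m) (ℚL.*-nonneg 0≤s 0≤s)))
    (ℚL.*-monoˡ (+-nonnegℚ 0≤1ℚ 0≤s) (bernoulli 0≤s m))

  1^ : ∀ m → 1ℚ ^ℚ m ≡ 1ℚ
  1^ zero    = refl
  1^ (suc m) = trans (ℚ.*-identityˡ (1ℚ ^ℚ m)) (1^ m)

  -- (1 - s)^m 2 ≤ (1 - s)^m (1 + s)^m = (1 - s²)^m ≤ 1.
  half-power : ∀ {s} m → 0ℚ ≼ s → s ≼ 1ℚ → ι m ⊛ s ≡ 1ℚ → (1ℚ ⊖ s) ^ℚ m ≼ ½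
  half-power {s} m 0≤s s≤1 ms = ℚ.*-cancelʳ-≤-pos (ι 2) (begin
    (1ℚ ⊖ s) ^ℚ m ⊛ ι 2                   ≤⟨ ℚL.*-monoˡ 0≤p (subst (_≼ (1ℚ ⊕ s) ^ℚ m) (cong (1ℚ ⊕_) ms) (bernoulli 0≤s m)) ⟩
    (1ℚ ⊖ s) ^ℚ m ⊛ (1ℚ ⊕ s) ^ℚ m         ≡⟨ sym (^ℚ-distrib (1ℚ ⊖ s) (1ℚ ⊕ s) m) ⟩
    ((1ℚ ⊖ s) ⊛ (1ℚ ⊕ s)) ^ℚ m            ≤⟨ ℚL.^-mono m (ℚL.*-nonneg (gap s≤1) (+-nonnegℚ 0≤1ℚ 0≤s))
                                               (from-gap (solveℚ 1 (λ s → conℚ 1ℚ :-ℚ (conℚ 1ℚ :-ℚ s) :*ℚ (conℚ 1ℚ :+ℚ s) :=ℚ s :*ℚ s) refl s) (ℚL.*-nonneg 0≤s 0≤s)) ⟩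
    1ℚ ^ℚ m                               ≡⟨ 1^ m ⟩
    1ℚ                                    ∎)
    where
    open ℚ.≤-Reasoning
    0≤p : 0ℚ ≼ (1ℚ ⊖ s) ^ℚ m
    0≤p = ℚL.^-nonneg m (gap s≤1)

  small-power : ∀ {s d} m a → 0ℚ ≼ s → s ≼ 1ℚ → ι m ⊛ s ≡ 1ℚ → 1ℚ ≼ d ⊛ ι (2 ℕ.^ a) → (1ℚ ⊖ s) ^ℚ (m ℕ.* a) ≼ d
  small-power {s} {d} m a 0≤s s≤1 ms 1≤d2^a = begin
    (1ℚ ⊖ s) ^ℚ (m ℕ.* a)             ≡⟨ sym (^ℚ-assoc (1ℚ ⊖ s) m a) ⟩
    ((1ℚ ⊖ s) ^ℚ m) ^ℚ a              ≤⟨ ℚL.^-mono a (ℚL.^-nonneg m (gap s≤1)) (half-power m 0≤s s≤1 ms) ⟩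
    ½ ^ℚ a                            ≡⟨ sym (ℚ.*-identityʳ (½ ^ℚ a)) ⟩
    ½ ^ℚ a ⊛ 1ℚ                       ≤⟨ ℚL.*-monoˡ (ℚL.^-nonneg a (ℚ.nonNegative⁻¹ ½)) 1≤d2^a ⟩
    ½ ^ℚ a ⊛ (d ⊛ ι (2 ℕ.^ a))        ≡⟨ cong (λ z → ½ ^ℚ a ⊛ (d ⊛ z)) (ℚL.ι-^ 2 a) ⟩
    ½ ^ℚ a ⊛ (d ⊛ ι 2 ^ℚ a)           ≡⟨ solveℚ 3 (λ x d y → x :*ℚ (d :*ℚ y) :=ℚ d :*ℚ (x :*ℚ y)) refl (½ ^ℚ a) d (ι 2 ^ℚ a) ⟩
    d ⊛ (½ ^ℚ a ⊛ ι 2 ^ℚ a)           ≡⟨ cong (d ⊛_) (sym (^ℚ-distrib ½ (ι 2) a)) ⟩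
    d ⊛ (½ ⊛ ι 2) ^ℚ a                ≡⟨ cong (d ⊛_) (1^ a) ⟩
    d ⊛ 1ℚ                            ≡⟨ ℚ.*-identityʳ d ⟩
    d                                 ∎
    where open ℚ.≤-Reasoning

  -- Factors of a likelihood ratio with step x for the threshold c, and those
  -- of its reversal, where the slack 1 + 2 s with s = 4 x² makes the two
  -- ratios multiply to at least 1.
  up down : ℚ → ℚ → ℚ → ℚ
  up   x c y = 1ℚ ⊕ x ⊛ (y ⊖ c)
  down x c y = (1ℚ ⊖ x ⊛ (y ⊖ c)) ⊛ (1ℚ ⊕ ι 2 ⊛ (ι 4 ⊛ (x ⊛ x)))

  module _ {x c : ℚ} (0≤x : 0ℚ ≼ x) (x≤ : x ≼ recip 32) (0≤c : 0ℚ ≼ c) (c≤2 : c ≼ ι 2) where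

    private
      s : ℚ
      s = ι 4 ⊛ (x ⊛ x)
      0≤s : 0ℚ ≼ s
      0≤s = ℚL.*-nonneg (0≤ι 4) (ℚL.*-nonneg 0≤x 0≤x)
      ½≥s : s ≼ ½
      ½≥s = ℚ.≤-trans (ℚL.*-monoˡ {ι 4} (0≤ι 4) (ℚL.*-mono {x} {recip 32} {x} {recip 32} 0≤x (ℚ.<⇒≤ (0<recip 32)) x≤ x≤)) (ℚ.≤ᵇ⇒≤ _)
      2x≤1 : x ⊛ ι 2 ≼ 1ℚ
      2x≤1 = ℚ.≤-trans (ℚ.*-monoʳ-≤-nonNeg (ι 2) x≤) (ℚ.≤ᵇ⇒≤ _)

    deviation : ∀ {z} → ⊝ ι 2 ≼ z → z ≼ ι 2 → x ⊛ z ≼ 1ℚ × 0ℚ ≼ 1ℚ ⊕ x ⊛ z × x ⊛ z ⊛ (x ⊛ z) ≼ s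
    deviation {z} lo hi = ℚ.≤-trans (ℚL.*-monoˡ 0≤x hi) 2x≤1 ,
      from-gap {d = (1ℚ ⊖ x ⊛ ι 2) ⊕ x ⊛ (z ⊖ ⊝ ι 2)}
        (solveℚ 2 (λ x z → (conℚ 1ℚ :+ℚ x :*ℚ z) :-ℚ conℚ 0ℚ :=ℚ (conℚ 1ℚ :-ℚ x :*ℚ conℚ (ι 2)) :+ℚ x :*ℚ (z :-ℚ conℚ (⊝ ι 2))) refl x z)
        (+-nonnegℚ (gap 2x≤1) (ℚL.*-nonneg 0≤x (gap lo))) ,
      from-gap {d = x ⊛ x ⊛ ((ι 2 ⊖ z) ⊛ (z ⊖ ⊝ ι 2))}
        (solveℚ 2 (λ x z → conℚ (ι 4) :*ℚ (x :*ℚ x) :-ℚ x :*ℚ z :*ℚ (x :*ℚ z) :=ℚ x :*ℚ x :*ℚ ((conℚ (ι 2) :-ℚ z) :*ℚ (z :-ℚ conℚ (⊝ ι 2)))) refl x z)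
        (ℚL.*-nonneg (ℚL.*-nonneg 0≤x 0≤x) (ℚL.*-nonneg (gap hi) (gap lo)))

    module _ {y : ℚ} (0≤y : 0ℚ ≼ y) (y≤1 : y ≼ 1ℚ) where

      private
        dev : x ⊛ (y ⊖ c) ≼ 1ℚ × 0ℚ ≼ 1ℚ ⊕ x ⊛ (y ⊖ c) × x ⊛ (y ⊖ c) ⊛ (x ⊛ (y ⊖ c)) ≼ s
        dev = deviation
          (from-gap {d = y ⊕ (ι 2 ⊖ c)} (solveℚ 2 (λ y c → (y :-ℚ c) :-ℚ conℚ (⊝ ι 2) :=ℚ y :+ℚ (conℚ (ι 2) :-ℚ c)) refl y c)
            (+-nonnegℚ 0≤y (gap c≤2)))
          (from-gap {d = (1ℚ ⊖ y) ⊕ (c ⊕ 1ℚ)} (solveℚ 2 (λ y c → conℚ (ι 2) :-ℚ (y :-ℚ c) :=ℚ (conℚ 1ℚ :-ℚ y) :+ℚ (c :+ℚ conℚ 1ℚ)) refl y c)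
            (+-nonnegℚ (gap y≤1) (+-nonnegℚ 0≤c 0≤1ℚ)))
        0≤slack : 0ℚ ≼ 1ℚ ⊕ ι 2 ⊛ s
        0≤slack = +-nonnegℚ 0≤1ℚ (ℚL.*-nonneg (0≤ι 2) 0≤s)

      0≤up : 0ℚ ≼ up x c y
      0≤up = proj₁ (proj₂ dev)

      0≤down : 0ℚ ≼ down x c y
      0≤down = ℚL.*-nonneg (gap (proj₁ dev)) 0≤slack

      up*down : 1ℚ ≼ up x c y ⊛ down x c y
      up*down = begin
        1ℚ
          ≤⟨ from-gap {d = ι 2 ⊛ s ⊛ (½ ⊖ s)} (solveℚ 1 (λ s → (conℚ 1ℚ :-ℚ s) :*ℚ (conℚ 1ℚ :+ℚ conℚ (ι 2) :*ℚ s) :-ℚ conℚ 1ℚ :=ℚ conℚ (ι 2) :*ℚ s :*ℚ (conℚ ½ :-ℚ s)) refl s)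
              (ℚL.*-nonneg (ℚL.*-nonneg (0≤ι 2) 0≤s) (gap ½≥s)) ⟩
        (1ℚ ⊖ s) ⊛ (1ℚ ⊕ ι 2 ⊛ s)
          ≤⟨ ℚ.*-monoʳ-≤-nonNeg (1ℚ ⊕ ι 2 ⊛ s) {{ℚ.nonNegative 0≤slack}}
               (from-gap {1ℚ ⊖ s} {1ℚ ⊖ X ⊛ X} {s ⊖ X ⊛ X} (solveℚ 2 (λ s z → (conℚ 1ℚ :-ℚ z) :-ℚ (conℚ 1ℚ :-ℚ s) :=ℚ s :-ℚ z) refl s (X ⊛ X)) (gap (proj₂ (proj₂ dev)))) ⟩
        (1ℚ ⊖ X ⊛ X) ⊛ (1ℚ ⊕ ι 2 ⊛ s)
          ≡⟨ solveℚ 2 (λ X k → (conℚ 1ℚ :-ℚ X :*ℚ X) :*ℚ k :=ℚ (conℚ 1ℚ :+ℚ X) :*ℚ ((conℚ 1ℚ :-ℚ X) :*ℚ k)) refl X (1ℚ ⊕ ι 2 ⊛ s) ⟩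
        up x c y ⊛ down x c y ∎
        where
        open ℚ.≤-Reasoning
        X = x ⊛ (y ⊖ c)

-- Independent answers as a mean

answersMean : ∀ {n} {μ : Distribution n} → Oracle μ → (As : List (Query n)) → Mean (Vec (Fin n) (length As))
answersMean O []       = always []
answersMean O (A ∷ As) = bind (weighted (answer O A)) λ j → mapMean (j ∷_) (answersMean O As)

answersPr-𝔼 : ∀ {n} {μ : Distribution n} (O : Oracle μ) As E →
              answersPr O As E ≃ 𝔼 (answersMean O As) (λ js → 𝟙 (E js))
answersPr-𝔼 O []       E = ≃-refl
answersPr-𝔼 O (A ∷ As) E = ∑-cong λ j → *-congˡ {mass (answer O A) j} (answersPr-𝔼 O As (λ js → E (j ∷ js)))

-- Products of one factor per trial

module Trials {C : Set} {n} (S : Sampler C) (ask : C → Query n) where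

  queriesOf : ∀ {N} → Vec C N → List (Query n)
  queriesOf []       = []
  queriesOf (c ∷ cs) = ask c ∷ ask c ∷ queriesOf cs

  length-queriesOf : ∀ {N} (cs : Vec C N) → length (queriesOf cs) ≡ 2 ℕ.* N
  length-queriesOf []           = refl
  length-queriesOf {suc N} (c ∷ cs) = trans (cong (λ l → suc (suc l)) (length-queriesOf cs))
    (cong suc (sym (ℕ.+-suc N (N ℕ.+ 0))))

  -- A trial whose two answers collide contributes f 1, any other trial f 0.
  factor : (ℚ → ℚ) → Fin n → Fin n → ℚ
  factor f j j′ = if does (j′ ≟ j) then f 1ℚ else f 0ℚ

  likelihood : (ℚ → ℚ) → ∀ {N} (cs : Vec C N) → Vec (Fin n) (length (queriesOf cs)) → ℚ
  likelihood f []       []            = 1ℚ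
  likelihood f (c ∷ cs) (j ∷ j′ ∷ js) = factor f j j′ ℚ.* likelihood f cs js

  likelihood-nonneg : ∀ f → 0ℚ ℚ.≤ f 0ℚ → 0ℚ ℚ.≤ f 1ℚ → ∀ {N} (cs : Vec C N) js → 0ℚ ℚ.≤ likelihood f cs js
  likelihood-nonneg f 0≤f₀ 0≤f₁ []       []            = ℚ.nonNegative⁻¹ 1ℚ
  likelihood-nonneg f 0≤f₀ 0≤f₁ (c ∷ cs) (j ∷ j′ ∷ js) =
    ℚL.*-nonneg {factor f j j′} {likelihood f cs js} (go (does (j′ ≟ j))) (likelihood-nonneg f 0≤f₀ 0≤f₁ cs js)
    where
    go : ∀ b → 0ℚ ℚ.≤ (if b then f 1ℚ else f 0ℚ)
    go true  = 0≤f₁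
    go false = 0≤f₀

  likelihood-product : ∀ f g → 1ℚ ℚ.≤ f 0ℚ ℚ.* g 0ℚ → 1ℚ ℚ.≤ f 1ℚ ℚ.* g 1ℚ →
    ∀ {N} (cs : Vec C N) js → 1ℚ ℚ.≤ likelihood f cs js ℚ.* likelihood g cs js
  likelihood-product f g h₀ h₁ []       []            = ℚ.≤-refl
  likelihood-product f g h₀ h₁ (c ∷ cs) (j ∷ j′ ∷ js) = begin
    1ℚ ℚ.* 1ℚ                          ≤⟨ ℚL.*-mono {1ℚ} {F ℚ.* G} {1ℚ} {P ℚ.* Q} 0≤1ℚ 0≤PQ (go (does (j′ ≟ j))) (likelihood-product f g h₀ h₁ cs js) ⟩
    (F ℚ.* G) ℚ.* (P ℚ.* Q)            ≡⟨ solveℚ 4 (λ F G P Q → (F :*ℚ G) :*ℚ (P :*ℚ Q) :=ℚ (F :*ℚ P) :*ℚ (G :*ℚ Q)) refl F G P Q ⟩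
    (F ℚ.* P) ℚ.* (G ℚ.* Q)            ∎
    where
    open ℚ.≤-Reasoning
    open ℚ-Estimates using (0≤1ℚ)
    open +-*-Solver using () renaming (solve to solveℚ; _:=_ to _:=ℚ_; _:*_ to _:*ℚ_)
    F G P Q : ℚ
    F = factor f j j′
    G = factor g j j′
    P = likelihood f cs js
    Q = likelihood g cs js
    0≤PQ : 0ℚ ℚ.≤ P ℚ.* Q
    0≤PQ = ℚ.≤-trans 0≤1ℚ (likelihood-product f g h₀ h₁ cs js)
    go : ∀ b → 1ℚ ℚ.≤ (if b then f 1ℚ else f 0ℚ) ℚ.* (if b then g 1ℚ else g 0ℚ)
    go true  = h₁
    go false = h₀

  module _ {μ : Distribution n} (O : Oracle μ) (f : ℚ → ℚ) where

    private
      a b : ℝ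
      a = fromℚ (f 0ℚ)
      b = fromℚ (f 1ℚ) + - fromℚ (f 0ℚ)
      q : C → ℝ
      q c = collision O (ask c)
      p : C → Fin n → ℝ
      p c = mass (answer O (ask c))

      Φ : ∀ {N} → Vec C N → ℝ
      Φ cs = 𝔼 (answersMean O (queriesOf cs)) (λ js → fromℚ (likelihood f cs js))

      factor-δ : ∀ j j′ → fromℚ (factor f j j′) ≃ a + b * δ j′ j
      factor-δ j j′ = go (does (j′ ≟ j))
        where
        go : ∀ x → fromℚ (if x then f 1ℚ else f 0ℚ) ≃ a + b * 𝟙 x
        go true  = solve 2 (λ a c → c := a :+ (c :- a) :* con 1ℚ) ≃-refl a (fromℚ (f 1ℚ))
        go false = solve 2 (λ a b → a := a :+ b :* con 0ℚ) ≃-refl a b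

      inner : ∀ c X j → 𝔼 (weighted (answer O (ask c))) (λ j′ → fromℚ (factor f j j′) * X) ≃ X * a + X * b * p c j
      inner c X j = begin-equality
        𝔼 W (λ j′ → fromℚ (factor f j j′) * X)
          ≈⟨ Mean.same W (λ j′ → ≃-trans (*-cong (factor-δ j j′) ≃-refl)
               (solve 4 (λ a b d X → (a :+ b :* d) :* X := X :* a :+ X :* b :* d) ≃-refl a b (δ j′ j) X)) ⟩
        𝔼 W (λ j′ → X * a + X * b * δ j′ j)
          ≈⟨ Mean.affine W (X * a) (X * b) (λ j′ → δ j′ j) ⟩
        X * a + X * b * 𝔼 W (λ j′ → δ j′ j)
          ≈⟨ +-cong ≃-refl (*-congˡ {X * b} (≃-trans (∑-cong λ j′ → *-comm (p c j′) (δ j′ j)) (∑-δ j (p c)))) ⟩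
        X * a + X * b * p c j ∎
        where
        open ≤-Reasoning
        W = weighted (answer O (ask c))

      outer : ∀ c X → 𝔼 (weighted (answer O (ask c))) (λ j → X * a + X * b * p c j) ≃ (a + b * q c) * X
      outer c X = ≃-trans (Mean.affine (weighted (answer O (ask c))) (X * a) (X * b) (p c))
        (solve 4 (λ a b q X → X :* a :+ X :* b :* q := (a :+ b :* q) :* X) ≃-refl a b (q c) X)

      step : ∀ {N} c (cs : Vec C N) → Φ (c ∷ cs) ≃ (a + b * q c) * Φ cs
      step c cs = begin-equality
        Φ (c ∷ cs)
          ≈⟨ Mean.same W (λ j → Mean.same W λ j′ → ≃-trans
               (Mean.same R λ js → fromℚ-* (factor f j j′) (likelihood f cs js))
               (Mean.scale R (fromℚ (factor f j j′)) (λ js → fromℚ (likelihood f cs js)))) ⟩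
        𝔼 W (λ j → 𝔼 W λ j′ → fromℚ (factor f j j′) * Φ cs)
          ≈⟨ Mean.same W (inner c (Φ cs)) ⟩
        𝔼 W (λ j → Φ cs * a + Φ cs * b * p c j)
          ≈⟨ outer c (Φ cs) ⟩
        (a + b * q c) * Φ cs ∎
        where
        open ≤-Reasoning
        W = weighted (answer O (ask c))
        R = answersMean O (queriesOf cs)

    -- The trials are independent, and a trial contributes its collision probability
    -- through the affine interpolation of f between 0 and 1.
    𝔼-likelihood : ∀ N → 𝔼 (law (independent N S)) Φ ≃ (a + b * 𝔼 (law S) q) ^ N
    𝔼-likelihood zero = independent-zero S Φ
    𝔼-likelihood (suc N) = begin-equality
      𝔼 (law (independent (suc N) S)) Φ
        ≈⟨ independent-suc N S Φ ⟩
      𝔼 (law S) (λ c → 𝔼 (law (independent N S)) λ cs → Φ (c ∷ cs))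
        ≈⟨ Mean.same (law S) (λ c → ≃-trans (Mean.same (law (independent N S)) (step c))
             (≃-trans (Mean.scale (law (independent N S)) (a + b * q c) Φ)
             (≃-trans (*-congˡ {a + b * q c} (𝔼-likelihood N)) (*-comm (a + b * q c) ρ^N)))) ⟩
      𝔼 (law S) (λ c → ρ^N * (a + b * q c))
        ≈⟨ Mean.scale (law S) ρ^N (λ c → a + b * q c) ⟩
      ρ^N * 𝔼 (law S) (λ c → a + b * q c)
        ≈⟨ *-congˡ {ρ^N} (Mean.affine (law S) a b q) ⟩
      ρ^N * ρ
        ≈⟨ *-comm ρ^N ρ ⟩
      ρ * ρ^N ∎
      where
      open ≤-Reasoning
      ρ ρ^N : ℝ
      ρ = a + b * 𝔼 (law S) q
      ρ^N = ρ ^ N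

    -- Markov's inequality turns this into a bound on the probability that the
    -- likelihood exceeds 1.
    𝔼-likelihood-≤ : 0ℚ ℚ.≤ f 0ℚ → 0ℚ ℚ.≤ f 1ℚ → ∀ {σ} → a + b * 𝔼 (law S) q ≤ fromℚ σ →
      ∀ N → 𝔼 (law (independent N S)) Φ ≤ fromℚ (σ ^ℚ N)
    𝔼-likelihood-≤ 0≤f₀ 0≤f₁ {σ} ρ≤σ N = ≤-trans (proj₁ (𝔼-likelihood N)) (power N)
      where
      0≤ρ : 0ℝ ≤ a + b * 𝔼 (law S) q
      0≤ρ = ≤-trans (Mean.nonneg (law (independent 1 S)) {Φ} (λ cs → Mean.nonneg (answersMean O (queriesOf cs))
          λ js → fromℚ-mono (likelihood-nonneg f 0≤f₀ 0≤f₁ cs js)))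
        (proj₁ (≃-trans (𝔼-likelihood 1) (*-identityʳ _)))
      0≤ρ^ : ∀ N → 0ℝ ≤ (a + b * 𝔼 (law S) q) ^ N
      0≤ρ^ zero    = 0≤1
      0≤ρ^ (suc N) = 0≤* 0≤ρ (0≤ρ^ N)
      power : ∀ N → (a + b * 𝔼 (law S) q) ^ N ≤ fromℚ (σ ^ℚ N)
      power zero    = ≤-refl
      power (suc N) = ≤-trans (*-mono (≤-trans 0≤ρ ρ≤σ) (0≤ρ^ N) ρ≤σ (power N)) (proj₂ (fromℚ-* σ (σ ^ℚ N)))

-- The test

fromℚ-∑ : ∀ {n} (f : Fin n → ℚ) → fromℚ (∑ℚ f) ≃ ∑ λ i → fromℚ (f i)
fromℚ-∑ {zero}  f = ≃-refl
fromℚ-∑ {suc n} f = ≃-trans (fromℚ-+ (f zero) (∑ℚ λ i → f (suc i))) (+-cong ≃-refl (fromℚ-∑ λ i → f (suc i)))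

recip≤1 : ∀ n .{{_ : ℕ.NonZero n}} → recip n ℚ.≤ 1ℚ
recip≤1 n@(suc _) = subst₂ ℚ._≤_ (ℚ.*-identityˡ (recip n)) (recip-inverse n)
  (ℚ.*-monoʳ-≤-nonNeg (recip n) {{ℚ.nonNegative (ℚ.<⇒≤ (0<recip n))}} (ι-mono {1} {n} (ℕ.s≤s ℕ.z≤n)))

module Test (n : ℕ) .{{n≢0 : ℕ.NonZero n}} (K : ℕ) (n≤2^K : n ℕ.≤ 2 ℕ.^ K) (b : ℕ) {{b≢0 : ℕ.NonZero b}} (a : ℕ) where

  open ℚ-Estimates

  trial : Sampler (Coins n K)
  trial = coins n K

  open Trials trial query

  -- 1 / D is the gain in collision probability, with 15552 = 243 · 4² · 2 · 2.  In
  -- terms of x = 1 / (32 D), m is the reciprocal of 4 x², so 256 = 32² / 4.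
  D m N : ℕ
  D = b ℕ.* b ℕ.* b ℕ.* b ℕ.* suc K ℕ.* 15552
  m = D ℕ.* D ℕ.* 256
  N = m ℕ.* a

  instance
    D≢0 : ℕ.NonZero D
    D≢0 = ℕ.m*n≢0 (b ℕ.* b ℕ.* b ℕ.* b ℕ.* suc K) 15552
      {{ℕ.m*n≢0 (b ℕ.* b ℕ.* b ℕ.* b) (suc K)
        {{ℕ.m*n≢0 (b ℕ.* b ℕ.* b) b {{ℕ.m*n≢0 (b ℕ.* b) b {{ℕ.m*n≢0 b b}}}}}}}}

  -- The gain is 32 x, and c lies halfway between the collision probabilities q₀ and
  -- q₀ + 32 x that are to be told apart.
  e q₀ x c : ℚ
  e  = recip b
  q₀ = recip (size trial) {{pos trial}} ℚ.* ∑ℚ (λ r → reciprocalSize (query (draw trial r)))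
  x  = recip 32 ℚ.* recip D
  c  = q₀ ℚ.+ ι 16 ℚ.* x

  experiment : Sampler (Vec (Coins n K) N)
  experiment = independent N trial

  collisionTest : NonAdaptiveTest n
  collisionTest = record
    { seeds   = size experiment
    ; seeds≢0 = pos experiment
    ; queries = λ r → queriesOf (draw experiment r)
    ; accepts = λ r js → does (likelihood (up x c) (draw experiment r) js ℚ.<? 1ℚ)
    }

  q₀-real : fromℚ q₀ ≃ 𝔼 (law trial) (λ ω → fromℚ (reciprocalSize (query ω)))
  q₀-real = ≃-trans (fromℚ-* (recip (size trial) {{pos trial}}) _)
    (*-congˡ {fromℚ (recip (size trial) {{pos trial}})} (fromℚ-∑ λ r → reciprocalSize (query (draw trial r))))

  0≤q₀ : 0ℚ ℚ.≤ q₀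
  0≤q₀ = fromℚ-cancel (≤-trans (Mean.nonneg (law trial) λ ω → fromℚ-mono (0≤rs (query ω))) (proj₂ q₀-real))
    where
    0≤rs : ∀ (Q : Query n) → 0ℚ ℚ.≤ reciprocalSize Q
    0≤rs (A , ne) = ℚ.<⇒≤ (0<recip Subset.∣ A ∣ {{nonempty⇒∣∣-nonZero ne}})

  q₀≤1 : q₀ ℚ.≤ 1ℚ
  q₀≤1 = fromℚ-cancel (≤-trans (proj₁ q₀-real)
    (≤-trans (Mean.mono (law trial) λ ω → fromℚ-mono (rs≤1 (query ω))) (proj₁ (Mean.unit (law trial)))))
    where
    rs≤1 : ∀ (Q : Query n) → reciprocalSize Q ℚ.≤ 1ℚ
    rs≤1 (A , ne) = recip≤1 Subset.∣ A ∣ {{nonempty⇒∣∣-nonZero ne}}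

  private
    s : ℚ
    s = ι 4 ℚ.* (x ℚ.* x)

    0≤x : 0ℚ ℚ.≤ x
    0≤x = ℚ.<⇒≤ (ℚL.*-pos (0<recip 32) (0<recip D))

    x≤ : x ℚ.≤ recip 32
    x≤ = subst (x ℚ.≤_) (ℚ.*-identityʳ (recip 32)) (ℚL.*-monoˡ (ℚ.<⇒≤ (0<recip 32)) (recip≤1 D))

    0≤16x : 0ℚ ℚ.≤ ι 16 ℚ.* x
    0≤16x = ℚL.*-nonneg (0≤ι 16) 0≤x

    0≤c : 0ℚ ℚ.≤ c
    0≤c = +-nonnegℚ 0≤q₀ 0≤16x

    c≤2 : c ℚ.≤ ι 2
    c≤2 = ℚ.+-mono-≤ {q₀} {1ℚ} {ι 16 ℚ.* x} {1ℚ} q₀≤1 (ℚ.≤-trans (ℚL.*-monoˡ (0≤ι 16) x≤) (ℚ.≤ᵇ⇒≤ _))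

    0≤s : 0ℚ ℚ.≤ s
    0≤s = ℚL.*-nonneg (0≤ι 4) (ℚL.*-nonneg 0≤x 0≤x)

    s≤1 : s ℚ.≤ 1ℚ
    s≤1 = ℚ.≤-trans (ℚL.*-monoˡ {ι 4} (0≤ι 4) (ℚL.*-mono {x} {recip 32} {x} {recip 32} 0≤x (ℚ.<⇒≤ (0<recip 32)) x≤ x≤)) (ℚ.≤ᵇ⇒≤ _)

    ms≡1 : ι m ℚ.* s ≡ 1ℚ
    ms≡1 = trans (cong (ℚ._* s) (trans (ι-* (D ℕ.* D) 256) (cong (ℚ._* ι 256) (ι-* D D))))
      (trans (solveℚ 2 (λ d r → (d :*ℚ d :*ℚ conℚ (ι 256)) :*ℚ (conℚ (ι 4) :*ℚ ((conℚ (recip 32) :*ℚ r) :*ℚ (conℚ (recip 32) :*ℚ r)))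
                 :=ℚ (d :*ℚ r) :*ℚ (d :*ℚ r)) refl (ι D) (recip D))
        (cong (λ z → z ℚ.* z) (recip-inverse D)))
      where open +-*-Solver using () renaming (solve to solveℚ; _:=_ to _:=ℚ_; _:*_ to _:*ℚ_; con to conℚ)


    affine-real : ∀ u v q → fromℚ u + (fromℚ v + - fromℚ u) * fromℚ q ≃ fromℚ (u ℚ.+ (v ℚ.- u) ℚ.* q)
    affine-real u v q = ≃-sym (≃-trans (fromℚ-+ u ((v ℚ.- u) ℚ.* q)) (+-cong ≃-refl (≃-trans (fromℚ-* (v ℚ.- u) q)
      (*-cong (≃-trans (fromℚ-+ v (ℚ.- u)) (+-cong ≃-refl (fromℚ-neg u))) ≃-refl))))

    module _ where
      open +-*-Solver using () renaming (solve to solveℚ; _:=_ to _:=ℚ_; _:+_ to _:+ℚ_; _:*_ to _:*ℚ_; _:-_ to _:-ℚ_; con to conℚ)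

      up-mean : up x c 0ℚ ℚ.+ (up x c 1ℚ ℚ.- up x c 0ℚ) ℚ.* q₀ ℚ.≤ 1ℚ ℚ.- s
      up-mean = from-gap {d = ι 12 ℚ.* (x ℚ.* x)}
        (solveℚ 2 (λ x q → (conℚ 1ℚ :-ℚ conℚ (ι 4) :*ℚ (x :*ℚ x)) :-ℚ
            ((conℚ 1ℚ :+ℚ x :*ℚ (conℚ 0ℚ :-ℚ (q :+ℚ conℚ (ι 16) :*ℚ x))) :+ℚ
             ((conℚ 1ℚ :+ℚ x :*ℚ (conℚ 1ℚ :-ℚ (q :+ℚ conℚ (ι 16) :*ℚ x))) :-ℚ (conℚ 1ℚ :+ℚ x :*ℚ (conℚ 0ℚ :-ℚ (q :+ℚ conℚ (ι 16) :*ℚ x)))) :*ℚ q)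
          :=ℚ conℚ (ι 12) :*ℚ (x :*ℚ x)) refl x q₀)
        (ℚL.*-nonneg (0≤ι 12) (ℚL.*-nonneg 0≤x 0≤x))

      down-mean : down x c 0ℚ ℚ.+ (down x c 1ℚ ℚ.- down x c 0ℚ) ℚ.* (q₀ ℚ.+ ι 32 ℚ.* x) ℚ.≤ 1ℚ ℚ.- s
      down-mean = from-gap {d = s ℚ.+ ι 8 ℚ.* (s ℚ.* s)}
        (solveℚ 2 (λ x q → let s = conℚ (ι 4) :*ℚ (x :*ℚ x)
                               k = conℚ 1ℚ :+ℚ conℚ (ι 2) :*ℚ s
                               c = q :+ℚ conℚ (ι 16) :*ℚ x
                               d₀ = (conℚ 1ℚ :-ℚ x :*ℚ (conℚ 0ℚ :-ℚ c)) :*ℚ k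
                               d₁ = (conℚ 1ℚ :-ℚ x :*ℚ (conℚ 1ℚ :-ℚ c)) :*ℚ k in
            (conℚ 1ℚ :-ℚ s) :-ℚ (d₀ :+ℚ (d₁ :-ℚ d₀) :*ℚ (q :+ℚ conℚ (ι 32) :*ℚ x))
          :=ℚ s :+ℚ conℚ (ι 8) :*ℚ (s :*ℚ s)) refl x q₀)
        (+-nonnegℚ 0≤s (ℚL.*-nonneg (0≤ι 8) (ℚL.*-nonneg 0≤s 0≤s)))

      down-slope : down x c 1ℚ ℚ.≤ down x c 0ℚ
      down-slope = from-gap {d = x ℚ.* (1ℚ ℚ.+ ι 2 ℚ.* s)}
        (solveℚ 3 (λ x c k → (conℚ 1ℚ :-ℚ x :*ℚ (conℚ 0ℚ :-ℚ c)) :*ℚ k :-ℚ (conℚ 1ℚ :-ℚ x :*ℚ (conℚ 1ℚ :-ℚ c)) :*ℚ k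
          :=ℚ x :*ℚ k) refl x c (1ℚ ℚ.+ ι 2 ℚ.* s))
        (ℚL.*-nonneg 0≤x (+-nonnegℚ 0≤1ℚ (ℚL.*-nonneg (0≤ι 2) 0≤s)))

    up-nonneg : ∀ {y} → 0ℚ ℚ.≤ y → y ℚ.≤ 1ℚ → 0ℚ ℚ.≤ up x c y
    up-nonneg = 0≤up 0≤x x≤ 0≤c c≤2

    down-nonneg : ∀ {y} → 0ℚ ℚ.≤ y → y ℚ.≤ 1ℚ → 0ℚ ℚ.≤ down x c y
    down-nonneg = 0≤down 0≤x x≤ 0≤c c≤2

    reversal : ∀ {y} → 0ℚ ℚ.≤ y → y ℚ.≤ 1ℚ → 1ℚ ℚ.≤ up x c y ℚ.* down x c y
    reversal = up*down 0≤x x≤ 0≤c c≤2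

    accept-or-large : ∀ w → 0ℚ ℚ.≤ w → 1ℝ ≤ 𝟙 (does (w ℚ.<? 1ℚ)) + fromℚ w
    accept-or-large w 0≤w = go (w ℚ.<? 1ℚ)
      where
      go : (d : Dec (w ℚ.< 1ℚ)) → 1ℝ ≤ 𝟙 (does d) + fromℚ w
      go (yes _)  = x≤x+y (fromℚ-mono 0≤w)
      go (no w≮1) = ≤-trans (fromℚ-mono (ℚ.≮⇒≥ w≮1)) (proj₂ (+-identityˡ (fromℚ w)))

    reject-or-large : ∀ w v → 0ℚ ℚ.≤ v → 1ℚ ℚ.≤ w ℚ.* v → 1ℝ ≤ 𝟙 (not (does (w ℚ.<? 1ℚ))) + fromℚ v
    reject-or-large w v 0≤v 1≤wv = go (w ℚ.<? 1ℚ)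
      where
      go : (d : Dec (w ℚ.< 1ℚ)) → 1ℝ ≤ 𝟙 (not (does d)) + fromℚ v
      go (no _)    = x≤x+y (fromℚ-mono 0≤v)
      go (yes w<1) = ≤-trans (fromℚ-mono (ℚ.≤-trans 1≤wv
          (subst (w ℚ.* v ℚ.≤_) (ℚ.*-identityˡ v) (ℚ.*-monoʳ-≤-nonNeg v {{ℚ.nonNegative 0≤v}} (ℚ.<⇒≤ w<1)))))
        (proj₂ (+-identityˡ (fromℚ v)))

    1-≤ : ∀ {δ P F} → 1ℝ ≤ P + F → F ≤ δ → 1ℝ - δ ≤ P
    1-≤ {δ} h g = ≤-trans (proj₁ (-≃+- 1ℝ δ)) (≤+⇒-≤ (≤-trans h (+-monoʳ g)))

  module _ {d : ℚ} (1≤d2^a : 1ℚ ℚ.≤ d ℚ.* ι (2 ℕ.^ a)) {δ : ℝ} (d≤δ : fromℚ d ≤ δ)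
           {μ : Distribution n} (O : Oracle μ) where

    private
      answers : ∀ {N} (cs : Vec (Coins n K) N) → Mean (Vec (Fin n) (length (queriesOf cs)))
      answers cs = answersMean O (queriesOf cs)

      q : ℝ
      q = 𝔼 (law trial) (λ ω → collision O (query ω))

      Φ : (ℚ → ℚ) → ∀ {N} → Vec (Coins n K) N → ℝ
      Φ f cs = 𝔼 (answers cs) (λ js → fromℚ (likelihood f cs js))

      -- Markov's inequality: the verdict V can fail only where the likelihood of f is at
      -- least 1, and the mean of the likelihood is at most δ.
      verdict : ∀ f → 0ℚ ℚ.≤ f 0ℚ → 0ℚ ℚ.≤ f 1ℚ →
        fromℚ (f 0ℚ) + (fromℚ (f 1ℚ) + - fromℚ (f 0ℚ)) * q ≤ fromℚ (1ℚ ℚ.- s) →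
        (V : ∀ (cs : Vec (Coins n K) N) → Vec (Fin n) (length (queriesOf cs)) → Bool) →
        (∀ cs js → 1ℝ ≤ 𝟙 (V cs js) + fromℚ (likelihood f cs js)) →
        1ℝ - δ ≤ 𝔼 (law experiment) (λ cs → answersPr O (queriesOf cs) (V cs))
      verdict f 0≤f₀ 0≤f₁ mean V right = 1-≤ total (≤-trans
        (≤-trans (𝔼-likelihood-≤ O f 0≤f₀ 0≤f₁ mean N) (fromℚ-mono (small-power m a 0≤s s≤1 ms≡1 1≤d2^a))) d≤δ)
        where
        open ≤-Reasoning
        total : 1ℝ ≤ 𝔼 (law experiment) (λ cs → answersPr O (queriesOf cs) (V cs)) + 𝔼 (law experiment) (Φ f)
        total = begin
          1ℝ
            ≈⟨ Mean.unit (law experiment) ⟨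
          𝔼 (law experiment) (λ _ → 1ℝ)
            ≤⟨ Mean.mono (law experiment) (λ cs → ≤-trans (proj₂ (Mean.unit (answers cs))) (≤-trans
                 (Mean.mono (answers cs) (right cs))
                 (proj₁ (≃-trans (Mean.add (answers cs) (λ js → 𝟙 (V cs js)) (λ js → fromℚ (likelihood f cs js)))
                   (+-cong (≃-sym (answersPr-𝔼 O (queriesOf cs) (V cs))) ≃-refl))))) ⟩
          𝔼 (law experiment) (λ cs → answersPr O (queriesOf cs) (V cs) + Φ f cs)
            ≈⟨ Mean.add (law experiment) (λ cs → answersPr O (queriesOf cs) (V cs)) (Φ f) ⟩
          𝔼 (law experiment) (λ cs → answersPr O (queriesOf cs) (V cs)) + 𝔼 (law experiment) (Φ f) ∎

    accepts-uniform : IsUniform n μ → 1ℝ - δ ≤ acceptPr collisionTest O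
    accepts-uniform unif = verdict (up x c) (up-nonneg ℚ.≤-refl 0≤1ℚ) (up-nonneg 0≤1ℚ ℚ.≤-refl)
      (≤-trans (proj₁ (≃-trans (+-cong ≃-refl (*-congˡ {fromℚ (up x c 1ℚ) + - fromℚ (up x c 0ℚ)} q≃q₀)) (affine-real (up x c 0ℚ) (up x c 1ℚ) q₀)))
        (fromℚ-mono up-mean))
      (λ cs js → does (likelihood (up x c) cs js ℚ.<? 1ℚ))
      (λ cs js → accept-or-large (likelihood (up x c) cs js)
        (likelihood-nonneg (up x c) (up-nonneg ℚ.≤-refl 0≤1ℚ) (up-nonneg 0≤1ℚ ℚ.≤-refl) cs js))
      where
      q≃q₀ : q ≃ fromℚ q₀
      q≃q₀ = ≃-trans (Mean.same (law trial) λ ω → uniform-collision O unif (query ω)) (≃-sym q₀-real)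

    rejects-far : fromℚ e ≤ fromℚ ½ * (∑ λ i → ∣ mass μ i - fromℚ (recip n) ∣) → 1ℝ - δ ≤ rejectPr collisionTest O
    rejects-far far = verdict (down x c) (down-nonneg ℚ.≤-refl 0≤1ℚ) (down-nonneg 0≤1ℚ ℚ.≤-refl)
      (≤-trans (≤-trans slope (proj₁ (affine-real (down x c 0ℚ) (down x c 1ℚ) (q₀ ℚ.+ ι 32 ℚ.* x)))) (fromℚ-mono down-mean))
      (λ cs js → not (does (likelihood (up x c) cs js ℚ.<? 1ℚ)))
      (λ cs js → reject-or-large (likelihood (up x c) cs js) (likelihood (down x c) cs js)
        (likelihood-nonneg (down x c) (down-nonneg ℚ.≤-refl 0≤1ℚ) (down-nonneg 0≤1ℚ ℚ.≤-refl) cs js)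
        (likelihood-product (up x c) (down x c) (reversal ℚ.≤-refl 0≤1ℚ) (reversal 0≤1ℚ ℚ.≤-refl) cs js))
      where
      open ≤-Reasoning
      ½e : ℚ
      ½e = ½ ℚ.* e
      G : ℚ
      G = recip 243 ℚ.* ((recip 4 ℚ.* e) ℚ.* (recip 4 ℚ.* e)) ℚ.* ½e ℚ.* (recip (suc K) ℚ.* ½e)
      32x≡G : ι 32 ℚ.* x ≡ G
      32x≡G = trans (solveℚ 1 (λ r → conℚ (ι 32) :*ℚ (conℚ (recip 32) :*ℚ r) :=ℚ r) refl (recip D))
        (recip-unique D (trans (cong (ℚ._* G) ιD)
          (trans (solveℚ 4 (λ b k e r → (b :*ℚ b :*ℚ b :*ℚ b :*ℚ k :*ℚ conℚ (ι 15552)) :*ℚ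
              (conℚ (recip 243) :*ℚ ((conℚ (recip 4) :*ℚ e) :*ℚ (conℚ (recip 4) :*ℚ e)) :*ℚ (conℚ ½ :*ℚ e) :*ℚ (r :*ℚ (conℚ ½ :*ℚ e)))
              :=ℚ (b :*ℚ e) :*ℚ (b :*ℚ e) :*ℚ (b :*ℚ e) :*ℚ (b :*ℚ e) :*ℚ (k :*ℚ r)) refl (ι b) (ι (suc K)) e (recip (suc K)))
            (cong₂ (λ y z → y ℚ.* y ℚ.* y ℚ.* y ℚ.* z) (recip-inverse b) (recip-inverse (suc K))))))
        where
        open +-*-Solver using () renaming (solve to solveℚ; _:=_ to _:=ℚ_; _:*_ to _:*ℚ_; con to conℚ)
        ιD : ι D ≡ ι b ℚ.* ι b ℚ.* ι b ℚ.* ι b ℚ.* ι (suc K) ℚ.* ι 15552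
        ιD = trans (ι-* (b ℕ.* b ℕ.* b ℕ.* b ℕ.* suc K) 15552) (cong (ℚ._* ι 15552)
          (trans (ι-* (b ℕ.* b ℕ.* b ℕ.* b) (suc K)) (cong (ℚ._* ι (suc K))
          (trans (ι-* (b ℕ.* b ℕ.* b) b) (cong (ℚ._* ι b)
          (trans (ι-* (b ℕ.* b) b) (cong (ℚ._* ι b) (ι-* b b))))))))
      G-real : fromℚ G ≃ fromℚ (recip 243) * (fromℚ (recip 4 ℚ.* e) * fromℚ (recip 4 ℚ.* e)) * (fromℚ ½ * fromℚ e)
                         * (fromℚ (recip (suc K)) * (fromℚ ½ * fromℚ e))
      G-real = ≃-trans (fromℚ-* (recip 243 ℚ.* (γ′ ℚ.* γ′) ℚ.* ½e) (recip (suc K) ℚ.* ½e)) (*-cong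
        (≃-trans (fromℚ-* (recip 243 ℚ.* (γ′ ℚ.* γ′)) ½e) (*-cong
          (≃-trans (fromℚ-* (recip 243) (γ′ ℚ.* γ′)) (*-congˡ {fromℚ (recip 243)} (fromℚ-* γ′ γ′)))
          (fromℚ-* ½ e)))
        (≃-trans (fromℚ-* (recip (suc K)) ½e) (*-congˡ {fromℚ (recip (suc K))} (fromℚ-* ½ e))))
        where
        γ′ : ℚ
        γ′ = recip 4 ℚ.* e
      q₀+32x≤q : fromℚ (q₀ ℚ.+ ι 32 ℚ.* x) ≤ q
      q₀+32x≤q = ≤-trans (proj₁ (≃-trans (fromℚ-+ q₀ (ι 32 ℚ.* x))
          (+-cong q₀-real (≃-trans (termwise λ _ → 32x≡G) G-real))))
        (Gain.gain K n≤2^K O e (0<recip b) (recip≤1 b) far)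
      d₀ d₁ : ℝ
      d₀ = fromℚ (down x c 0ℚ)
      d₁ = fromℚ (down x c 1ℚ)
      slope : d₀ + (d₁ + - d₀) * q ≤ d₀ + (d₁ + - d₀) * fromℚ (q₀ ℚ.+ ι 32 ℚ.* x)
      slope = begin
        d₀ + (d₁ + - d₀) * q
          ≈⟨ solve 3 (λ d₀ d₁ q → d₀ :+ (d₁ :- d₀) :* q := d₀ :- (d₀ :- d₁) :* q) ≃-refl d₀ d₁ q ⟩
        d₀ + - ((d₀ + - d₁) * q)
          ≤⟨ +-monoʳ (neg-anti (*-monoʳ (≤⇒0≤- (fromℚ-mono down-slope)) q₀+32x≤q)) ⟩
        d₀ + - ((d₀ + - d₁) * fromℚ (q₀ ℚ.+ ι 32 ℚ.* x))
          ≈⟨ solve 3 (λ d₀ d₁ q → d₀ :+ (d₁ :- d₀) :* q := d₀ :- (d₀ :- d₁) :* q) ≃-refl d₀ d₁ (fromℚ (q₀ ℚ.+ ι 32 ℚ.* x)) ⟨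
        d₀ + (d₁ + - d₀) * fromℚ (q₀ ℚ.+ ι 32 ℚ.* x) ∎

-- Parameters

minimal-exponent : ∀ n → ∃ λ K → n ℕ.≤ 2 ℕ.^ K × (K ≡ 0 ⊎ ∃ λ K′ → K ≡ suc K′ × ¬ n ℕ.≤ 2 ℕ.^ K′)
minimal-exponent n = least (λ K → n ℕ.≤? 2 ℕ.^ K) n (n≤2^n n)

minimal-multiple : ∀ {d} → 0ℚ ℚ.< d → ∃ λ b → 1ℚ ℚ.≤ d ℚ.* ι b × (b ≡ 0 ⊎ ∃ λ b′ → b ≡ suc b′ × ¬ 1ℚ ℚ.≤ d ℚ.* ι b′)
minimal-multiple {d} 0<d = least (λ b → 1ℚ ℚ.≤? d ℚ.* ι b) B
  (subst (ℚ._≤ d ℚ.* ι B) (1/₀-inverse 0<d) (ℚL.*-monoˡ (ℚ.<⇒≤ 0<d) (proj₂ (archimedean (1/₀ d)))))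
  where B = proj₁ (archimedean (1/₀ d))

minimal-doubling : ∀ {d} → 0ℚ ℚ.< d → ∃ λ a → 1ℚ ℚ.≤ d ℚ.* ι (2 ℕ.^ a) × (a ≡ 0 ⊎ ∃ λ a′ → a ≡ suc a′ × ¬ 1ℚ ℚ.≤ d ℚ.* ι (2 ℕ.^ a′))
minimal-doubling {d} 0<d = least (λ a → 1ℚ ℚ.≤? d ℚ.* ι (2 ℕ.^ a)) B
  (ℚ.≤-trans (proj₁ (proj₂ (minimal-multiple 0<d))) (ℚL.*-monoˡ (ℚ.<⇒≤ 0<d) (ι-mono (n≤2^n B))))
  where B = proj₁ (minimal-multiple 0<d)

1≰0 : ¬ 1ℚ ℚ.≤ 0ℚ
1≰0 h = ℚ.<-irrefl refl (ℚ.<-≤-trans (ℚ.positive⁻¹ 1ℚ) h)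

multiple-nonZero : ∀ {d} b → 1ℚ ℚ.≤ d ℚ.* ι b → ℕ.NonZero b
multiple-nonZero {d} zero h = contradiction (subst (1ℚ ℚ.≤_) (ℚ.*-zeroʳ d) h) 1≰0
multiple-nonZero (suc b) _ = _

recip-≤ : ∀ {d} b .{{_ : ℕ.NonZero b}} → 1ℚ ℚ.≤ d ℚ.* ι b → recip b ℚ.≤ d
recip-≤ {d} b h = subst₂ ℚ._≤_ (ℚ.*-identityʳ (recip b))
  (trans (solveℚ 3 (λ r d b → r :*ℚ (d :*ℚ b) :=ℚ d :*ℚ (b :*ℚ r)) refl (recip b) d (ι b))
    (trans (cong (d ℚ.*_) (recip-inverse b)) (ℚ.*-identityʳ d)))
  (ℚL.*-monoˡ (ℚ.<⇒≤ (0<recip b)) h)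
  where open +-*-Solver using () renaming (solve to solveℚ; _:=_ to _:=ℚ_; _:*_ to _:*ℚ_)

-- The tester

uniformDistribution : ∀ n .{{_ : ℕ.NonZero n}} → Distribution n
uniformDistribution n = record
  { mass   = λ _ → fromℚ (recip n)
  ; nonneg = λ _ → fromℚ-mono (ℚ.<⇒≤ (0<recip n))
  ; total  = ≃-trans (∑-const n (fromℚ (recip n))) (≃-trans (*-comm (fromℕ n) (fromℚ (recip n))) (recip-real n))
  }

no-distribution : ¬ Distribution 0
no-distribution μ = 1≰0 (fromℚ-cancel (proj₂ (Distribution.total μ)))

emptyTest : NonAdaptiveTest 0
emptyTest = record { seeds = 1 ; queries = λ _ → [] ; accepts = λ _ _ → true }

module Parameters {ε δ : ℝ} (ε>0 : 0ℝ < ε) (δ>0 : 0ℝ < δ) (n : ℕ) where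

  εℚ δℚ : ℚ
  εℚ = proj₁ (magnitude ε>0)
  δℚ = proj₁ (magnitude δ>0)

  0<εℚ : 0ℚ ℚ.< εℚ
  0<εℚ = proj₁ (proj₂ (magnitude ε>0))
  0<δℚ : 0ℚ ℚ.< δℚ
  0<δℚ = proj₁ (proj₂ (magnitude δ>0))

  K b a : ℕ
  K = proj₁ (minimal-exponent n)
  b = proj₁ (minimal-multiple 0<εℚ)
  a = proj₁ (minimal-doubling 0<δℚ)

  n≤2^K : n ℕ.≤ 2 ℕ.^ K
  n≤2^K = proj₁ (proj₂ (minimal-exponent n))

  b≢0 : ℕ.NonZero b
  b≢0 = multiple-nonZero {εℚ} b (proj₁ (proj₂ (minimal-multiple 0<εℚ)))

  recip-b≤ε : fromℚ (recip b {{b≢0}}) ≤ ε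
  recip-b≤ε = ≤-trans (fromℚ-mono (recip-≤ {εℚ} b {{b≢0}} (proj₁ (proj₂ (minimal-multiple 0<εℚ)))))
    (proj₁ (proj₂ (proj₂ (magnitude ε>0))))

  2^a-large : 1ℚ ℚ.≤ δℚ ℚ.* ι (2 ℕ.^ a)
  2^a-large = proj₁ (proj₂ (minimal-doubling 0<δℚ))

  δℚ≤δ : fromℚ δℚ ≤ δ
  δℚ≤δ = proj₁ (proj₂ (proj₂ (magnitude δ>0)))

uniformityTest : ∀ ε δ → 0ℝ < ε → 0ℝ < δ → ∀ n → NonAdaptiveTest n
uniformityTest ε δ ε>0 δ>0 zero      = emptyTest
uniformityTest ε δ ε>0 δ>0 n@(suc _) = Test.collisionTest n K n≤2^K b {{b≢0}} a
  where open Parameters ε>0 δ>0 n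

uniformityTester : NonAdaptiveTester IsUniform
uniformityTester = record { test = uniformityTest ; complete = complete′ ; sound = sound′ }
  where
  complete′ : ∀ ε δ (ε>0 : 0ℝ < ε) (δ>0 : 0ℝ < δ) {n} (μ : Distribution n) (O : Oracle μ) →
              IsUniform n μ → 1ℝ - δ ≤ acceptPr (uniformityTest ε δ ε>0 δ>0 n) O
  complete′ ε δ ε>0 δ>0 {zero}      μ O unif = contradiction μ no-distribution
  complete′ ε δ ε>0 δ>0 {n@(suc _)} μ O unif =
    Test.accepts-uniform n K n≤2^K b {{b≢0}} a 2^a-large δℚ≤δ O unif
    where open Parameters ε>0 δ>0 n
  sound′ : ∀ ε δ (ε>0 : 0ℝ < ε) (δ>0 : 0ℝ < δ) {n} (μ : Distribution n) (O : Oracle μ) →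
           Far IsUniform ε μ → 1ℝ - δ ≤ rejectPr (uniformityTest ε δ ε>0 δ>0 n) O
  sound′ ε δ ε>0 δ>0 {zero}      μ O far = contradiction μ no-distribution
  sound′ ε δ ε>0 δ>0 {n@(suc _)} μ O far =
    Test.rejects-far n K n≤2^K b {{b≢0}} a 2^a-large δℚ≤δ O
      (≤-trans recip-b≤ε (far (uniformDistribution n) (λ _ → ≃-refl)))
    where open Parameters ε>0 δ>0 n

-- The number of queries

-- If the logarithm were below p then y would be at most 2^p.  The slack of 1 leaves
-- room for a decidable comparison.
log-≥ : ∀ {y} (1≤y : 1ℝ ≤ y) p → ¬ y ≤ fromℕ (2 ℕ.^ p) → fromℕ p ≤ log₂ y 1≤y + 1ℝ
log-≥ {y} 1≤y p ¬y≤ = go (compare ℓ (ℚ.+-monoʳ-< (ι p) (ℚ.neg-antimono-< {½} {1ℚ} (ℚ.*<* (+<+ (ℕ.s≤s (ℕ.s≤s ℕ.z≤n)))))))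
  where
  ℓ = log₂ y 1≤y
  go : fromℚ (ι p ℚ.- 1ℚ) ≤ ℓ ⊎ ℓ ≤ fromℚ (ι p ℚ.- ½) → fromℕ p ≤ ℓ + 1ℝ
  go (inj₁ h) = ≤-trans (proj₁ (≃-trans (termwise λ _ → solveℚ 1 (λ p → p :=ℚ (p :-ℚ conℚ 1ℚ) :+ℚ conℚ 1ℚ) refl (ι p)) (fromℚ-+ (ι p ℚ.- 1ℚ) 1ℚ)))
    (+-mono h ≤-refl)
    where open +-*-Solver using () renaming (solve to solveℚ; _:=_ to _:=ℚ_; _:+_ to _:+ℚ_; _:-_ to _:-ℚ_; con to conℚ)
  go (inj₂ h) = contradiction
    (≤-trans (proj₂ (*-identityʳ y)) (IsLog₂.upper (log₂-isLog₂ y 1≤y) p 1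
      (ℚ≤⇒< {fromℕ 1 * ℓ} {ι p ℚ.- ½} {ι p} (≤-trans (proj₁ (*-identityˡ ℓ)) h)
        (subst (ι p ℚ.- ½ ℚ.<_) (ℚ.+-identityʳ (ι p)) (ℚ.+-monoʳ-< (ι p) {ℚ.- ½} {0ℚ} (ℚ.negative⁻¹ (ℚ.- ½)))))))
    ¬y≤

fromℕ-* : ∀ m n → fromℕ (m ℕ.* n) ≃ fromℕ m * fromℕ n
fromℕ-* m n = ≃-trans (termwise λ _ → ι-* m n) (fromℚ-* (ι m) (ι n))

0≤fromℕ : ∀ n → 0ℝ ≤ fromℕ n
0≤fromℕ n = fromℚ-mono (0≤ι n)

module Counting {ε δ : ℝ} (ε>0 : 0ℝ < ε) (δ>0 : 0ℝ < δ) (ε<1 : ε < 1ℝ) (δ<1 : δ < 1ℝ) (n : ℕ) .{{n≢0 : ℕ.NonZero n}} where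

  open Parameters ε>0 δ>0 n
  open ≤-Reasoning

  X Y Z : ℝ
  X = log₂ (fromℕ n) (1≤fromℕ n)
  Y = ε ⁻¹⟨ ε>0 ⟩
  Z = log₂ (δ ⁻¹⟨ δ>0 ⟩) (1≤⁻¹ δ>0 δ<1)

  0≤X : 0ℝ ≤ X
  0≤X = IsLog₂.nonneg (log₂-isLog₂ (fromℕ n) (1≤fromℕ n))
  0≤Y : 0ℝ ≤ Y
  0≤Y = ⁻¹-nonneg ε>0
  0≤Z : 0ℝ ≤ Z
  0≤Z = IsLog₂.nonneg (log₂-isLog₂ (δ ⁻¹⟨ δ>0 ⟩) (1≤⁻¹ δ>0 δ<1))

  b≤5Y : fromℕ b ≤ fromℕ 5 * Y
  b≤5Y = go (proj₂ (proj₂ (minimal-multiple 0<εℚ)))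
    where
    go : b ≡ 0 ⊎ (∃ λ b′ → b ≡ suc b′ × ¬ 1ℚ ℚ.≤ εℚ ℚ.* ι b′) → fromℕ b ≤ fromℕ 5 * Y
    go (inj₁ b≡0) = subst (λ b → fromℕ b ≤ fromℕ 5 * Y) (sym b≡0) (0≤* (0≤fromℕ 5) 0≤Y)
    go (inj₂ (b′ , b≡ , ¬h)) = subst (λ b → fromℕ b ≤ fromℕ 5 * Y) (sym b≡) (begin
      fromℕ (suc b′)                     ≈⟨ fromℕ-suc b′ ⟩
      1ℝ + fromℕ b′                      ≈⟨ +-cong ≃-refl (≃-trans (≃-sym (*-identityʳ (fromℕ b′))) (*-congˡ {fromℕ b′} (≃-sym (⁻¹-inverse ε>0)))) ⟩
      1ℝ + fromℕ b′ * (ε * Y)            ≈⟨ +-cong ≃-refl (*-assoc (fromℕ b′) ε Y) ⟨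
      1ℝ + fromℕ b′ * ε * Y              ≤⟨ +-mono (1≤⁻¹ ε>0 ε<1) (*-monoˡ 0≤Y b′ε≤4) ⟩
      Y + fromℕ 4 * Y                    ≈⟨ solve 1 (λ y → y :+ con (ι 4) :* y := con (ι 5) :* y) ≃-refl Y ⟩
      fromℕ 5 * Y                        ∎)
      where
      b′ε≤4 : fromℕ b′ * ε ≤ fromℕ 4
      b′ε≤4 = begin
        fromℕ b′ * ε                               ≤⟨ *-monoʳ (0≤fromℕ b′) (proj₂ (proj₂ (proj₂ (magnitude ε>0)))) ⟩
        fromℕ b′ * fromℚ (ι 4 ℚ.* εℚ)              ≈⟨ *-congˡ {fromℕ b′} (fromℚ-* (ι 4) εℚ) ⟩
        fromℕ b′ * (fromℕ 4 * fromℚ εℚ)            ≈⟨ solve 2 (λ b e → b :* (con (ι 4) :* e) := con (ι 4) :* (e :* b)) ≃-refl (fromℕ b′) (fromℚ εℚ) ⟩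
        fromℕ 4 * (fromℚ εℚ * fromℕ b′)            ≈⟨ *-congˡ {fromℕ 4} (fromℚ-* εℚ (ι b′)) ⟨
        fromℕ 4 * fromℚ (εℚ ℚ.* ι b′)              ≤⟨ *-monoʳ (0≤fromℕ 4) (fromℚ-mono (ℚ.<⇒≤ (ℚ.≰⇒> ¬h))) ⟩
        fromℕ 4 * 1ℝ                               ≈⟨ *-identityʳ (fromℕ 4) ⟩
        fromℕ 4                                    ∎

  1+K≤X+3 : fromℕ (suc K) ≤ X + fromℕ 3
  1+K≤X+3 = go (proj₂ (proj₂ (minimal-exponent n)))
    where
    go : K ≡ 0 ⊎ (∃ λ K′ → K ≡ suc K′ × ¬ n ℕ.≤ 2 ℕ.^ K′) → fromℕ (suc K) ≤ X + fromℕ 3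
    go (inj₁ K≡0) = subst (λ K → fromℕ (suc K) ≤ X + fromℕ 3) (sym K≡0)
      (≤-trans (fromℚ-mono (ι-mono {1} {3} (ℕ.s≤s ℕ.z≤n))) (≤-trans (proj₂ (+-identityˡ (fromℕ 3))) (+-mono 0≤X ≤-refl)))
    go (inj₂ (K′ , K≡ , ¬h)) = subst (λ K → fromℕ (suc K) ≤ X + fromℕ 3) (sym K≡) (begin
      fromℕ (suc (suc K′))       ≈⟨ ≃-trans (fromℕ-suc (suc K′)) (+-cong ≃-refl (fromℕ-suc K′)) ⟩
      1ℝ + (1ℝ + fromℕ K′)       ≤⟨ +-monoʳ (+-monoʳ (log-≥ (1≤fromℕ n) K′ (λ h → ¬h (ι-cancel (fromℚ-cancel h))))) ⟩
      1ℝ + (1ℝ + (X + 1ℝ))       ≈⟨ solve 1 (λ x → con 1ℚ :+ (con 1ℚ :+ (x :+ con 1ℚ)) := x :+ con (ι 3)) ≃-refl X ⟩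
      X + fromℕ 3                ∎)

  -- Two doublings are lost because δ may be four times its approximation.
  a≤Z+4 : fromℕ a ≤ Z + fromℕ 4
  a≤Z+4 = go (proj₂ (proj₂ (minimal-doubling 0<δℚ)))
    where
    small : ∀ {k} → k ℕ.≤ 4 → fromℕ k ≤ Z + fromℕ 4
    small k≤4 = ≤-trans (fromℚ-mono (ι-mono k≤4)) (≤-trans (proj₂ (+-identityˡ (fromℕ 4))) (+-mono 0≤Z ≤-refl))
    large : ∀ a″ → ¬ 1ℚ ℚ.≤ δℚ ℚ.* ι (2 ℕ.^ suc (suc a″)) → ¬ δ ⁻¹⟨ δ>0 ⟩ ≤ fromℕ (2 ℕ.^ a″)
    large a″ ¬h δ⁻¹≤ = ¬h (fromℚ-cancel (begin
      1ℝ                                                ≈⟨ ⁻¹-inverse δ>0 ⟨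
      δ * δ ⁻¹⟨ δ>0 ⟩                                   ≤⟨ *-mono (0≤* (0≤fromℕ 4) (fromℚ-mono (ℚ.<⇒≤ 0<δℚ))) (⁻¹-nonneg δ>0)
                                                             (≤-trans (proj₂ (proj₂ (proj₂ (magnitude δ>0)))) (proj₁ (fromℚ-* (ι 4) δℚ))) δ⁻¹≤ ⟩
      fromℕ 4 * fromℚ δℚ * fromℕ (2 ℕ.^ a″)             ≈⟨ solve 2 (λ d p → con (ι 4) :* d :* p := d :* (con (ι 2) :* (con (ι 2) :* p))) ≃-refl (fromℚ δℚ) (fromℕ (2 ℕ.^ a″)) ⟩
      fromℚ δℚ * (fromℕ 2 * (fromℕ 2 * fromℕ (2 ℕ.^ a″)))
                                                        ≈⟨ *-congˡ {fromℚ δℚ} (≃-trans (fromℕ-* 2 (2 ℕ.^ suc a″)) (*-congˡ {fromℕ 2} (fromℕ-* 2 (2 ℕ.^ a″)))) ⟨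
      fromℚ δℚ * fromℕ (2 ℕ.^ suc (suc a″))             ≈⟨ fromℚ-* δℚ (ι (2 ℕ.^ suc (suc a″))) ⟨
      fromℚ (δℚ ℚ.* ι (2 ℕ.^ suc (suc a″)))             ∎))
    split : ∀ a′ → ¬ 1ℚ ℚ.≤ δℚ ℚ.* ι (2 ℕ.^ a′) → fromℕ (suc a′) ≤ Z + fromℕ 4
    split zero            _  = small (ℕ.s≤s ℕ.z≤n)
    split (suc zero)      _  = small (ℕ.s≤s (ℕ.s≤s ℕ.z≤n))
    split (suc (suc a″))  ¬h = begin
      fromℕ (suc (suc (suc a″)))       ≈⟨ ≃-trans (fromℕ-suc (suc (suc a″))) (+-cong ≃-refl (≃-trans (fromℕ-suc (suc a″)) (+-cong ≃-refl (fromℕ-suc a″)))) ⟩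
      1ℝ + (1ℝ + (1ℝ + fromℕ a″))      ≤⟨ +-monoʳ (+-monoʳ (+-monoʳ (log-≥ (1≤⁻¹ δ>0 δ<1) a″ (large a″ ¬h)))) ⟩
      1ℝ + (1ℝ + (1ℝ + (Z + 1ℝ)))      ≈⟨ solve 1 (λ z → con 1ℚ :+ (con 1ℚ :+ (con 1ℚ :+ (z :+ con 1ℚ))) := z :+ con (ι 4)) ≃-refl Z ⟩
      Z + fromℕ 4                      ∎
    go : a ≡ 0 ⊎ (∃ λ a′ → a ≡ suc a′ × ¬ 1ℚ ℚ.≤ δℚ ℚ.* ι (2 ℕ.^ a′)) → fromℕ a ≤ Z + fromℕ 4
    go (inj₁ a≡0)             = subst (λ a → fromℕ a ≤ Z + fromℕ 4) (sym a≡0) (small ℕ.z≤n)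
    go (inj₂ (a′ , a≡ , ¬h))  = subst (λ a → fromℕ a ≤ Z + fromℕ 4) (sym a≡) (split a′ ¬h)

-- There are 2 · 256 (15552 b⁴ (K + 1))² a queries, where b ≤ 5 Y, K + 1 ≤ X + 3 and
-- a ≤ Z + 4; the last factor of c₀ is 5⁸.
c₀ : ℝ
c₀ = fromℕ 2 * (fromℕ 15552 * fromℕ 15552 * fromℕ 256) * fromℕ 390625

queryPolynomial : Polynomial₃
queryPolynomial =
  (c₀ , 2 , 8 , 1) ∷ (fromℕ 4 * c₀ , 2 , 8 , 0) ∷ (fromℕ 6 * c₀ , 1 , 8 , 1) ∷
  (fromℕ 24 * c₀ , 1 , 8 , 0) ∷ (fromℕ 9 * c₀ , 0 , 8 , 1) ∷ (fromℕ 36 * c₀ , 0 , 8 , 0) ∷ []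

queryPolynomial-factored : ∀ X Y Z → eval queryPolynomial X Y Z ≃
                           c₀ * Y ^ 8 * ((X + fromℕ 3) * (X + fromℕ 3)) * (Z + fromℕ 4)
queryPolynomial-factored X Y Z = solve 4 (λ c x w z →
    let x² = x :* (x :* con 1ℚ)
        x¹ = x :* con 1ℚ
        z¹ = z :* con 1ℚ
        one = con 1ℚ
    in c :* x² :* w :* z¹ :+ (con (ι 4) :* c :* x² :* w :* one :+ (con (ι 6) :* c :* x¹ :* w :* z¹ :+
       (con (ι 24) :* c :* x¹ :* w :* one :+ (con (ι 9) :* c :* one :* w :* z¹ :+
       (con (ι 36) :* c :* one :* w :* one :+ con 0ℚ)))))
    := c :* w :* ((x :+ con (ι 3)) :* (x :+ con (ι 3))) :* (z :+ con (ι 4))) ≃-refl c₀ X (Y ^ 8) Z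

theorem4p1p1 : ∃ λ (p : Polynomial₃) → ∃ λ (T : NonAdaptiveTester IsUniform) →
    ∀ (ε δ : ℝ) (ε>0 : 0ℝ < ε) (δ>0 : 0ℝ < δ) → ε < 1ℝ → (δ<1 : δ < 1ℝ) →
    ∀ (n : ℕ) .{{_ : ℕ.NonZero n}} →
    ∀ (r : Fin (seeds (test T ε δ ε>0 δ>0 n))) →
    fromℕ (length (queries (test T ε δ ε>0 δ>0 n) r))
    ≤ eval p (log₂ (fromℕ n) (1≤fromℕ n))
    (ε ⁻¹⟨ ε>0 ⟩)
    (log₂ (δ ⁻¹⟨ δ>0 ⟩) (1≤⁻¹ δ>0 δ<1))
theorem4p1p1 = queryPolynomial , uniformityTester , bounded-queries
  where
  bounded-queries : ∀ (ε δ : ℝ) (ε>0 : 0ℝ < ε) (δ>0 : 0ℝ < δ) → ε < 1ℝ → (δ<1 : δ < 1ℝ) →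
    ∀ (n : ℕ) .{{_ : ℕ.NonZero n}} →
    ∀ (r : Fin (seeds (uniformityTest ε δ ε>0 δ>0 n))) →
    fromℕ (length (queries (uniformityTest ε δ ε>0 δ>0 n) r))
    ≤ eval queryPolynomial (log₂ (fromℕ n) (1≤fromℕ n)) (ε ⁻¹⟨ ε>0 ⟩) (log₂ (δ ⁻¹⟨ δ>0 ⟩) (1≤⁻¹ δ>0 δ<1))
  bounded-queries ε δ ε>0 δ>0 ε<1 δ<1 n@(suc _) r = begin
    fromℕ (length (queries (uniformityTest ε δ ε>0 δ>0 n) r))
      ≡⟨ cong fromℕ (Trials.length-queriesOf T.trial query (draw T.experiment r)) ⟩
    fromℕ (2 ℕ.* T.N)
      ≈⟨ expand ⟩
    κ * (B * B * B * B * (B * B * B * B)) * (L * L) * A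
      ≤⟨ *-mono (0≤* (0≤* 0≤κ (0≤B⁸ 0≤5Y)) (0≤* 0≤X+3 0≤X+3)) (0≤fromℕ a)
           (*-mono (0≤* 0≤κ (0≤B⁸ 0≤5Y)) (0≤* (0≤fromℕ (suc K)) (0≤fromℕ (suc K)))
             (*-monoʳ 0≤κ (*-mono (0≤B⁴ 0≤5Y) (0≤B⁴ (0≤fromℕ b)) fourth fourth))
             (*-mono 0≤X+3 (0≤fromℕ (suc K)) 1+K≤X+3 1+K≤X+3))
           a≤Z+4 ⟩
    κ * (W * W * W * W * (W * W * W * W)) * ((X + fromℕ 3) * (X + fromℕ 3)) * (Z + fromℕ 4)
      ≈⟨ solve 4 (λ k y x z → k :* (w y :* w y :* w y :* w y :* (w y :* w y :* w y :* w y)) :* x :* z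
           := k :* con (ι 390625) :* (y :* (y :* (y :* (y :* (y :* (y :* (y :* (y :* con 1ℚ)))))))) :* x :* z)
           ≃-refl κ Y ((X + fromℕ 3) * (X + fromℕ 3)) (Z + fromℕ 4) ⟩
    c₀ * Y ^ 8 * ((X + fromℕ 3) * (X + fromℕ 3)) * (Z + fromℕ 4)
      ≈⟨ queryPolynomial-factored X Y Z ⟨
    eval queryPolynomial X Y Z ∎
    where
    open ≤-Reasoning
    open Parameters ε>0 δ>0 n
    open Counting ε>0 δ>0 ε<1 δ<1 n
    module T = Test n K n≤2^K b {{b≢0}} a
    w : ∀ {m} → Polynomial m → Polynomial m
    w y = con (ι 5) :* y
    κ B L A W : ℝ
    κ = fromℕ 2 * (fromℕ 15552 * fromℕ 15552 * fromℕ 256)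
    B = fromℕ b
    L = fromℕ (suc K)
    A = fromℕ a
    W = fromℕ 5 * Y
    0≤κ : 0ℝ ≤ κ
    0≤κ = 0≤* (0≤fromℕ 2) (0≤* (0≤* (0≤fromℕ 15552) (0≤fromℕ 15552)) (0≤fromℕ 256))
    0≤5Y : 0ℝ ≤ W
    0≤5Y = 0≤* (0≤fromℕ 5) 0≤Y
    0≤X+3 : 0ℝ ≤ X + fromℕ 3
    0≤X+3 = +-nonneg 0≤X (0≤fromℕ 3)
    0≤B⁴ : ∀ {z} → 0ℝ ≤ z → 0ℝ ≤ z * z * z * z
    0≤B⁴ h = 0≤* (0≤* (0≤* h h) h) h
    0≤B⁸ : ∀ {z} → 0ℝ ≤ z → 0ℝ ≤ z * z * z * z * (z * z * z * z)
    0≤B⁸ h = 0≤* (0≤B⁴ h) (0≤B⁴ h)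
    fourth : B * B * B * B ≤ W * W * W * W
    fourth = *-mono (0≤* (0≤* 0≤5Y 0≤5Y) 0≤5Y) (0≤fromℕ b)
      (*-mono (0≤* 0≤5Y 0≤5Y) (0≤fromℕ b) (*-mono 0≤5Y (0≤fromℕ b) b≤5Y b≤5Y) b≤5Y) b≤5Y
    D-real : fromℕ T.D ≃ B * B * B * B * L * fromℕ 15552
    D-real = ≃-trans (fromℕ-* (b ℕ.* b ℕ.* b ℕ.* b ℕ.* suc K) 15552) (*-cong
      (≃-trans (fromℕ-* (b ℕ.* b ℕ.* b ℕ.* b) (suc K)) (*-cong
        (≃-trans (fromℕ-* (b ℕ.* b ℕ.* b) b) (*-cong (≃-trans (fromℕ-* (b ℕ.* b) b) (*-cong (fromℕ-* b b) ≃-refl)) ≃-refl)) ≃-refl)) ≃-refl)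
    expand : fromℕ (2 ℕ.* T.N) ≃ κ * (B * B * B * B * (B * B * B * B)) * (L * L) * A
    expand = ≃-trans (≃-trans (fromℕ-* 2 T.N) (*-congˡ {fromℕ 2} (≃-trans (fromℕ-* T.m a) (*-cong
        (≃-trans (fromℕ-* (T.D ℕ.* T.D) 256) (*-cong (≃-trans (fromℕ-* T.D T.D) (*-cong D-real D-real)) ≃-refl)) ≃-refl))))
      (solve 5 (λ f b l a g → con (ι 2) :* (((b :* b :* b :* b :* l :* f) :* (b :* b :* b :* b :* l :* f) :* g) :* a)
         := con (ι 2) :* (f :* f :* g) :* (b :* b :* b :* b :* (b :* b :* b :* b)) :* (l :* l) :* a) ≃-refl
         (fromℕ 15552) B L A (fromℕ 256))
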